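{- Let $M=p_1^{n_1}\cdots p_d^{n_d}$, where $p_1<\dots<p_d$ are distinct primes and $n_1,\dots,n_d\in\mathbb{N}$ (so $n_i\ge 1$). Assume that $p_j>2^{j-2}$ for all $j\in\{6,\dots,d\}$. Then for every nonempty set $A\subset\mathbb{Z}_M$ such that $\Phi_M(X)$ divides $A(X)$, there exists $i\in\{1,\dots,d\}$ such that $M/p_i\in\mathrm{Div}(A)$. Consequently, for any tiling $A\oplus B=\mathbb{Z}_M$ there exists $i\in\{1,\dots,d\}$ such that $M/p_i\in\mathrm{Div}(A)\cup\mathrm{Div}(B)$.
   Context: Elements of $\mathbb{Z}_M$ are represented by integers in $\{0,1,\dots,M-1\}$. For a set $A\subset\mathbb{Z}_M$, its mask polynomial is $A(X)=\sum_{a\in A}X^a$; $\Phi_M(X)$ denotes the $M$-th cyclotomic polynomial (divisibility of $A(X)$ by $\Phi_M$ does not depend on the choice of representatives since $\Phi_M\mid X^M-1$). For $m,n\in\mathbb{Z}$, $(m,n)$ denotes their greatest common divisor. The divisor set of $A$ is $\mathrm{Div}(A)=\{(a-a',M): a,a'\in A\}$. For $A,B\subset\mathbb{Z}_M$, we write $A\oplus B=\mathbb{Z}_M$ (a tiling) if every element of $\mathbb{Z}_M$ can be written uniquely as $a+b \bmod M$ with $a\in A$, $b\in B$. -}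

module Defs where

open import Data.Nat as ℕ using (ℕ; zero; suc; _≤?_; _∸_)
open import Data.Nat.Divisibility using (_∣?_)
open import Data.Nat.GCD using (gcd)
open import Data.Integer as ℤ using (ℤ; +_; -[1+_])
open import Data.List using (List; []; _∷_; map; length; reverse; replicate; _++_; foldr; lookup)
open import Data.Bool using (Bool; true; false; if_then_else_)
open import Data.Fin using (Fin; toℕ)
open import Data.Fin.Subset using (Subset; _∈_)
open import Data.Vec using (Vec; []; _∷_)
open import Data.Sum using (_⊎_)
open import Data.Product using (_×_; _,_; ∃-syntax; Σ-syntax)
open import Relation.Nullary using (yes; no)
open import Relation.Nullary.Decidable using (⌊_⌋)
open import Relation.Binary.PropositionalEquality using (_≡_)

-- Polynomials over ℤ: coefficient lists, lowest degree first.
-- Trailing zeros are allowed; equality is coefficientwise (_≈P_).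

Poly : Set
Poly = List ℤ

coeff : Poly → ℕ → ℤ
coeff []       _       = + 0
coeff (a ∷ p)  zero    = a
coeff (a ∷ p)  (suc i) = coeff p i

_≈P_ : Poly → Poly → Set
p ≈P q = ∀ i → coeff p i ≡ coeff q i

infixl 6 _+P_
infixl 7 _*P_

_+P_ : Poly → Poly → Poly
[]      +P q       = q
(a ∷ p) +P []      = a ∷ p
(a ∷ p) +P (b ∷ q) = (a ℤ.+ b) ∷ (p +P q)

scaleP : ℤ → Poly → Poly
scaleP c = map (c ℤ.*_)

_*P_ : Poly → Poly → Poly
[]      *P q = []
(a ∷ p) *P q = scaleP a q +P (+ 0 ∷ (p *P q))

xpowMinus1 : ℕ → Poly
xpowMinus1 n = (replicate n (+ 0) ++ (+ 1 ∷ [])) +P (-[1+ 0 ] ∷ [])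

strip : Poly → Poly
strip p = reverse (dropZ (reverse p))
  where
  dropZ : List ℤ → List ℤ
  dropZ []            = []
  dropZ (+ 0 ∷ xs)    = dropZ xs
  dropZ (x ∷ xs)      = x ∷ xs

-- Long division by a monic polynomial (exact quotient when divisible).
-- Lists here are highest degree first; ds is the divisor without its leading 1.
private
  subFront : ℤ → List ℤ → List ℤ → List ℤ
  subFront c []       rs       = rs
  subFront c (d ∷ ds) []       = []
  subFront c (d ∷ ds) (r ∷ rs) = (r ℤ.- c ℤ.* d) ∷ subFront c ds rs

  divH : ℕ → List ℤ → List ℤ → List ℤ
  divH zero    ds _        = []
  divH (suc f) ds []       = []
  divH (suc f) ds (c ∷ rs) with length ds ≤? length rs
  ... | yes _ = c ∷ divH f ds (subFront c ds rs)
  ... | no  _ = []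

  tailL : List ℤ → List ℤ
  tailL []       = []
  tailL (_ ∷ xs) = xs

divMonic : Poly → Poly → Poly
divMonic p d = reverse (divH (length p) (tailL (reverse (strip d))) (reverse (strip p)))

-- Cyclotomic polynomials, by the recursion X^n - 1 = ∏_{d ∣ n} Φ_d,
-- i.e. Φ_n = (X^n - 1) / ∏_{d ∣ n, d < n} Φ_d.

private
  Table : Set
  Table = List (ℕ × Poly)

  prodDiv : ℕ → Table → Poly
  prodDiv n = foldr (λ { (d , φ) acc → if ⌊ d ∣? n ⌋ then φ *P acc else acc }) (+ 1 ∷ [])

  table : ℕ → Table
  table zero    = []
  table (suc n) = table n ++ ((suc n , divMonic (xpowMinus1 (suc n)) (prodDiv (suc n) (table n))) ∷ [])

  findT : ℕ → Table → Poly
  findT n []             = []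
  findT n ((d , φ) ∷ ts) = if ⌊ d ℕ.≟ n ⌋ then φ else findT n ts

Φ : ℕ → Poly
Φ n = findT n (table n)

_∣P_ : Poly → Poly → Set
f ∣P g = ∃[ q ] (g ≈P (f *P q))

-- Subsets of ℤ_M (elements 0..M-1) as Data.Fin.Subset M.

mask : ∀ {M} → Subset M → Poly
mask []          = []
mask (b ∷ s)     = (if b then + 1 else + 0) ∷ mask s

-- the integer (a - a', M) ; adding M does not change the gcd
gcdDiff : (M : ℕ) → Fin M → Fin M → ℕ
gcdDiff M a a' = gcd ((toℕ a ℕ.+ M) ∸ toℕ a') M

InDiv : (M : ℕ) → ℕ → Subset M → Set
InDiv M m A = ∃[ a ] ∃[ a' ] (a ∈ A × a' ∈ A × gcdDiff M a a' ≡ m)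

_≡_[modℕ_] : ℕ → ℕ → ℕ → Set
u ≡ v [modℕ M ] = ∃[ k ] ((u ≡ v ℕ.+ k ℕ.* M) ⊎ (v ≡ u ℕ.+ k ℕ.* M))

IsTiling : (M : ℕ) → Subset M → Subset M → Set
IsTiling M A B =
  (∀ (x : Fin M) → ∃[ a ] ∃[ b ] (a ∈ A × b ∈ B × (toℕ a ℕ.+ toℕ b) ≡ toℕ x [modℕ M ]))
  × (∀ a a' b b' → a ∈ A → a' ∈ A → b ∈ B → b' ∈ B →
       (toℕ a ℕ.+ toℕ b) ≡ (toℕ a' ℕ.+ toℕ b') [modℕ M ] → (a ≡ a') × (b ≡ b'))

prodFin : (d : ℕ) → (Fin d → ℕ) → ℕ
prodFin zero    f = 1
prodFin (suc d) f = f Fin.zero ℕ.* prodFin d (λ i → f (Fin.suc i))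
  where import Data.Fin as Fin

{-# OPTIONS --safe #-}

-- Let W = ∏ (X^(M/p_i) - 1), let polynomials act on sequences by shifts, and let g_A(k) be the number
-- of a ∈ A with M ∣ k + a. Suppose that no M/p_i lies in Div(A). Then a line k + c M/p_i, 0 ≤ c < p_i,
-- meets the support of g_A at most once. Starting from k₀ with g_A(k₀) > 0, choose c_1, c_2, … in turn
-- so that g_A vanishes at all k₀ + ∑_{j ∈ S} c_j M/p_j with |S| odd: at stage j at most 2^(j-2) < p_j
-- values are excluded. The alternating sum of g_A over this cuboid is positive, so W does not
-- annihilate g_A. But X^M - 1 divides Φ_M W, so W annihilates g_A when Φ_M divides A(X).
--
-- Since Φ_n is defined by long division, X^n - 1 = ∏_{d ∣ n} Φ_d needs a proof: the earlier Φ_d are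
-- pairwise coprime up to a nonzero integer, so their product divides a multiple of X^n - 1, and
-- division by a monic polynomial cancels the integer factor.
--
-- For a tiling the irreducibility of Φ_M is not needed: one shows directly that W annihilates g_A or
-- g_B. By the Frobenius congruence, tA ⊕ B is a tiling for all t prime to M, so H = W g_B satisfies
-- ∑_{a ∈ A} H(k + t a) = 0. Summing over these t gives H(k) ∑_a c(l + a) = 0 with c the Ramanujan sum
-- modulo M. As W c = M W δ, where δ is the indicator of M ℤ, a nonzero value of H forces W g_A = 0.

module Submission where

open import Defs
open import Data.Nat using (ℕ; _≤_; _<_; _^_; _∸_; _/_)
open import Data.Nat.Primality using (Prime; prime⇒nonZero)
open import Data.Fin using (Fin; toℕ)
open import Data.Fin.Subset using (Subset; Nonempty)
open import Data.Product using (_×_; ∃-syntax)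
open import Data.Sum using (_⊎_)
open import Relation.Binary.PropositionalEquality using (_≡_)

open import Algebra.Bundles using (CommutativeRing)
open import Data.Bool using (Bool; true; false; if_then_else_; _∧_; not)
open import Data.Bool.Properties using (∧-conicalˡ; ∧-conicalʳ; ∧-zeroʳ)
open import Data.Empty using (⊥; ⊥-elim)
import Data.Fin as Fin
import Data.Fin.Properties as Fin
open import Data.Fin.Subset using (_∈_)
open import Data.Fin.Subset.Properties using (_∈?_)
open import Data.Integer as ℤ using (ℤ; 0ℤ; 1ℤ; -1ℤ)
import Data.Integer.Properties as ℤP
open import Data.Integer.Tactic.RingSolver using () renaming (solve-∀ to ℤ-solve)
open import Data.List using (List; []; _∷_; _++_; map; foldr; foldl; length; reverse; replicate; lookup; tabulate)
import Data.List.Properties as LP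
open import Data.List.Membership.Propositional using () renaming (_∈_ to _∈ₗ_)
open import Data.List.Relation.Unary.All as All using (All)
import Data.List.Relation.Unary.All.Properties as All
open import Data.List.Relation.Unary.AllPairs as AP using (AllPairs)
import Data.List.Relation.Unary.AllPairs.Properties as AP
open import Data.List.Relation.Unary.Any as Any using (Any; here; there)
import Data.List.Relation.Unary.Any.Properties as Any
open import Data.Maybe using (Maybe; just; nothing)
open import Data.Nat as ℕ using (zero; suc; _+_; _*_; _%_; _!; z≤n; s≤s; NonZero; _≤?_; _<?_; _≟_)
open import Data.Nat.Combinatorics using (nCn≡1; nCk≡n!/k![n-k]!; k![n∸k]!∣n!) renaming (_C_ to _choose_)
open import Data.Nat.Coprimality using (prime⇒coprime; coprime⇒gcd≡1)
open import Data.Nat.Divisibility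
open import Data.Nat.DivMod using (m*[n/m]≡n; m/n*n≡m; m%n<n; m≡m%n+[m/n]*n)
open import Data.Nat.GCD
open import Data.Nat.Induction using (<-rec)
open import Data.Nat.ListAction using (product)
open import Data.Nat.ListAction.Properties using (∈⇒∣product)
open import Data.Nat.Primality using (¬prime[1]; euclidsLemma; prime⇒irreducible; prime⇒nonTrivial)
open import Data.Nat.Primality.Factorisation using (factorise; module PrimeFactorisation)
import Data.Nat.Properties as ℕP
open import Data.Nat.Tactic.RingSolver using () renaming (solve-∀ to ℕ-solve)
open import Data.Product using (_,_; ∃; ∃₂; proj₁; proj₂)
open import Data.Sum using (inj₁; inj₂; [_,_]′)
open import Data.Vec using ([]; _∷_)
import Data.Vec as Vec
open import Function using (_∘_; id; case_of_; it)
open import Relation.Binary.Bundles using (Setoid)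
open import Relation.Binary.Definitions using (tri<; tri≈; tri>)
open import Relation.Binary.PropositionalEquality using (_≢_; refl; sym; trans; cong; cong₂; subst; subst₂; module ≡-Reasoning)
import Relation.Binary.Reasoning.Setoid as SetoidReasoning
open import Relation.Nullary using (Dec; yes; no; ¬_; contradiction)
open import Relation.Nullary.Decidable using (⌊_⌋; _×-dec_; decidable-stable)
open import Tactic.RingSolver using (solve-∀)
open import Tactic.RingSolver.Core.AlmostCommutativeRing using (AlmostCommutativeRing; fromCommutativeRing)

-- Private definitions of Defs

-- These definitions cannot be named here. Each is obtained as the solution of a metavariable in the
-- equation below it: with-abstraction turns the arguments (and _++_ or foldl) into variables, which
-- makes the equation a pattern unification problem.

-- Behind the tiling argument stands Fourier analysis on ℤ_M, carried out with integer identities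
-- only. W(ζ) = 0 for every M-th root of unity ζ that is not primitive: its order is a proper
-- divisor of M and so divides some M/p_i. Thus W g keeps just the primitive frequencies of g. For
-- each of these the sum of ζ^(t m) over the t prime to M has the same value c(m), so the sum of H(k
-- + t m) over these t is c(m) H(k). Likewise c is the sum of the primitive characters and M δ the
-- sum of all characters, whence W c = M W δ. Irreducibility would pass from Φ_M ∣ A(X) B(X) to one
-- of the factors; the sum over the dilations t replaces it, as a sum over Galois conjugates would.
-- The bound 2^(j-2) arises because only the even half of the 2^(j-1) vertices present at stage j
-- restricts c_j. For j ≤ 5 it holds for any increasing primes.

Table : Set
Table = List (ℕ × Poly)

mutual
  findT-of : (Table → Table → Table) → ℕ → ℕ → Poly
  findT-of = _

  findT-of-eq : ∀ n → Φ (suc n) ≡ findT-of _++_ (suc n) n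
  findT-of-eq n with _++_ {A = ℕ × Poly} | suc n
  ... | app | x = refl

findT : ℕ → Table → Poly
-- `findT-of app x n` looks `x` up in the list that `app` forms from `table n` and the next entry; a
-- constant `app` puts an arbitrary `ts` in its place.
findT x ts = findT-of (λ _ _ → ts) x 0

mutual
  table : ℕ → Table
  table = _

  Φ-table : ∀ n → Φ n ≡ findT n (table n)
  Φ-table n with findT
  ... | f = refl

mutual
  prodDiv : ℕ → Table → Poly
  prodDiv = _

  table-suc : ∀ n → table (suc n) ≡
    table n ++ ((suc n , divMonic (xpowMinus1 (suc n)) (prodDiv (suc n) (table n))) ∷ [])
  table-suc n with table n | suc n | foldl {A = List ℤ} {B = ℤ}
  ... | ts | x | fold = refl

mutual
  strip-of : ((List ℤ → ℤ → List ℤ) → List ℤ → List ℤ → List ℤ) → Poly → List ℤ → Poly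
  strip-of = _

  strip-of-eq : ∀ p → strip p ≡ strip-of foldl p (reverse p)
  strip-of-eq p with reverse p
  ... | q with foldl {A = List ℤ} {B = ℤ}
  ... | fold = refl

dropZ : List ℤ → List ℤ → List ℤ
-- `reverse` is a left fold, so a fold that returns its list removes the outer `reverse`. The first
-- argument of `dropZ` is the `p` of `strip p`, over which the local function is abstracted.
dropZ = strip-of (λ _ _ xs → xs)

strip-eq : ∀ p → strip p ≡ reverse (dropZ p (reverse p))
strip-eq p = refl

mutual
  divH-of : ((List ℤ → ℤ → List ℤ) → List ℤ → List ℤ → List ℤ) → ℕ → List ℤ → List ℤ → List ℤ
  divH-of = _

  divH-of-eq : ∀ p d → divMonic p d ≡ divH-of foldl (length p) (reverse (strip d)) (reverse (strip p))
  divH-of-eq p d with length p | reverse (strip d) | reverse (strip p)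
  ... | n | ds | cs with foldl {A = List ℤ} {B = ℤ}
  ... | fold = refl

divH : ℕ → List ℤ → List ℤ → List ℤ
-- The solution takes the whole divisor and drops its head, so a leading 1 is put back.
divH n ds = divH-of (λ _ _ xs → xs) n (ℤ.+ 1 ∷ ds)

divMonic-eq : ∀ p d {c ds} → reverse (strip d) ≡ c ∷ ds →
  divMonic p d ≡ reverse (divH (length p) ds (reverse (strip p)))
divMonic-eq p d eq with reverse (strip d) | eq
... | _ | refl = refl

mutual
  subFront : ℤ → List ℤ → List ℤ → List ℤ
  subFront = _

  divH-step : ∀ n ds c rs → length ds ≤ length rs →
    divH (suc n) ds (c ∷ rs) ≡ c ∷ divH n ds (subFront c ds rs)
  divH-step n ds c rs le with length ds ≤? length rs
  ... | yes _ = refl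
  ... | no ¬le = contradiction le ¬le

divH-[] : ∀ n ds → divH n ds [] ≡ []
divH-[] zero ds = refl
divH-[] (suc n) ds = refl

-- The ring of polynomials

infixr 5 _⋆_

-- X acts as the shift; identities between polynomials are proved as identities of operators.
_⋆_ : Poly → (ℕ → ℤ) → ℕ → ℤ
([] ⋆ h) k = 0ℤ
((a ∷ f) ⋆ h) k = a ℤ.* h k ℤ.+ (f ⋆ h) (suc k)

⋆-cong : ∀ f {h h′} → (∀ k → h k ≡ h′ k) → ∀ k → (f ⋆ h) k ≡ (f ⋆ h′) k
⋆-cong [] eq k = refl
⋆-cong (a ∷ f) eq k = cong₂ (λ u v → a ℤ.* u ℤ.+ v) (eq k) (⋆-cong f eq (suc k))

⋆-0 : ∀ f k → (f ⋆ λ _ → 0ℤ) k ≡ 0ℤ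
⋆-0 [] k = refl
⋆-0 (a ∷ f) k = trans (cong₂ ℤ._+_ (ℤP.*-zeroʳ a) (⋆-0 f (suc k))) refl

⋆-+ : ∀ f g h k → ((f +P g) ⋆ h) k ≡ (f ⋆ h) k ℤ.+ (g ⋆ h) k
⋆-+ [] g h k = sym (ℤP.+-identityˡ _)
⋆-+ (a ∷ f) [] h k = sym (ℤP.+-identityʳ _)
⋆-+ (a ∷ f) (b ∷ g) h k rewrite ⋆-+ f g h (suc k) = lemma a b (h k) ((f ⋆ h) (suc k)) ((g ⋆ h) (suc k))
  where
  lemma : ∀ a b x u v → (a ℤ.+ b) ℤ.* x ℤ.+ (u ℤ.+ v) ≡ a ℤ.* x ℤ.+ u ℤ.+ (b ℤ.* x ℤ.+ v)
  lemma = ℤ-solve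

⋆-scale : ∀ c f h k → (scaleP c f ⋆ h) k ≡ c ℤ.* (f ⋆ h) k
⋆-scale c [] h k = sym (ℤP.*-zeroʳ c)
⋆-scale c (a ∷ f) h k rewrite ⋆-scale c f h (suc k) = lemma c a (h k) ((f ⋆ h) (suc k))
  where
  lemma : ∀ c a x u → c ℤ.* a ℤ.* x ℤ.+ c ℤ.* u ≡ c ℤ.* (a ℤ.* x ℤ.+ u)
  lemma = ℤ-solve

⋆-* : ∀ f g h k → ((f *P g) ⋆ h) k ≡ (f ⋆ (g ⋆ h)) k
⋆-* [] g h k = refl
⋆-* (a ∷ f) g h k
  rewrite ⋆-+ (scaleP a g) (0ℤ ∷ (f *P g)) h k | ⋆-scale a g h k | ⋆-* f g h (suc k)
  = cong (λ v → a ℤ.* (g ⋆ h) k ℤ.+ v) (ℤP.+-identityˡ _)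

⋆-shift : ∀ f h m k → (f ⋆ (λ i → h (i + m))) k ≡ (f ⋆ h) (k + m)
⋆-shift [] h m k = refl
⋆-shift (a ∷ f) h m k = cong (λ v → a ℤ.* h (k + m) ℤ.+ v) (⋆-shift f h m (suc k))

⋆-linear : ∀ f a h h′ k → (f ⋆ (λ i → a ℤ.* h i ℤ.+ h′ i)) k ≡ a ℤ.* (f ⋆ h) k ℤ.+ (f ⋆ h′) k
⋆-linear [] a h h′ k = sym (trans (ℤP.+-identityʳ _) (ℤP.*-zeroʳ a))
⋆-linear (b ∷ f) a h h′ k rewrite ⋆-linear f a h h′ (suc k)
  = lemma b a (h k) (h′ k) ((f ⋆ h) (suc k)) ((f ⋆ h′) (suc k))
  where
  lemma : ∀ b a x y u v → b ℤ.* (a ℤ.* x ℤ.+ y) ℤ.+ (a ℤ.* u ℤ.+ v)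
    ≡ a ℤ.* (b ℤ.* x ℤ.+ u) ℤ.+ (b ℤ.* y ℤ.+ v)
  lemma = ℤ-solve

⋆-suc : ∀ f h k → (f ⋆ (λ i → h (suc i))) k ≡ (f ⋆ h) (suc k)
⋆-suc f h k = trans (⋆-cong f (λ i → cong h (sym (ℕP.+-comm i 1))) k)
  (trans (⋆-shift f h 1 k) (cong (f ⋆ h) (ℕP.+-comm k 1)))

⋆-comm : ∀ f g h k → (f ⋆ (g ⋆ h)) k ≡ (g ⋆ (f ⋆ h)) k
⋆-comm [] g h k = sym (⋆-0 g k)
⋆-comm (a ∷ f) g h k = sym (trans (⋆-linear g a h (λ i → (f ⋆ h) (suc i)) k)
  (cong (λ v → a ℤ.* (g ⋆ h) k ℤ.+ v) (trans (⋆-suc g (f ⋆ h) k) (sym (⋆-comm f g h (suc k))))))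

infix 4 _≋_

-- Equality as operators agrees with equality of coefficients (`≋⇒≈P`, `≈P⇒≋`) and turns the ring
-- axioms into pointwise identities in ℤ. As a record it lets unification recover the two
-- polynomials.
record _≋_ (f g : Poly) : Set where
  constructor by
  field at : ∀ h k → (f ⋆ h) k ≡ (g ⋆ h) k

open _≋_ public

≋-setoid : Setoid _ _
≋-setoid = record
  { Carrier = Poly ; _≈_ = _≋_
  ; isEquivalence = record
    { refl = by λ _ _ → refl
    ; sym = λ e → by λ h k → sym (at e h k)
    ; trans = λ e e′ → by λ h k → trans (at e h k) (at e′ h k) } }

open Setoid ≋-setoid public using () renaming (refl to ≋-refl; sym to ≋-sym; trans to ≋-trans)

negP : Poly → Poly
negP = scaleP -1ℤ

+P-cong : ∀ {f f′ g g′} → f ≋ f′ → g ≋ g′ → f +P g ≋ f′ +P g′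
+P-cong {f} {f′} {g} {g′} e e′ = by λ h k → trans (⋆-+ f g h k)
  (trans (cong₂ ℤ._+_ (at e h k) (at e′ h k)) (sym (⋆-+ f′ g′ h k)))

*P-cong : ∀ {f f′ g g′} → f ≋ f′ → g ≋ g′ → f *P g ≋ f′ *P g′
*P-cong {f} {f′} {g} {g′} e e′ = by λ h k → trans (⋆-* f g h k)
  (trans (at e (g ⋆ h) k) (trans (⋆-cong f′ (at e′ h) k) (sym (⋆-* f′ g′ h k))))

*P-comm : ∀ f g → f *P g ≋ g *P f
*P-comm f g = by λ h k → trans (⋆-* f g h k) (trans (⋆-comm f g h k) (sym (⋆-* g f h k)))

*P-assoc : ∀ f g l → (f *P g) *P l ≋ f *P (g *P l)
*P-assoc f g l = by λ h k → trans (⋆-* (f *P g) l h k) (trans (⋆-* f g (l ⋆ h) k)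
  (sym (trans (⋆-* f (g *P l) h k) (⋆-cong f (⋆-* g l h) k))))

*P-identityˡ : ∀ f → (1ℤ ∷ []) *P f ≋ f
*P-identityˡ f = by λ h k → trans (⋆-* (1ℤ ∷ []) f h k)
  (trans (ℤP.+-identityʳ _) (ℤP.*-identityˡ _))

*P-distribʳ : ∀ l f g → (f +P g) *P l ≋ f *P l +P g *P l
*P-distribʳ l f g = by λ h k → trans (⋆-* (f +P g) l h k) (trans (⋆-+ f g (l ⋆ h) k)
  (sym (trans (⋆-+ (f *P l) (g *P l) h k) (cong₂ ℤ._+_ (⋆-* f l h k) (⋆-* g l h k)))))

+P-comm : ∀ f g → f +P g ≋ g +P f
+P-comm f g = by λ h k → trans (⋆-+ f g h k) (trans (ℤP.+-comm ((f ⋆ h) k) ((g ⋆ h) k)) (sym (⋆-+ g f h k)))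

+P-assoc : ∀ f g l → (f +P g) +P l ≋ f +P (g +P l)
+P-assoc f g l = by λ h k → trans (⋆-+ (f +P g) l h k) (trans (cong (ℤ._+ (l ⋆ h) k) (⋆-+ f g h k))
  (trans (ℤP.+-assoc ((f ⋆ h) k) ((g ⋆ h) k) ((l ⋆ h) k)) (sym (trans (⋆-+ f (g +P l) h k) (cong (λ v → (f ⋆ h) k ℤ.+ v) (⋆-+ g l h k))))))

negP-inverseˡ : ∀ f → negP f +P f ≋ []
negP-inverseˡ f = by λ h k → trans (⋆-+ (negP f) f h k)
  (trans (cong (ℤ._+ (f ⋆ h) k) (⋆-scale -1ℤ f h k)) (lemma ((f ⋆ h) k)))
  where
  lemma : ∀ x → -1ℤ ℤ.* x ℤ.+ x ≡ 0ℤ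
  lemma = ℤ-solve

PolyRing : CommutativeRing _ _
PolyRing = record
  { Carrier = Poly ; _≈_ = _≋_ ; _+_ = _+P_ ; _*_ = _*P_ ; -_ = negP ; 0# = [] ; 1# = 1ℤ ∷ []
  ; isCommutativeRing = record
    { isRing = record
      { +-isAbelianGroup = record
        { isGroup = record
          { isMonoid = record
            { isSemigroup = record
              { isMagma = record { isEquivalence = Setoid.isEquivalence ≋-setoid ; ∙-cong = +P-cong }
              ; assoc = +P-assoc }
            ; identity = (λ _ → ≋-refl) , λ f → ≋-trans (+P-comm f []) ≋-refl }
          ; inverse = negP-inverseˡ , λ f → ≋-trans (+P-comm f (negP f)) (negP-inverseˡ f)
          ; ⁻¹-cong = λ {f} {g} e → by λ h k → trans (⋆-scale -1ℤ f h k)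
              (trans (cong (-1ℤ ℤ.*_) (at e h k)) (sym (⋆-scale -1ℤ g h k))) }
        ; comm = +P-comm }
      ; *-cong = *P-cong
      ; *-assoc = *P-assoc
      ; *-identity = *P-identityˡ , λ f → ≋-trans (*P-comm f _) (*P-identityˡ f)
      ; distrib = (λ f g l → ≋-trans (*P-comm f (g +P l)) (≋-trans (*P-distribʳ f g l)
                    (+P-cong (*P-comm g f) (*P-comm l f))))
                , *P-distribʳ }
    ; *-comm = *P-comm } }

module R = CommutativeRing PolyRing

module ≋-Reasoning = SetoidReasoning ≋-setoid

-- Zero has many representations because trailing zeros are allowed. The ring solver uses this test
-- to cancel closed terms such as `const 1ℤ +P const -1ℤ`.
≋[]? : ∀ f → Maybe ([] ≋ f)
≋[]? [] = just ≋-refl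
≋[]? (ℤ.+ 0 ∷ f) with ≋[]? f
... | just e = just (by λ h k → trans (at e h (suc k)) (sym (ℤP.+-identityˡ _)))
... | nothing = nothing
≋[]? _ = nothing

Poly-acr : AlmostCommutativeRing _ _
Poly-acr = fromCommutativeRing PolyRing ≋[]?

-- Monic polynomials

δ : ℕ → ℕ → ℤ
δ zero zero = 1ℤ
δ zero (suc k) = 0ℤ
δ (suc i) zero = 0ℤ
δ (suc i) (suc k) = δ i k

-- The way back from operators to coefficients: the unit sequences are the test sequences.
⋆-δ : ∀ f i → (f ⋆ δ i) 0 ≡ coeff f i
⋆-δ [] i = refl
⋆-δ (a ∷ f) zero = trans (cong₂ ℤ._+_ (ℤP.*-identityʳ a) (trans (sym (⋆-suc f (δ 0) 0)) (⋆-0 f 0)))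
  (ℤP.+-identityʳ a)
⋆-δ (a ∷ f) (suc i) = trans (cong₂ ℤ._+_ (ℤP.*-zeroʳ a) (trans (sym (⋆-suc f (δ (suc i)) 0)) (⋆-δ f i)))
  (ℤP.+-identityˡ _)

≋⇒≈P : ∀ {f g} → f ≋ g → f ≈P g
≋⇒≈P {f} {g} e i = trans (sym (⋆-δ f i)) (trans (at e (δ i) 0) (⋆-δ g i))

≈P⇒≋ : ∀ {f g} → f ≈P g → f ≋ g
≈P⇒≋ {f} {g} e = by (go f g e)
  where
  go : ∀ f g → f ≈P g → ∀ h k → (f ⋆ h) k ≡ (g ⋆ h) k
  go [] [] e h k = refl
  go [] (b ∷ g) e h k rewrite sym (e 0) =
    trans (go [] g (e ∘ suc) h (suc k)) (sym (ℤP.+-identityˡ _))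
  go (a ∷ f) [] e h k rewrite e 0 =
    trans (ℤP.+-identityˡ _) (go f [] (e ∘ suc) h (suc k))
  go (a ∷ f) (b ∷ g) e h k = cong₂ (λ u v → u ℤ.* h k ℤ.+ v) (e 0) (go f g (e ∘ suc) h (suc k))

coeff-+ : ∀ f g i → coeff (f +P g) i ≡ coeff f i ℤ.+ coeff g i
coeff-+ f g i = trans (sym (⋆-δ (f +P g) i)) (trans (⋆-+ f g (δ i) 0) (cong₂ ℤ._+_ (⋆-δ f i) (⋆-δ g i)))

coeff-scale : ∀ c f i → coeff (scaleP c f) i ≡ c ℤ.* coeff f i
coeff-scale c f i = trans (sym (⋆-δ (scaleP c f) i)) (trans (⋆-scale c f (δ i) 0) (cong (c ℤ.*_) (⋆-δ f i)))

DegBelow : Poly → ℕ → Set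
DegBelow f n = ∀ i → n ≤ i → coeff f i ≡ 0ℤ

record Monic (f : Poly) (n : ℕ) : Set where
  constructor monic
  field
    leading : coeff f n ≡ 1ℤ
    bounded : DegBelow f (suc n)

open Monic public

degBelow-length : ∀ f → DegBelow f (length f)
degBelow-length [] i _ = refl
degBelow-length (a ∷ f) (suc i) (s≤s le) = degBelow-length f i le

degBelow-≋ : ∀ {f g n} → f ≋ g → DegBelow f n → DegBelow g n
degBelow-≋ e b i le = trans (sym (≋⇒≈P e i)) (b i le)

monic-≋ : ∀ {f g n} → f ≋ g → Monic f n → Monic g n
monic-≋ e m = monic (trans (sym (≋⇒≈P e _)) (leading m)) (degBelow-≋ e (bounded m))

degBelow-0 : ∀ {f} → DegBelow f 0 → f ≋ []
degBelow-0 b = ≈P⇒≋ λ i → b i z≤n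

degBelow-scale : ∀ c f {n} → DegBelow f n → DegBelow (scaleP c f) n
degBelow-scale c f b i le = trans (coeff-scale c f i) (trans (cong (c ℤ.*_) (b i le)) (ℤP.*-zeroʳ c))

degBelow-pred : ∀ {f m} → DegBelow f (suc m) → coeff f m ≡ 0ℤ → DegBelow f m
degBelow-pred {f} {m} b z i le with m ≟ i
... | yes refl = z
... | no m≢i = b i (ℕP.≤∧≢⇒< le m≢i)

coeff-*-top : ∀ {D n} s m → Monic D n → DegBelow s (suc m) → coeff (D *P s) (n + m) ≡ coeff s m
coeff-*-top {[]} s m (monic () _) b
coeff-*-top {a ∷ p} {zero} s m (monic refl bd) b = begin
  coeff (scaleP 1ℤ s +P (0ℤ ∷ p *P s)) m             ≡⟨ ≋⇒≈P tail-vanishes m ⟩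
  coeff (scaleP 1ℤ s) m                             ≡⟨ coeff-scale 1ℤ s m ⟩
  1ℤ ℤ.* coeff s m                                  ≡⟨ ℤP.*-identityˡ _ ⟩
  coeff s m                                         ∎
  where
  open ≡-Reasoning
  p≋0 : p ≋ []
  p≋0 = ≈P⇒≋ λ i → bd (suc i) (s≤s z≤n)
  0∷≋0 : ∀ {f} → f ≋ [] → 0ℤ ∷ f ≋ []
  0∷≋0 e = by λ h k → trans (ℤP.+-identityˡ _) (at e h (suc k))
  tail-vanishes : scaleP 1ℤ s +P (0ℤ ∷ p *P s) ≋ scaleP 1ℤ s
  tail-vanishes = ≋-trans (+P-cong (≋-refl {scaleP 1ℤ s}) (0∷≋0 (*P-cong p≋0 (≋-refl {s})))) (R.+-identityʳ _)
coeff-*-top {a ∷ p} {suc n} s m (monic l bd) b = begin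
  coeff (scaleP a s +P (0ℤ ∷ p *P s)) (suc (n + m))      ≡⟨ coeff-+ (scaleP a s) (0ℤ ∷ p *P s) (suc (n + m)) ⟩
  coeff (scaleP a s) (suc (n + m)) ℤ.+ coeff (p *P s) (n + m)
    ≡⟨ cong₂ ℤ._+_ (degBelow-scale a s b (suc (n + m)) (s≤s (ℕP.m≤n+m m n)))
                   (coeff-*-top {p} {n} s m (monic l λ i le → bd (suc i) (s≤s le)) b) ⟩
  0ℤ ℤ.+ coeff s m                                       ≡⟨ ℤP.+-identityˡ _ ⟩
  coeff s m                                              ∎
  where open ≡-Reasoning

degBelow-* : ∀ {D n s m} → Monic D n → DegBelow s (suc m) → DegBelow (D *P s) (suc (n + m))
degBelow-* {D} {n} {s} {m} M b i le = begin
  coeff (D *P s) i             ≡⟨ cong (coeff (D *P s)) (sym n+m′≡i) ⟩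
  coeff (D *P s) (n + (i ∸ n)) ≡⟨ coeff-*-top s (i ∸ n) M (λ j le′ → b j (ℕP.≤-trans (ℕP.m≤n⇒m≤1+n m<m′) le′)) ⟩
  coeff s (i ∸ n)              ≡⟨ b (i ∸ n) m<m′ ⟩
  0ℤ                           ∎
  where
  open ≡-Reasoning
  n+m′≡i : n + (i ∸ n) ≡ i
  n+m′≡i = ℕP.m+[n∸m]≡n (ℕP.≤-trans (ℕP.m≤n⇒m≤1+n (ℕP.m≤m+n n m)) le)
  m<m′ : m < i ∸ n
  m<m′ = ℕP.m+n≤o⇒m≤o∸n (suc m) (subst (_≤ i) (cong suc (ℕP.+-comm n m)) le)

monic-* : ∀ {f g n m} → Monic f n → Monic g m → Monic (f *P g) (n + m)
monic-* {f} {g} {n} {m} F G = monic (trans (coeff-*-top g m F (bounded G)) (leading G)) (degBelow-* {s = g} F (bounded G))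

-- The leading coefficient of a nonzero `s` would reappear in `D *P s` in degree at least `n`. This
-- is the uniqueness part of division by a monic polynomial. The descent starts at the list length,
-- as the true degree is unknown.
low-multiple≋0 : ∀ {D n} s → Monic D n → DegBelow (D *P s) n → s ≋ []
low-multiple≋0 {D} {n} s M b = degBelow-0 (descend (length s) (degBelow-length s))
  where
  descend : ∀ m → DegBelow s m → DegBelow s 0
  descend zero c = c
  descend (suc m) c = descend m (degBelow-pred {s} c
    (trans (sym (coeff-*-top s m M c)) (b (n + m) (ℕP.m≤m+n n m))))

*P-cancelˡ : ∀ {D n} s t → Monic D n → D *P s ≋ D *P t → s ≋ t
*P-cancelˡ {D} s t M e = begin
  s                    ≈⟨ split s t ⟩
  (s +P negP t) +P t   ≈⟨ +P-cong diff≋0 ≋-refl ⟩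
  t                    ∎
  where
  open ≋-Reasoning
  split : ∀ s t → s ≋ (s +P negP t) +P t
  split = solve-∀ Poly-acr
  expand : ∀ D s t → D *P s +P negP (D *P t) ≋ D *P (s +P negP t)
  expand = solve-∀ Poly-acr
  cancels : ∀ u → u +P negP u ≋ []
  cancels = solve-∀ Poly-acr
  product≋0 : D *P (s +P negP t) ≋ []
  product≋0 = ≋-trans (≋-sym (expand D s t)) (≋-trans (+P-cong e (≋-refl {negP (D *P t)})) (cancels (D *P t)))
  diff≋0 : s +P negP t ≋ []
  diff≋0 = low-multiple≋0 _ M λ i _ → ≋⇒≈P product≋0 i

top-coeff-of-monic : ∀ {f n m} → Monic f n → coeff f m ≢ 0ℤ → DegBelow f (suc m) → (m ≡ n) × (coeff f m ≡ 1ℤ)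
top-coeff-of-monic {f} {n} {m} M nz b with ℕP.<-cmp m n
... | tri< m<n _ _ = case trans (sym (leading M)) (b n m<n) of λ ()
... | tri≈ _ refl _ = refl , leading M
... | tri> _ _ n<m = contradiction (bounded M m n<m) nz

-- The first nonzero coefficient of `Q` from above is also the top coefficient of `D *P Q`, hence 1.
monic-quotient : ∀ {D n k} Q → Monic D n → Monic (D *P Q) k → ∃ (Monic Q)
monic-quotient {D} {n} {k} Q M N = search (length Q) (degBelow-length Q)
  where
  search : ∀ m → DegBelow Q m → ∃ (Monic Q)
  search zero b = case trans (sym (leading N)) (≋⇒≈P D*Q≋0 k) of λ ()
    where
    D*Q≋0 : D *P Q ≋ []
    D*Q≋0 = ≋-trans (*P-cong (≋-refl {D}) (degBelow-0 {Q} b)) (R.zeroʳ D)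
  search (suc m) b with coeff Q m ℤ.≟ 0ℤ
  ... | yes z = search m (degBelow-pred {Q} b z)
  ... | no nz = m , monic (trans (sym top) (proj₂ (top-coeff-of-monic N
          (nz ∘ trans (sym top)) (degBelow-* {s = Q} M b)))) b
    where
    top : coeff (D *P Q) (n + m) ≡ coeff Q m
    top = coeff-*-top Q m M b

-- Division with remainder

mono : ℕ → Poly
mono n = replicate n 0ℤ ++ (1ℤ ∷ [])

⋆-mono : ∀ n h k → (mono n ⋆ h) k ≡ h (k + n)
⋆-mono zero h k = trans (ℤP.+-identityʳ _) (trans (ℤP.*-identityˡ _) (cong h (sym (ℕP.+-identityʳ k))))
⋆-mono (suc n) h k = trans (ℤP.+-identityˡ _) (trans (⋆-mono n h (suc k)) (cong h (sym (ℕP.+-suc k n))))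

mono-+ : ∀ m n → mono m *P mono n ≋ mono (m + n)
mono-+ m n = by λ h k → begin
  (mono m *P mono n ⋆ h) k       ≡⟨ ⋆-* (mono m) (mono n) h k ⟩
  (mono m ⋆ mono n ⋆ h) k        ≡⟨ ⋆-mono m (mono n ⋆ h) k ⟩
  (mono n ⋆ h) (k + m)           ≡⟨ ⋆-mono n h (k + m) ⟩
  h (k + m + n)                  ≡⟨ cong h (ℕP.+-assoc k m n) ⟩
  h (k + (m + n))                ≡⟨ ⋆-mono (m + n) h k ⟨
  (mono (m + n) ⋆ h) k           ∎
  where open ≡-Reasoning

const : ℤ → Poly
const c = c ∷ []

⋆-const : ∀ c h k → (const c ⋆ h) k ≡ c ℤ.* h k
⋆-const c h k = ℤP.+-identityʳ _

const-* : ∀ c d → const (c ℤ.* d) ≋ const c *P const d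
const-* c d = ≈P⇒≋ λ { zero → sym (ℤP.+-identityʳ _) ; (suc zero) → refl ; (suc (suc i)) → refl }

const-- : ∀ c d → const (c ℤ.- d) ≋ const c +P negP (const d)
const-- c d = ≈P⇒≋ λ { zero → cong (λ v → c ℤ.+ v) (sym (ℤP.-1*i≡-i d)) ; (suc i) → refl }

⋆-++ : ∀ f g h k → ((f ++ g) ⋆ h) k ≡ (f ⋆ h) k ℤ.+ (g ⋆ h) (k + length f)
⋆-++ [] g h k = trans (cong (g ⋆ h) (sym (ℕP.+-identityʳ k))) (sym (ℤP.+-identityˡ _))
⋆-++ (a ∷ f) g h k rewrite ⋆-++ f g h (suc k) | ℕP.+-suc k (length f) = sym (ℤP.+-assoc (a ℤ.* h k) _ _)

-- Highest degree first, as in divMonic.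
fromHigh : List ℤ → Poly
fromHigh [] = []
fromHigh (c ∷ cs) = const c *P mono (length cs) +P fromHigh cs

reverse≋fromHigh : ∀ cs → reverse cs ≋ fromHigh cs
reverse≋fromHigh [] = ≋-refl
reverse≋fromHigh (c ∷ cs) = by λ h k → begin
  (reverse (c ∷ cs) ⋆ h) k                    ≡⟨ cong (λ l → (l ⋆ h) k) (LP.unfold-reverse c cs) ⟩
  ((reverse cs ++ const c) ⋆ h) k             ≡⟨ ⋆-++ (reverse cs) (const c) h k ⟩
  (reverse cs ⋆ h) k ℤ.+ (const c ⋆ h) (k + length (reverse cs))
    ≡⟨ cong₂ (λ u n → u ℤ.+ (const c ⋆ h) (k + n)) (at (reverse≋fromHigh cs) h k) (LP.length-reverse cs) ⟩
  (fromHigh cs ⋆ h) k ℤ.+ (const c ⋆ h) (k + length cs)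
    ≡⟨ cong (λ u → (fromHigh cs ⋆ h) k ℤ.+ u) (sym (⋆-mono (length cs) (const c ⋆ h) k)) ⟩
  (fromHigh cs ⋆ h) k ℤ.+ (mono (length cs) ⋆ const c ⋆ h) k
    ≡⟨ ℤP.+-comm ((fromHigh cs ⋆ h) k) _ ⟩
  (mono (length cs) ⋆ const c ⋆ h) k ℤ.+ (fromHigh cs ⋆ h) k
    ≡⟨ cong (ℤ._+ (fromHigh cs ⋆ h) k)
         (trans (⋆-comm (mono (length cs)) (const c) h k) (sym (⋆-* (const c) (mono (length cs)) h k))) ⟩
  (const c *P mono (length cs) ⋆ h) k ℤ.+ (fromHigh cs ⋆ h) k
    ≡⟨ ⋆-+ (const c *P mono (length cs)) (fromHigh cs) h k ⟨
  (fromHigh (c ∷ cs) ⋆ h) k                   ∎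
  where open ≡-Reasoning

coeff-++ : ∀ f g i → coeff (f ++ g) (length f + i) ≡ coeff g i
coeff-++ [] g i = refl
coeff-++ (a ∷ f) g i = coeff-++ f g i

degBelow-fromHigh : ∀ cs → DegBelow (fromHigh cs) (length cs)
degBelow-fromHigh cs = degBelow-≋ (reverse≋fromHigh cs)
  (subst (DegBelow (reverse cs)) (LP.length-reverse cs) (degBelow-length (reverse cs)))

leading-fromHigh : ∀ c cs → coeff (fromHigh (c ∷ cs)) (length cs) ≡ c
leading-fromHigh c cs = begin
  coeff (fromHigh (c ∷ cs)) (length cs)                   ≡⟨ ≋⇒≈P (reverse≋fromHigh (c ∷ cs)) (length cs) ⟨
  coeff (reverse (c ∷ cs)) (length cs)                    ≡⟨ cong₂ coeff (LP.unfold-reverse c cs)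
                                                               (trans (sym (LP.length-reverse cs)) (sym (ℕP.+-identityʳ _))) ⟩
  coeff (reverse cs ++ const c) (length (reverse cs) + 0) ≡⟨ coeff-++ (reverse cs) (const c) 0 ⟩
  c                                                       ∎
  where open ≡-Reasoning

length-subFront : ∀ c ds rs → length (subFront c ds rs) ≡ length rs
length-subFront c [] rs = refl
length-subFront c (d ∷ ds) [] = refl
length-subFront c (d ∷ ds) (r ∷ rs) = cong suc (length-subFront c ds rs)

subFront-spec : ∀ c ds rs → length ds ≤ length rs →
  fromHigh rs ≋ const c *P mono (length rs ∸ length ds) *P fromHigh ds +P fromHigh (subFront c ds rs)
subFront-spec c [] rs _ = absorb (const c *P mono (length rs)) (fromHigh rs)
  where
  absorb : ∀ u r → r ≋ u *P [] +P r
  absorb = solve-∀ Poly-acr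
subFront-spec c (d ∷ ds) (r ∷ rs) (s≤s le) = begin
  C r *P X |rs| +P fromHigh rs
    ≈⟨ +P-cong ≋-refl (subFront-spec c ds rs le) ⟩
  C r *P X |rs| +P (C c *P X j *P fromHigh ds +P tail′)
    ≈⟨ arrange (C c) (C d) (C r) (X |rs|) (X j *P fromHigh ds) (X j) (fromHigh ds) tail′ ⟩
  C c *P X j *P fromHigh ds +P C c *P C d *P X |rs| +P ((C r +P negP (C c *P C d)) *P X |rs| +P tail′)
    ≈⟨ +P-cong (+P-cong (≋-refl {C c *P X j *P fromHigh ds}) (*P-cong (≋-refl {C c *P C d}) split-X))
               (+P-cong (*P-cong fold-const fold-X) (≋-refl {tail′})) ⟩
  C c *P X j *P fromHigh ds +P C c *P C d *P (X j *P X |ds|) +P (C (r ℤ.- c ℤ.* d) *P X (length (subFront c ds rs)) +P tail′)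
    ≈⟨ +P-cong (arrange₂ (C c) (C d) (X j) (X |ds|) (fromHigh ds)) ≋-refl ⟩
  C c *P X j *P (C d *P X |ds| +P fromHigh ds) +P fromHigh (subFront c (d ∷ ds) (r ∷ rs)) ∎
  where
  open ≋-Reasoning
  C = const
  X = mono
  |rs| = length rs
  |ds| = length ds
  j = |rs| ∸ |ds|
  tail′ = fromHigh (subFront c ds rs)
  arrange : ∀ c d r x y z f t → r *P x +P (c *P z *P f +P t) ≋ c *P z *P f +P c *P d *P x +P ((r +P negP (c *P d)) *P x +P t)
  arrange = solve-∀ Poly-acr
  arrange₂ : ∀ c d x y f → c *P x *P f +P c *P d *P (x *P y) ≋ c *P x *P (d *P y +P f)
  arrange₂ = solve-∀ Poly-acr
  split-X : X |rs| ≋ X j *P X |ds|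
  split-X = ≋-trans (by λ h k → cong (λ n → (mono n ⋆ h) k) (sym (ℕP.m∸n+n≡m le))) (≋-sym (mono-+ j |ds|))
  fold-const : C r +P negP (C c *P C d) ≋ C (r ℤ.- c ℤ.* d)
  fold-const = ≋-trans (+P-cong (≋-refl {C r}) (R.-‿cong {C c *P C d} (≋-sym (const-* c d)))) (≋-sym (const-- r (c ℤ.* d)))
  fold-X : X |rs| ≋ X (length (subFront c ds rs))
  fold-X = by λ h k → cong (λ n → (mono n ⋆ h) k) (sym (length-subFront c ds rs))

-- The length of the quotient has to be part of the induction: `fromHigh` reads the degree of a term
-- off the number of coefficients behind it, so the new term is c X^j only if the recursive quotient
-- has length j.
divH-spec : ∀ n ds cs → length cs ≤ n →
  length (divH n ds cs) ≡ length cs ∸ length ds ×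
  ∃ λ r → length r ≤ length ds ×
    fromHigh cs ≋ fromHigh (1ℤ ∷ ds) *P fromHigh (divH n ds cs) +P fromHigh r
divH-spec n ds [] _ rewrite divH-[] n ds =
  sym (ℕP.0∸n≡0 (length ds)) , [] , z≤n , ≋-sym (≋-trans (R.+-identityʳ _) (R.zeroʳ (fromHigh (1ℤ ∷ ds))))
divH-spec (suc n) ds (c ∷ rs) (s≤s le) with length ds ≤? length rs
... | no ¬fits =
  sym (ℕP.m≤n⇒m∸n≡0 (ℕP.≰⇒> ¬fits)) , c ∷ rs , ℕP.≰⇒> ¬fits ,
  ≋-sym (+P-cong (R.zeroʳ (fromHigh (1ℤ ∷ ds))) ≋-refl)
... | yes fits
  with divH-spec n ds (subFront c ds rs) (subst (_≤ n) (sym (length-subFront c ds rs)) le)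
... | len , r , small , eq rewrite length-subFront c ds rs =
  trans (cong suc len) (sym (ℕP.+-∸-assoc 1 fits)) , r , small , (begin
    C c *P X |rs| +P fromHigh rs
      ≈⟨ +P-cong (*P-cong (≋-refl {C c}) split-X) (≋-trans (subFront-spec c ds rs fits) (+P-cong ≋-refl eq)) ⟩
    C c *P (X j *P X |ds|) +P (C c *P X j *P fromHigh ds +P ((1P *P X |ds| +P fromHigh ds) *P fromHigh q +P fromHigh r))
      ≈⟨ arrange (C c) (X j) (X |ds|) (fromHigh ds) (fromHigh q) (fromHigh r) ⟩
    (1P *P X |ds| +P fromHigh ds) *P (C c *P X j +P fromHigh q) +P fromHigh r
      ≈⟨ +P-cong (*P-cong (≋-refl {fromHigh (1ℤ ∷ ds)}) (+P-cong (*P-cong (≋-refl {C c}) X-len) ≋-refl)) ≋-refl ⟩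
    fromHigh (1ℤ ∷ ds) *P (C c *P X (length q) +P fromHigh q) +P fromHigh r ∎)
  where
  open ≋-Reasoning
  C = const
  X = mono
  1P = const 1ℤ
  |rs| = length rs
  |ds| = length ds
  j = |rs| ∸ |ds|
  q = divH n ds (subFront c ds rs)
  split-X : X |rs| ≋ X j *P X |ds|
  split-X = ≋-trans (by λ h k → cong (λ n → (mono n ⋆ h) k) (sym (ℕP.m∸n+n≡m fits))) (≋-sym (mono-+ j |ds|))
  X-len : X j ≋ X (length q)
  X-len = by λ h k → cong (λ n → (mono n ⋆ h) k) (sym len)
  arrange : ∀ c x y f q r → c *P (x *P y) +P (c *P x *P f +P ((const 1ℤ *P y +P f) *P q +P r))
    ≋ (const 1ℤ *P y +P f) *P (c *P x +P q) +P r
  arrange = solve-∀ Poly-acr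

data Stripped (p : Poly) : List ℤ → Set where
  zero-poly : p ≋ [] → Stripped p []
  leading-≢0 : ∀ {c cs} → c ≢ 0ℤ → p ≋ fromHigh (c ∷ cs) → Stripped p (c ∷ cs)

reverse-strip : ∀ p → reverse (strip p) ≡ dropZ p (reverse p)
reverse-strip p = trans (cong reverse (strip-eq p)) (LP.reverse-involutive (dropZ p (reverse p)))

dropZ-spec : ∀ p {q} xs → q ≋ fromHigh xs → Stripped q (dropZ p xs)
dropZ-spec p [] e = zero-poly e
dropZ-spec p (ℤ.+ 0 ∷ xs) e = dropZ-spec p xs
  (≋-trans e (drop-zero (const 0ℤ) (mono (length xs)) (fromHigh xs) (≈P⇒≋ λ { zero → refl ; (suc i) → refl })))
  where
  drop-zero : ∀ z x f → z ≋ [] → z *P x +P f ≋ f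
  drop-zero z x f e = +P-cong (*P-cong e (≋-refl {x})) (≋-refl {f})
dropZ-spec p (ℤ.+ suc n ∷ xs) e = leading-≢0 (λ ()) e
dropZ-spec p (ℤ.-[1+ n ] ∷ xs) e = leading-≢0 (λ ()) e

reverse-strip-spec : ∀ p → Stripped p (reverse (strip p))
reverse-strip-spec p rewrite reverse-strip p = dropZ-spec p (reverse p)
  (≋-trans (by λ h k → cong (λ l → (l ⋆ h) k) (sym (LP.reverse-involutive p))) (reverse≋fromHigh (reverse p)))

length-dropZ : ∀ p xs → length (dropZ p xs) ≤ length xs
length-dropZ p [] = z≤n
length-dropZ p (ℤ.+ 0 ∷ xs) = ℕP.m≤n⇒m≤1+n (length-dropZ p xs)
length-dropZ p (ℤ.+ suc n ∷ xs) = ℕP.≤-refl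
length-dropZ p (ℤ.-[1+ n ] ∷ xs) = ℕP.≤-refl

stripped≋ : ∀ {p cs} → Stripped p cs → p ≋ fromHigh cs
stripped≋ (zero-poly e) = e
stripped≋ (leading-≢0 _ e) = e

divMonic-spec : ∀ {D n} p → Monic D n →
  ∃ λ r → DegBelow r n × p ≋ D *P divMonic p D +P r
divMonic-spec {D} {n} p M = go refl (reverse-strip-spec D)
  where
  go : ∀ {cs} → reverse (strip D) ≡ cs → Stripped D cs → ∃ λ r → DegBelow r n × p ≋ D *P divMonic p D +P r
  go _ (zero-poly e) = case trans (sym (leading M)) (≋⇒≈P e n) of λ ()
  -- `divMonic` discards the leading coefficient `c` unseen; as a nonzero top coefficient of the
  -- monic `D` it is 1.
  go {c ∷ ds} eq (leading-≢0 c≢0 e)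
    with top-coeff-of-monic {m = length ds} M
           (subst (_≢ 0ℤ) (sym (trans (≋⇒≈P e (length ds)) (leading-fromHigh c ds))) c≢0)
           (degBelow-≋ (≋-sym e) (degBelow-fromHigh (c ∷ ds)))
  ... | refl , c≡1 with trans (sym (trans (≋⇒≈P e (length ds)) (leading-fromHigh c ds))) c≡1
  ... | refl with divH-spec (length p) ds (reverse (strip p))
                    (subst (_≤ length p) (cong length (sym (reverse-strip p)))
                      (ℕP.≤-trans (length-dropZ p (reverse p)) (ℕP.≤-reflexive (LP.length-reverse p))))
  ... | _ , r , small , q-eq =
    fromHigh r , (λ i le → degBelow-fromHigh r i (ℕP.≤-trans small le)) , (begin
      p                                                ≈⟨ stripped≋ (reverse-strip-spec p) ⟩
      fromHigh (reverse (strip p))                     ≈⟨ q-eq ⟩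
      fromHigh (1ℤ ∷ ds) *P fromHigh q +P fromHigh r   ≈⟨ +P-cong (*P-cong (≋-sym e) q≋) ≋-refl ⟩
      D *P divMonic p D +P fromHigh r                  ∎)
    where
    open ≋-Reasoning
    q = divH (length p) ds (reverse (strip p))
    q≋ : fromHigh q ≋ divMonic p D
    q≋ = ≋-trans (≋-sym (reverse≋fromHigh q)) (by λ h k → cong (λ l → (l ⋆ h) k) (sym (divMonic-eq p D eq)))

-- The remainder is also a remainder of c p, hence a multiple of D of too low a degree.
divMonic-exact : ∀ {D n c} p s → Monic D n → c ≢ 0ℤ → const c *P p ≋ D *P s → D *P divMonic p D ≋ p
divMonic-exact {D} {n} {c} p s M c≢0 e with divMonic-spec p M
... | r , small , p≋ = ≋-sym (≋-trans p≋ (≋-trans (+P-cong ≋-refl r≋0) (R.+-identityʳ _)))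
  where
  open ≋-Reasoning
  q = divMonic p D
  C = const c
  move : ∀ D s q C r → D *P s ≋ C *P (D *P q +P r) → D *P (s +P negP (C *P q)) ≋ C *P r
  move D s q C r h = ≋-trans (lemma₁ D s q C) (≋-trans (+P-cong h ≋-refl) (lemma₂ D q C r))
    where
    lemma₁ : ∀ D s q C → D *P (s +P negP (C *P q)) ≋ D *P s +P negP (C *P (D *P q))
    lemma₁ = solve-∀ Poly-acr
    lemma₂ : ∀ D q C r → C *P (D *P q +P r) +P negP (C *P (D *P q)) ≋ C *P r
    lemma₂ = solve-∀ Poly-acr
  multiple : D *P (s +P negP (C *P q)) ≋ C *P r
  multiple = move D s q C r (≋-trans (≋-sym e) (*P-cong (≋-refl {C}) p≋))
  coeff-C : ∀ i → coeff (C *P r) i ≡ c ℤ.* coeff r i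
  coeff-C i = trans (≋⇒≈P {C *P r} {scaleP c r} (by λ h k → trans (⋆-* C r h k) (trans (⋆-const c (r ⋆ h) k) (sym (⋆-scale c r h k)))) i)
    (coeff-scale c r i)
  quotient≋0 : s +P negP (C *P q) ≋ []
  quotient≋0 = low-multiple≋0 _ M (degBelow-≋ (≋-sym multiple)
    λ i le → trans (coeff-C i) (trans (cong (c ℤ.*_) (small i le)) (ℤP.*-zeroʳ c)))
  r≋0 : r ≋ []
  r≋0 = ≈P⇒≋ λ i → [ (λ c≡0 → contradiction c≡0 c≢0) , id ]′ (ℤP.i*j≡0⇒i≡0∨j≡0 c
    (trans (sym (coeff-C i)) (≋⇒≈P (≋-trans (≋-sym multiple) (≋-trans (*P-cong (≋-refl {D}) quotient≋0) (R.zeroʳ D))) i)))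

-- Divisibility and coprimality

infix 4 _∣ᴾ_

record _∣ᴾ_ (f g : Poly) : Set where
  constructor _,_
  field
    quotient : Poly
    equality : g ≋ f *P quotient

open _∣ᴾ_ public

∣ᴾ-refl : ∀ {f} → f ∣ᴾ f
∣ᴾ-refl {f} = const 1ℤ , ≋-sym (R.*-identityʳ f)

∣ᴾ-trans : ∀ {f g l} → f ∣ᴾ g → g ∣ᴾ l → f ∣ᴾ l
∣ᴾ-trans {f} {g} (q , e) (r , e′) = q *P r , ≋-trans e′ (≋-trans (*P-cong e (≋-refl {r})) (*P-assoc f q r))

∣ᴾ-respˡ : ∀ {f f′ g} → f ≋ f′ → f ∣ᴾ g → f′ ∣ᴾ g
∣ᴾ-respˡ e (q , e′) = q , ≋-trans e′ (*P-cong e (≋-refl {q}))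

∣ᴾ-respʳ : ∀ {f g g′} → g ≋ g′ → f ∣ᴾ g → f ∣ᴾ g′
∣ᴾ-respʳ e (q , e′) = q , ≋-trans (≋-sym e) e′

∣ᴾ-* : ∀ {f f′ g g′} → f ∣ᴾ f′ → g ∣ᴾ g′ → f *P g ∣ᴾ f′ *P g′
∣ᴾ-* {f} {f′} {g} {g′} (q , e) (r , e′) = q *P r , ≋-trans (*P-cong e e′) (interchange f q g r)
  where
  interchange : ∀ f q g r → (f *P q) *P (g *P r) ≋ (f *P g) *P (q *P r)
  interchange = solve-∀ Poly-acr

1∣ᴾ : ∀ f → const 1ℤ ∣ᴾ f
1∣ᴾ f = f , ≋-sym (*P-identityˡ f)

-- The polynomials X^n - 1

x-1 : ℕ → Poly
x-1 = xpowMinus1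

coeff-mono : ∀ n i → coeff (mono n) i ≡ δ i n
coeff-mono n i = trans (sym (⋆-δ (mono n) i)) (⋆-mono n (δ i) 0)

δ-diag : ∀ n → δ n n ≡ 1ℤ
δ-diag zero = refl
δ-diag (suc n) = δ-diag n

δ-off : ∀ {i n} → n < i → δ i n ≡ 0ℤ
δ-off {suc i} {zero} _ = refl
δ-off {suc i} {suc n} (s≤s lt) = δ-off lt

monic-x-1 : ∀ n → .{{NonZero n}} → Monic (x-1 n) n
monic-x-1 (suc n) = monic
  (trans (coeff-+ (mono (suc n)) (const -1ℤ) (suc n)) (cong (ℤ._+ 0ℤ) (trans (coeff-mono (suc n) (suc n)) (δ-diag n))))
  λ { (suc i) lt → trans (coeff-+ (mono (suc n)) (const -1ℤ) (suc i))
        (cong (ℤ._+ 0ℤ) (trans (coeff-mono (suc n) (suc i)) (δ-off lt))) }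

mono≡ : ∀ {m n} → m ≡ n → mono m ≋ mono n
mono≡ refl = ≋-refl

x-1-split : ∀ m n → x-1 (m + n) ≋ mono m *P x-1 n +P x-1 m
x-1-split m n = ≋-trans (+P-cong (≋-sym (mono-+ m n)) (≋-refl {const -1ℤ})) (expand (mono m) (mono n))
  where
  expand : ∀ x y → x *P y +P const -1ℤ ≋ x *P (y +P const -1ℤ) +P (x +P const -1ℤ)
  expand = solve-∀ Poly-acr

-- The quotient 1 + X^d + … + X^((k-1)d) is k modulo X^d - 1.
geometric : ∀ k d → ∃₂ λ G K → x-1 (k * d) ≋ x-1 d *P G × G ≋ x-1 d *P K +P const (ℤ.+ k)
geometric zero d = [] , [] ,
  ≋-trans (≈P⇒≋ (λ { zero → refl ; (suc i) → refl })) (≋-sym (R.zeroʳ (x-1 d))) ,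
  ≋-sym (≋-trans (+P-cong (R.zeroʳ (x-1 d)) (≋-refl {const 0ℤ})) (≈P⇒≋ (λ { zero → refl ; (suc i) → refl })))
geometric (suc k) d with geometric k d
... | G , K , e , e′ = mono d *P G +P const 1ℤ , G +P K ,
  ≋-trans (x-1-split d (k * d)) (≋-trans (+P-cong (*P-cong (≋-refl {mono d}) e) ≋-refl) (regroup (mono d) (x-1 d) G)) ,
  ≋-trans (shift (mono d) G) (≋-trans
    (+P-cong (≋-refl {x-1 d *P G}) (+P-cong e′ (≋-refl {const 1ℤ})))
    (≋-trans (collect (x-1 d) G K (const (ℤ.+ k))) (+P-cong (≋-refl {x-1 d *P (G +P K)}) (≈P⇒≋ λ { zero → cong ℤ.+_ (ℕP.+-comm k 1) ; (suc i) → refl }))))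
  where
  regroup : ∀ x y g → x *P (y *P g) +P y ≋ y *P (x *P g +P const 1ℤ)
  regroup = solve-∀ Poly-acr
  shift : ∀ x g → x *P g +P const 1ℤ ≋ (x +P const -1ℤ) *P g +P (g +P const 1ℤ)
  shift = solve-∀ Poly-acr
  collect : ∀ y g k c → y *P g +P ((y *P k +P c) +P const 1ℤ) ≋ y *P (g +P k) +P (c +P const 1ℤ)
  collect = solve-∀ Poly-acr

x-1-∣ : ∀ {d n} → d ∣ n → x-1 d ∣ᴾ x-1 n
x-1-∣ {d} (divides-refl k) with geometric k d
... | G , _ , e , _ = G , e

x-1-gcd : ∀ a b → ∃₂ λ u v → x-1 (gcd a b) ≋ u *P x-1 a +P v *P x-1 b
x-1-gcd a b with Bézout.identity (gcd-GCD a b)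
... | Bézout.+- x y eq with geometric x a | geometric y b
... | G , _ , e , _ | H , _ , e′ , _ = G , negP (mono g *P H) , (begin
    x-1 g                                                 ≈⟨ isolate (x-1 g) (mono g) (x-1 (y * b)) ⟩
    (mono g *P x-1 (y * b) +P x-1 g) +P negP (mono g *P x-1 (y * b))
      ≈⟨ +P-cong (≋-trans (≋-sym (x-1-split g (y * b))) (≋-trans (+P-cong (mono≡ eq) (≋-refl {const -1ℤ})) e))
                 (R.-‿cong {mono g *P x-1 (y * b)} (*P-cong (≋-refl {mono g}) e′)) ⟩
    x-1 a *P G +P negP (mono g *P (x-1 b *P H))           ≈⟨ arrange (x-1 a) G (mono g) (x-1 b) H ⟩
    G *P x-1 a +P negP (mono g *P H) *P x-1 b             ∎)
  where
  open ≋-Reasoning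
  g = gcd a b
  isolate : ∀ d x z → d ≋ (x *P z +P d) +P negP (x *P z)
  isolate = solve-∀ Poly-acr
  arrange : ∀ a g x b h → a *P g +P negP (x *P (b *P h)) ≋ g *P a +P negP (x *P h) *P b
  arrange = solve-∀ Poly-acr
x-1-gcd a b | Bézout.-+ x y eq with geometric x a | geometric y b
... | G , _ , e , _ | H , _ , e′ , _ = negP (mono g *P G) , H , (begin
    x-1 g                                                 ≈⟨ isolate (x-1 g) (mono g) (x-1 (x * a)) ⟩
    (mono g *P x-1 (x * a) +P x-1 g) +P negP (mono g *P x-1 (x * a))
      ≈⟨ +P-cong (≋-trans (≋-sym (x-1-split g (x * a))) (≋-trans (+P-cong (mono≡ eq) (≋-refl {const -1ℤ})) e′))
                 (R.-‿cong {mono g *P x-1 (x * a)} (*P-cong (≋-refl {mono g}) e)) ⟩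
    x-1 b *P H +P negP (mono g *P (x-1 a *P G))           ≈⟨ arrange (x-1 b) H (mono g) (x-1 a) G ⟩
    negP (mono g *P G) *P x-1 a +P H *P x-1 b             ∎)
  where
  open ≋-Reasoning
  g = gcd a b
  isolate : ∀ d x z → d ≋ (x *P z +P d) +P negP (x *P z)
  isolate = solve-∀ Poly-acr
  arrange : ∀ b h x a g → b *P h +P negP (x *P (a *P g)) ≋ negP (x *P g) *P a +P h *P b
  arrange = solve-∀ Poly-acr

-- Coprimality over ℚ with denominators cleared. The constant cannot be normalised to 1:
-- combinations of X - 1 and X + 1 over ℤ that are constant are even.
record Coprimeᴾ (f g : Poly) : Set where
  constructor coprimeᴾ
  field
    {u v} : Poly
    {c} : ℤ
    c≢0 : c ≢ 0ℤ
    combination : u *P f +P v *P g ≋ const c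

coprimeᴾ-sym : ∀ {f g} → Coprimeᴾ f g → Coprimeᴾ g f
coprimeᴾ-sym {f} {g} (coprimeᴾ {u} {v} nz e) =
  coprimeᴾ {u = v} {v = u} nz (≋-trans (+P-comm (v *P g) (u *P f)) e)

*≢0 : ∀ {c d} → c ≢ 0ℤ → d ≢ 0ℤ → c ℤ.* d ≢ 0ℤ
*≢0 {c} nz nz′ = [ nz , nz′ ]′ ∘ ℤP.i*j≡0⇒i≡0∨j≡0 c

coprimeᴾ-* : ∀ {f f′ g} → Coprimeᴾ f g → Coprimeᴾ f′ g → Coprimeᴾ (f *P f′) g
coprimeᴾ-* {f} {f′} {g} (coprimeᴾ {u} {v} {c} nz e) (coprimeᴾ {u′} {v′} {c′} nz′ e′) =
  coprimeᴾ {u = u *P u′} {v = u *P f *P v′ +P v *P (u′ *P f′ +P v′ *P g)}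
    (*≢0 nz nz′) (≋-trans (≋-sym (expand u f v g u′ f′ v′)) (≋-trans (*P-cong e e′) (≋-sym (const-* c c′))))
  where
  expand : ∀ u f v g u′ f′ v′ → (u *P f +P v *P g) *P (u′ *P f′ +P v′ *P g)
    ≋ u *P u′ *P (f *P f′) +P (u *P f *P v′ +P v *P (u′ *P f′ +P v′ *P g)) *P g
  expand = solve-∀ Poly-acr

coprimeᴾ-1 : ∀ g → Coprimeᴾ (const 1ℤ) g
coprimeᴾ-1 g = coprimeᴾ {u = const 1ℤ} {v = []} (λ ()) (R.+-identityʳ (const 1ℤ))

-- Multiply the combination by `c l`: in c′ c l = c u f l + v g (c l) both terms contain f g. The
-- integer factor sits on the side of `f`, the product built up so far, where it grows with each
-- step.
coprimeᴾ-∣ : ∀ {f g l c} → Coprimeᴾ f g → f ∣ᴾ const c *P l → g ∣ᴾ l →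
  ∃ λ c′ → c′ ≢ 0ℤ × f *P g ∣ᴾ const (c′ ℤ.* c) *P l
coprimeᴾ-∣ {f} {g} {l} {c} (coprimeᴾ {u} {v} {c′} nz e) (q , eq) (r , er) = c′ , nz ,
  const c *P u *P r +P v *P q , (begin
    const (c′ ℤ.* c) *P l                              ≈⟨ *P-cong (const-* c′ c) (≋-refl {l}) ⟩
    const c′ *P const c *P l                           ≈⟨ *P-cong (*P-cong (≋-sym e) (≋-refl {const c})) (≋-refl {l}) ⟩
    (u *P f +P v *P g) *P const c *P l                 ≈⟨ expand u f v g (const c) l ⟩
    const c *P u *P f *P l +P v *P g *P (const c *P l) ≈⟨ +P-cong (*P-cong (≋-refl {const c *P u *P f}) er)
                                                                  (*P-cong (≋-refl {v *P g}) eq) ⟩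
    const c *P u *P f *P (g *P r) +P v *P g *P (f *P q) ≈⟨ collect (const c) u f g r v q ⟩
    f *P g *P (const c *P u *P r +P v *P q)            ∎)
  where
  open ≋-Reasoning
  expand : ∀ u f v g c l → (u *P f +P v *P g) *P c *P l ≋ c *P u *P f *P l +P v *P g *P (c *P l)
  expand = solve-∀ Poly-acr
  collect : ∀ c u f g r v q → c *P u *P f *P (g *P r) +P v *P g *P (f *P q) ≋ f *P g *P (c *P u *P r +P v *P q)
  collect = solve-∀ Poly-acr

-- Cyclotomic polynomials

div : ℕ → ℕ → Bool
div n d = ⌊ d ∣? n ⌋

div-yes : ∀ {d n} → d ∣ n → div n d ≡ true
div-yes {d} {n} d∣n with d ∣? n
... | yes _ = refl
... | no ¬d∣n = contradiction d∣n ¬d∣n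

div-no : ∀ {d n} → ¬ d ∣ n → div n d ≡ false
div-no {d} {n} ¬d∣n with d ∣? n
... | yes d∣n = contradiction d∣n ¬d∣n
... | no _ = refl

⌊⌋-sound : ∀ {P : Set} (P? : Dec P) → ⌊ P? ⌋ ≡ true → P
⌊⌋-sound (yes p) _ = p

div⇒∣ : ∀ {d n} → div n d ≡ true → d ∣ n
div⇒∣ {d} {n} = ⌊⌋-sound (d ∣? n)

findT-++ : ∀ {x} ts us → All (λ e → proj₁ e < x) ts → findT x (ts ++ us) ≡ findT x us
findT-++ [] us All.[] = refl
findT-++ {x} ((d , φ) ∷ ts) us (d<x All.∷ below) with d ≟ x
... | yes refl = contradiction d<x (ℕP.n≮n d)
... | no _ = findT-++ ts us below

table-below : ∀ n → All (λ e → proj₁ e < suc n) (table n)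
table-below zero = All.[]
table-below (suc n) rewrite table-suc n =
  All.++⁺ (All.map ℕP.m<n⇒m<1+n (table-below n)) (ℕP.n<1+n (suc n) All.∷ All.[])

cofactor : ℕ → Poly
cofactor n = prodDiv (suc n) (table n)

findT-here : ∀ n φ → findT n ((n , φ) ∷ []) ≡ φ
findT-here n φ with n ≟ n
... | yes _ = refl
... | no n≢n = contradiction refl n≢n

Φ-suc : ∀ n → Φ (suc n) ≡ divMonic (x-1 (suc n)) (cofactor n)
Φ-suc n = begin
  Φ (suc n)                                      ≡⟨ Φ-table (suc n) ⟩
  findT (suc n) (table (suc n))                  ≡⟨ cong (findT (suc n)) (table-suc n) ⟩
  findT (suc n) (table n ++ (suc n , φ) ∷ [])    ≡⟨ findT-++ (table n) ((suc n , φ) ∷ []) (table-below n) ⟩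
  findT (suc n) ((suc n , φ) ∷ [])               ≡⟨ findT-here (suc n) φ ⟩
  φ                                              ∎
  where
  open ≡-Reasoning
  φ = divMonic (x-1 (suc n)) (cofactor n)

-- Sealed: unfolding Φ makes the normal forms of goals explode.
abstract
  cyc : ℕ → Poly
  cyc = Φ

  cyc≡Φ : ∀ n → cyc n ≡ Φ n
  cyc≡Φ n = refl

cyc-suc : ∀ n → cyc (suc n) ≡ divMonic (x-1 (suc n)) (cofactor n)
cyc-suc n = trans (cyc≡Φ (suc n)) (Φ-suc n)

prodΦ : (ℕ → Bool) → ℕ → Poly
prodΦ S zero = const 1ℤ
prodΦ S (suc m) = if S (suc m) then cyc (suc m) *P prodΦ S m else prodΦ S m

prodDiv-++ : ∀ x ts us → prodDiv x (ts ++ us) ≋ prodDiv x ts *P prodDiv x us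
prodDiv-++ x [] us = ≋-sym (*P-identityˡ _)
prodDiv-++ x ((d , φ) ∷ ts) us with d ∣? x
... | yes _ = ≋-trans (*P-cong (≋-refl {φ}) (prodDiv-++ x ts us)) (≋-sym (*P-assoc φ _ _))
... | no _ = prodDiv-++ x ts us

prodDiv-single : ∀ x d φ → prodDiv x ((d , φ) ∷ []) ≋ (if div x d then φ else const 1ℤ)
prodDiv-single x d φ with d ∣? x
... | yes _ = R.*-identityʳ φ
... | no _ = ≋-refl

*P-if : ∀ b f g → f *P (if b then g else const 1ℤ) ≋ (if b then g *P f else f)
*P-if true f g = *P-comm f g
*P-if false f g = R.*-identityʳ f

prodDiv-table : ∀ x n → prodDiv x (table n) ≋ prodΦ (div x) n
prodDiv-table x zero = ≋-refl
prodDiv-table x (suc n) = step (cyc-suc n)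
  where
  open ≋-Reasoning
  step : ∀ {φ} → cyc (suc n) ≡ φ → prodDiv x (table n ++ (suc n , φ) ∷ []) ≋ prodΦ (div x) (suc n)
  step refl = begin
    prodDiv x (table n ++ (suc n , cyc (suc n)) ∷ [])
      ≈⟨ prodDiv-++ x (table n) ((suc n , cyc (suc n)) ∷ []) ⟩
    prodDiv x (table n) *P prodDiv x ((suc n , cyc (suc n)) ∷ [])
      ≈⟨ *P-cong (prodDiv-table x n) (prodDiv-single x (suc n) (cyc (suc n))) ⟩
    prodΦ (div x) n *P (if div x (suc n) then cyc (suc n) else const 1ℤ)
      ≈⟨ *P-if (div x (suc n)) (prodΦ (div x) n) (cyc (suc n)) ⟩
    prodΦ (div x) (suc n) ∎

prodΦ-mono : ∀ (S T : ℕ → Bool) m → (∀ d → d ≤ m → S d ≡ true → T d ≡ true) → prodΦ S m ∣ᴾ prodΦ T m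
prodΦ-mono S T zero sub = ∣ᴾ-refl
prodΦ-mono S T (suc m) sub = step refl refl
  where
  ih : prodΦ S m ∣ᴾ prodΦ T m
  ih = prodΦ-mono S T m (λ d le → sub d (ℕP.m≤n⇒m≤1+n le))
  step : ∀ {s t : Bool} → S (suc m) ≡ s → T (suc m) ≡ t →
    (if s then cyc (suc m) *P prodΦ S m else prodΦ S m) ∣ᴾ (if t then cyc (suc m) *P prodΦ T m else prodΦ T m)
  step {true}  {true}  _  _  = ∣ᴾ-* (∣ᴾ-refl {cyc (suc m)}) ih
  step {true}  {false} eS eT = case trans (sym eT) (sub (suc m) ℕP.≤-refl eS) of λ ()
  step {false} {true}  _  _  = ∣ᴾ-trans ih (cyc (suc m) , *P-comm (cyc (suc m)) (prodΦ T m))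
  step {false} {false} _  _  = ih

prodΦ-split : ∀ (S T : ℕ → Bool) m → prodΦ S m ≋ prodΦ (λ d → S d ∧ T d) m *P prodΦ (λ d → S d ∧ not (T d)) m
prodΦ-split S T zero = ≋-sym (*P-identityˡ (const 1ℤ))
prodΦ-split S T (suc m) with prodΦ-split S T m | S (suc m) | T (suc m)
... | ih | true  | true  = ≋-trans (*P-cong (≋-refl {cyc (suc m)}) ih) (≋-sym (*P-assoc (cyc (suc m)) _ _))
... | ih | true  | false = ≋-trans (*P-cong (≋-refl {cyc (suc m)}) ih)
    (exchange (cyc (suc m)) (prodΦ (λ d → S d ∧ T d) m) (prodΦ (λ d → S d ∧ not (T d)) m))
  where
  exchange : ∀ φ f g → φ *P (f *P g) ≋ f *P (φ *P g)
  exchange = solve-∀ Poly-acr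
... | ih | false | _     = ih

prodΦ-beyond : ∀ n → .{{NonZero n}} → ∀ j → prodΦ (div n) (j + n) ≡ prodΦ (div n) n
prodΦ-beyond n zero = refl
prodΦ-beyond n (suc j) rewrite div-no {suc (j + n)} {n} (λ d∣n → ℕP.<⇒≱ (s≤s (ℕP.m≤n+m n j)) (∣⇒≤ d∣n)) =
  prodΦ-beyond n j

prodΦ-suc : ∀ S m → S (suc m) ≡ true → prodΦ S (suc m) ≡ cyc (suc m) *P prodΦ S m
prodΦ-suc S m e rewrite e = refl

ProdFormula : ℕ → Set
ProdFormula n = prodΦ (div n) n ≋ x-1 n

Φ-∣-x-1 : ∀ n → .{{NonZero n}} → ProdFormula n → cyc n ∣ᴾ x-1 n
Φ-∣-x-1 (suc m) E = prodΦ (div (suc m)) m ,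
  ≋-trans (≋-sym E) (subst (λ f → f ≋ cyc (suc m) *P prodΦ (div (suc m)) m)
    (sym (prodΦ-suc (div (suc m)) m (div-yes ∣-refl))) ≋-refl)

-- Φ_a divides (X^a - 1)/(X^g - 1), which is the constant a/g modulo X^g - 1.
Φ-mod-x-1 : ∀ a g → .{{NonZero a}} → .{{NonZero g}} → g ∣ a → g < a → ProdFormula a → ProdFormula g →
  ∃₂ λ L K → ∃ λ k → k ≢ 0ℤ × cyc a *P L ≋ x-1 g *P K +P const k
Φ-mod-x-1 (suc m) g (divides k eq) (s≤s g≤m) Ea Eg with geometric k g
... | G , K , e , e′ with prodΦ-mono (div g) (div (suc m)) m
                            (λ d _ d∣g → div-yes (∣-trans (div⇒∣ d∣g) (divides k eq)))
... | rest , er = rest , K , ℤ.+ k , k≢0 , ≋-trans (*P-cancelˡ _ _ (monic-x-1 g) cancel) e′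
  where
  open ≋-Reasoning
  S = div (suc m)
  k≢0 : ℤ.+ k ≢ 0ℤ
  k≢0 refl = case eq of λ ()
  x-1-g : prodΦ (div g) m ≋ x-1 g
  x-1-g = subst (λ j → prodΦ (div g) j ≋ x-1 g) (ℕP.m∸n+n≡m g≤m)
    (subst (_≋ x-1 g) (sym (prodΦ-beyond g (m ∸ g))) Eg)
  exchange : ∀ x φ r → x *P (φ *P r) ≋ φ *P (x *P r)
  exchange = solve-∀ Poly-acr
  cancel : x-1 g *P (cyc (suc m) *P rest) ≋ x-1 g *P G
  cancel = begin
    x-1 g *P (cyc (suc m) *P rest)           ≈⟨ exchange (x-1 g) (cyc (suc m)) rest ⟩
    cyc (suc m) *P (x-1 g *P rest)           ≈⟨ *P-cong (≋-refl {cyc (suc m)}) (*P-cong (≋-sym x-1-g) (≋-refl {rest})) ⟩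
    cyc (suc m) *P (prodΦ (div g) m *P rest) ≈⟨ *P-cong (≋-refl {cyc (suc m)}) (≋-sym er) ⟩
    cyc (suc m) *P prodΦ S m                 ≡⟨ sym (prodΦ-suc S m (div-yes ∣-refl)) ⟩
    prodΦ S (suc m)                        ≈⟨ Ea ⟩
    x-1 (suc m)                            ≡⟨ cong x-1 eq ⟩
    x-1 (k * g)                            ≈⟨ e ⟩
    x-1 g *P G                             ∎

-- With g the gcd, a nonzero constant is a combination of Φ_a and X^g - 1 by `Φ-mod-x-1`, and X^g -
-- 1 is a combination of X^a - 1 and X^b - 1, which are multiples of Φ_a and Φ_b.
Φ-coprime-< : ∀ a b → .{{NonZero a}} → .{{NonZero b}} → gcd a b < a →
  ProdFormula a → ProdFormula b → ProdFormula (gcd a b) → Coprimeᴾ (cyc a) (cyc b)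
Φ-coprime-< a b g<a Ea Eb Eg
  with Φ-mod-x-1 a (gcd a b) {{it}} {{ℕ.≢-nonZero (gcd[m,n]≢0 a b (inj₁ (ℕ.≢-nonZero⁻¹ a)))}} (gcd[m,n]∣m a b) g<a Ea Eg
     | x-1-gcd a b | Φ-∣-x-1 a Ea | Φ-∣-x-1 b Eb
... | L , K , k , k≢0 , e | u , v , eg | A , eA | B , eB =
  coprimeᴾ {u = L +P negP (K *P u *P A)} {v = negP (K *P v *P B)} k≢0 (begin
    (L +P negP (K *P u *P A)) *P cyc a +P negP (K *P v *P B) *P cyc b
      ≈⟨ expand L K u A (cyc a) v B (cyc b) ⟩
    cyc a *P L +P negP (K *P (u *P (cyc a *P A) +P v *P (cyc b *P B)))
      ≈⟨ +P-cong e (R.-‿cong {K *P (u *P (cyc a *P A) +P v *P (cyc b *P B))} (*P-cong (≋-refl {K})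
           (≋-trans (+P-cong (*P-cong (≋-refl {u}) (≋-sym eA)) (*P-cong (≋-refl {v}) (≋-sym eB))) (≋-sym eg)))) ⟩
    (x-1 (gcd a b) *P K +P const k) +P negP (K *P x-1 (gcd a b))
      ≈⟨ collapse (x-1 (gcd a b)) K (const k) ⟩
    const k ∎)
  where
  open ≋-Reasoning
  expand : ∀ L K u A a v B b → (L +P negP (K *P u *P A)) *P a +P negP (K *P v *P B) *P b
    ≋ a *P L +P negP (K *P (u *P (a *P A) +P v *P (b *P B)))
  expand = solve-∀ Poly-acr
  collapse : ∀ x K c → (x *P K +P c) +P negP (K *P x) ≋ c
  collapse = solve-∀ Poly-acr

Φ-coprime : ∀ a b → .{{NonZero a}} → .{{NonZero b}} → a ≢ b →
  ProdFormula a → ProdFormula b → ProdFormula (gcd a b) → Coprimeᴾ (cyc a) (cyc b)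
Φ-coprime a b a≢b Ea Eb Eg with gcd a b <? a | gcd a b <? b
... | yes g<a | _ = Φ-coprime-< a b g<a Ea Eb Eg
... | no _ | yes g<b = coprimeᴾ-sym (Φ-coprime-< b a (subst (_< b) (gcd-comm a b) g<b) Eb Ea
                         (subst ProdFormula (gcd-comm a b) Eg))
... | no g≮a | no g≮b = contradiction (trans (sym (attained a (gcd[m,n]∣m a b) g≮a)) (attained b (gcd[m,n]∣n a b) g≮b)) a≢b
  where
  attained : ∀ c → .{{NonZero c}} → gcd a b ∣ c → ¬ gcd a b < c → gcd a b ≡ c
  attained c g∣c g≮c = ℕP.≤-antisym (∣⇒≤ g∣c) (ℕP.≮⇒≥ g≮c)

-- The two halves are proved together: the product formula below n makes the earlier Φ_d coprime in
-- pairs, and their monicity is what allows `divMonic` to divide by their product.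
Correct : ℕ → Set
Correct n = .{{NonZero n}} → ProdFormula n × ∃ (Monic (cyc n))

module CorrectStep (m : ℕ) (ih : ∀ {k} → k < suc m → Correct k) where

  S : ℕ → Bool
  S = div (suc m)

  prodΦ-monic : ∀ j → j ≤ m → ∃ (Monic (prodΦ S j))
  prodΦ-monic zero _ = 0 , monic refl (λ { (suc i) _ → refl })
  prodΦ-monic (suc j) le = step (S (suc j)) (proj₂ (ih (s≤s le))) (prodΦ-monic j (ℕP.<⇒≤ le))
    where
    step : ∀ b {f g} → ∃ (Monic f) → ∃ (Monic g) → ∃ (Monic (if b then f *P g else g))
    step false _ G = G
    step true (n , F) (n′ , G) = n + n′ , monic-* F G

  coprime-earlier : ∀ j → suc j ≤ m → ∀ i → i ≤ j → Coprimeᴾ (prodΦ S i) (cyc (suc j))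
  coprime-earlier j j<m zero _ = coprimeᴾ-1 (cyc (suc j))
  coprime-earlier j j<m (suc i) i<j = step (S (suc i)) pair (coprime-earlier j j<m i (ℕP.<⇒≤ i<j))
    where
    step : ∀ b {f g l} → Coprimeᴾ f l → Coprimeᴾ g l → Coprimeᴾ (if b then f *P g else g) l
    step false _ c = c
    step true c c′ = coprimeᴾ-* c c′
    gcd≢0 : NonZero (gcd (suc i) (suc j))
    gcd≢0 = ℕ.≢-nonZero (gcd[m,n]≢0 (suc i) (suc j) (inj₁ λ ()))
    pair : Coprimeᴾ (cyc (suc i)) (cyc (suc j))
    pair = Φ-coprime (suc i) (suc j) (λ { refl → ℕP.n≮n i i<j })
      (proj₁ (ih (s≤s (ℕP.≤-trans i<j (ℕP.<⇒≤ j<m))))) (proj₁ (ih (s≤s j<m)))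
      (proj₁ (ih (s≤s (ℕP.≤-trans (∣⇒≤ (gcd[m,n]∣n (suc i) (suc j))) j<m)) {{gcd≢0}}))

  HasMultiple : Poly → Set
  HasMultiple f = ∃ λ c → c ≢ 0ℤ × f ∣ᴾ const c *P x-1 (suc m)

  prodΦ-∣-multiple : ∀ j → j ≤ m → HasMultiple (prodΦ S j)
  prodΦ-∣-multiple zero _ = 1ℤ , (λ ()) , 1∣ᴾ _
  prodΦ-∣-multiple (suc j) le = step refl (prodΦ-∣-multiple j (ℕP.<⇒≤ le))
    where
    step : ∀ {b} → S (suc j) ≡ b → HasMultiple (prodΦ S j) →
      HasMultiple (if b then cyc (suc j) *P prodΦ S j else prodΦ S j)
    step {false} _ multiple = multiple
    step {true} eq (c , c≢0 , d) =
      let c′ , c′≢0 , d′ = coprimeᴾ-∣ (coprime-earlier j le j ℕP.≤-refl) d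
            (∣ᴾ-trans (Φ-∣-x-1 (suc j) (proj₁ (ih (s≤s le)))) (x-1-∣ (div⇒∣ {suc j} {suc m} eq)))
      in c′ ℤ.* c , *≢0 c′≢0 c≢0 , ∣ᴾ-respˡ (*P-comm (prodΦ S j) (cyc (suc j))) d′

  cofactor-exact : prodΦ S m *P cyc (suc m) ≋ x-1 (suc m)
  cofactor-exact with prodΦ-∣-multiple m ℕP.≤-refl
  ... | c , c≢0 , q , e = ≋-trans (*P-cong (≋-sym same) (≋-refl {cyc (suc m)}))
    (subst (λ φ → cofactor m *P φ ≋ x-1 (suc m)) (sym (cyc-suc m))
      (divMonic-exact (x-1 (suc m)) q (monic-≋ (≋-sym same) (proj₂ (prodΦ-monic m ℕP.≤-refl))) c≢0
        (≋-trans e (*P-cong (≋-sym same) (≋-refl {q})))))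
    where
    same : cofactor m ≋ prodΦ S m
    same = prodDiv-table (suc m) m

  correct : Correct (suc m)
  correct = ≋-trans (subst (λ f → f ≋ cyc (suc m) *P prodΦ S m) (sym (prodΦ-suc S m (div-yes ∣-refl))) ≋-refl)
                    (≋-trans (*P-comm (cyc (suc m)) (prodΦ S m)) cofactor-exact)
          , monic-quotient (cyc (suc m)) (proj₂ (prodΦ-monic m ℕP.≤-refl)) (monic-≋ (≋-sym cofactor-exact) (monic-x-1 (suc m)))

Φ-correct : ∀ n → Correct n
Φ-correct = <-rec Correct λ
  { zero ih → ⊥-elim (ℕ.≢-nonZero⁻¹ 0 refl)
  ; (suc m) ih → CorrectStep.correct m ih }

prodΦ-x-1 : ∀ n → .{{NonZero n}} → ProdFormula n
prodΦ-x-1 n = proj₁ (Φ-correct n)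

prodXs : List ℕ → Poly
prodXs = foldr (λ s f → x-1 s *P f) (const 1ℤ)

-- An index d may divide several members of `ss`; it is charged to the first one. The selected Φ_d
-- with d ∣ s are part of the factorisation of X^s - 1, and the other indices are passed on to the
-- rest of the list.
prodΦ-∣-prodXs : ∀ N ss S → All (λ s → s ≤ N × NonZero s) ss →
  (∀ d → d ≤ N → S d ≡ true → Any (d ∣_) ss) → (∀ d → S d ≡ true → d ≢ 0) → prodΦ S N ∣ᴾ prodXs ss
prodΦ-∣-prodXs N [] S _ cover pos =
  ∣ᴾ-trans (prodΦ-mono S (λ _ → false) N (λ d le e → case cover d le e of λ ())) (empty N)
  where
  empty : ∀ N → prodΦ (λ _ → false) N ∣ᴾ const 1ℤ
  empty zero = ∣ᴾ-refl
  empty (suc N) = empty N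
prodΦ-∣-prodXs N (s ∷ ss) S ((s≤N , s≢0) All.∷ bounds) cover pos =
  ∣ᴾ-respˡ (≋-sym (prodΦ-split S (div s) N))
    (∣ᴾ-* (∣ᴾ-trans (prodΦ-mono _ (div s) N (λ d _ e → ∧-conicalʳ (S d) _ e))
                     (∣ᴾ-respʳ x-1-s ∣ᴾ-refl))
          (prodΦ-∣-prodXs N ss _ bounds rest (λ d e → pos d (∧-conicalˡ (S d) _ e))))
  where
  instance
    _ = s≢0
  x-1-s : prodΦ (div s) N ≋ x-1 s
  x-1-s = subst (λ j → prodΦ (div s) j ≋ x-1 s) (ℕP.m∸n+n≡m s≤N)
    (subst (_≋ x-1 s) (sym (prodΦ-beyond s (N ∸ s))) (prodΦ-x-1 s))
  rest : ∀ d → d ≤ N → (S d ∧ not (div s d)) ≡ true → Any (d ∣_) ss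
  rest d le e with cover d le (∧-conicalˡ (S d) _ e)
  ... | there d∣ss = d∣ss
  ... | here d∣s with trans (sym (cong not (div-yes d∣s))) (∧-conicalʳ (S d) _ e)
  ... | ()

-- The factors Φ_d of (X^M - 1) / Φ_M are distributed over the X^s - 1 with d ∣ s.
x-1-∣-cyc*prodXs : ∀ M ss → .{{NonZero M}} → All (λ s → s ≤ M × NonZero s) ss →
  (∀ d → d ∣ M → d < M → Any (d ∣_) ss) → x-1 M ∣ᴾ cyc M *P prodXs ss
x-1-∣-cyc*prodXs (suc m) ss bounds cover =
  ∣ᴾ-respˡ (≋-trans (*P-comm (cyc (suc m)) _) (CorrectStep.cofactor-exact m (λ {k} _ → Φ-correct k)))
    (∣ᴾ-* (∣ᴾ-refl {cyc (suc m)}) (∣ᴾ-trans extend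
       (prodΦ-∣-prodXs (suc m) ss proper bounds
         (λ d _ e → cover d (div⇒∣ (∧-conicalˡ (div (suc m) d) ⌊ d <? suc m ⌋ e)) (lt d e))
         (λ { zero e → λ _ → case 0∣⇒≡0 (div⇒∣ {0} {suc m} (∧-conicalˡ (div (suc m) 0) ⌊ 0 <? suc m ⌋ e)) of λ () ; (suc d) _ () }))))
  where
  proper : ℕ → Bool
  proper d = div (suc m) d ∧ ⌊ d <? suc m ⌋
  lt : ∀ d → proper d ≡ true → d < suc m
  lt d e = ⌊⌋-sound (d <? suc m) (∧-conicalʳ (div (suc m) d) ⌊ d <? suc m ⌋ e)
  proper-below : ∀ d → d ≤ m → div (suc m) d ≡ true → proper d ≡ true
  proper-below d le e with d <? suc m
  ... | yes _ rewrite e = refl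
  ... | no d≮ = contradiction (s≤s le) d≮
  proper-top : proper (suc m) ≡ false
  proper-top with suc m <? suc m
  ... | yes lt = contradiction lt (ℕP.n≮n _)
  ... | no _ = ∧-zeroʳ (div (suc m) (suc m))
  extend : prodΦ (div (suc m)) m ∣ᴾ prodΦ proper (suc m)
  extend = subst (λ b → prodΦ (div (suc m)) m ∣ᴾ (if b then cyc (suc m) *P prodΦ proper m else prodΦ proper m))
    (sym proper-top) (prodΦ-mono (div (suc m)) proper m proper-below)

-- Cuboids

sumOver : List ℕ → (ℕ → ℤ) → ℤ
sumOver [] h = 0ℤ
sumOver (e ∷ es) h = h e ℤ.+ sumOver es h

sumOver-++ : ∀ es fs h → sumOver (es ++ fs) h ≡ sumOver es h ℤ.+ sumOver fs h
sumOver-++ [] fs h = sym (ℤP.+-identityˡ _)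
sumOver-++ (e ∷ es) fs h rewrite sumOver-++ es fs h = sym (ℤP.+-assoc (h e) _ _)

sumOver-map : ∀ (φ : ℕ → ℕ) es h → sumOver (map φ es) h ≡ sumOver es (h ∘ φ)
sumOver-map φ [] h = refl
sumOver-map φ (e ∷ es) h = cong (ℤ._+_ (h (φ e))) (sumOver-map φ es h)

sumOver-≡0 : ∀ {h} es → All (λ e → h e ≡ 0ℤ) es → sumOver es h ≡ 0ℤ
sumOver-≡0 [] All.[] = refl
sumOver-≡0 (e ∷ es) (z All.∷ zs) = cong₂ ℤ._+_ z (sumOver-≡0 es zs)

sumOver-cong : ∀ {h h′} es → (∀ k → h k ≡ h′ k) → sumOver es h ≡ sumOver es h′
sumOver-cong [] eq = refl
sumOver-cong (e ∷ es) eq = cong₂ ℤ._+_ (eq e) (sumOver-cong es eq)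

sumOver-≥0 : ∀ {h} es → (∀ k → 0ℤ ℤ.≤ h k) → 0ℤ ℤ.≤ sumOver es h
sumOver-≥0 [] pos = ℤP.≤-refl
sumOver-≥0 (e ∷ es) pos = ℤP.+-mono-≤ (pos e) (sumOver-≥0 es pos)

sumOver-- : ∀ es h h′ → sumOver es (λ k → h k ℤ.- h′ k) ≡ sumOver es h ℤ.- sumOver es h′
sumOver-- [] h h′ = refl
sumOver-- (e ∷ es) h h′ rewrite sumOver-- es h h′ = rearrange (h e) (h′ e) (sumOver es h) (sumOver es h′)
  where
  rearrange : ∀ a b u v → a ℤ.- b ℤ.+ (u ℤ.- v) ≡ a ℤ.+ u ℤ.- (b ℤ.+ v)
  rearrange = ℤ-solve

1-x : ℕ → Poly
1-x u = const 1ℤ +P negP (mono u)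

⋆-1-x : ∀ u h k → (1-x u ⋆ h) k ≡ h k ℤ.- h (k + u)
⋆-1-x u h k = begin
  (1-x u ⋆ h) k                                   ≡⟨ ⋆-+ (const 1ℤ) (negP (mono u)) h k ⟩
  (const 1ℤ ⋆ h) k ℤ.+ (negP (mono u) ⋆ h) k      ≡⟨ cong₂ ℤ._+_ (⋆-const 1ℤ h k) (⋆-scale -1ℤ (mono u) h k) ⟩
  1ℤ ℤ.* h k ℤ.+ -1ℤ ℤ.* (mono u ⋆ h) k           ≡⟨ cong (λ v → 1ℤ ℤ.* h k ℤ.+ -1ℤ ℤ.* v) (⋆-mono u h k) ⟩
  1ℤ ℤ.* h k ℤ.+ -1ℤ ℤ.* h (k + u)                ≡⟨ simplify (h k) (h (k + u)) ⟩
  h k ℤ.- h (k + u)                               ∎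
  where
  open ≡-Reasoning
  simplify : ∀ a b → 1ℤ ℤ.* a ℤ.+ -1ℤ ℤ.* b ≡ a ℤ.- b
  simplify = ℤ-solve

cuboid : ∀ d → (Fin d → ℕ) → Poly
cuboid zero u = const 1ℤ
cuboid (suc d) u = 1-x (u Fin.zero) *P cuboid d (u ∘ Fin.suc)

alternating : List ℕ → List ℕ → (ℕ → ℤ) → ℤ
alternating E O h = sumOver E h ℤ.- sumOver O h

-- A shift by `u` is one more step from the starting vertex, so translated vertices change parity.
alternating-step : ∀ u E O h →
  alternating E O (1-x u ⋆ h) ≡ alternating (E ++ map (_+ u) O) (O ++ map (_+ u) E) h
alternating-step u E O h
  rewrite sumOver-cong E (⋆-1-x u h) | sumOver-cong O (⋆-1-x u h)
        | sumOver-- E h (λ k → h (k + u)) | sumOver-- O h (λ k → h (k + u))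
        | sumOver-++ E (map (_+ u) O) h | sumOver-++ O (map (_+ u) E) h
        | sumOver-map (_+ u) O h | sumOver-map (_+ u) E h
  = rearrange (sumOver E h) (sumOver E (λ k → h (k + u))) (sumOver O h) (sumOver O (λ k → h (k + u)))
  where
  rearrange : ∀ a b c d → a ℤ.- b ℤ.- (c ℤ.- d) ≡ a ℤ.+ d ℤ.- (c ℤ.+ b)
  rearrange = ℤ-solve

module Greedy (g : ℕ → ℤ) (g≥0 : ∀ k → 0ℤ ℤ.≤ g k) where

  SparseLines : ℕ → ℕ → Set
  SparseLines p s = ∀ k c c′ → c < c′ → c′ < p → g (k + c * s) ≢ 0ℤ → g (k + c′ * s) ≢ 0ℤ → ⊥

  -- Otherwise each of the `p` candidates is blocked by some position in `E`, and by the pigeonhole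
  -- principle two of them by the same one; the line through that vertex then meets the support
  -- twice.
  avoiding : ∀ p s E → SparseLines p s → length E < p → ∃ λ c → All (λ e → g (e + c * s) ≡ 0ℤ) E
  avoiding p s E sparse small with Fin.any? {n = p} (λ c → All.all? (λ e → g (e + toℕ c * s) ℤ.≟ 0ℤ) E)
  ... | yes (c , zeros) = toℕ c , zeros
  ... | no none = ⊥-elim (collision (Fin.pigeonhole small (λ c → Any.index (hit c))))
    where
    hit : ∀ c → Any (λ e → g (e + toℕ c * s) ≢ 0ℤ) E
    hit c = All.¬All⇒Any¬ (λ e → g (e + toℕ c * s) ℤ.≟ 0ℤ) E (λ zeros → none (c , zeros))
    collision : (∃₂ λ i j → i Fin.< j × Any.index (hit i) ≡ Any.index (hit j)) → ⊥
    collision (i , j , i<j , eq) = sparse e (toℕ i) (toℕ j) i<j (Fin.toℕ<n j) (Any.lookup-index (hit i))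
      (subst (λ x → g (x + toℕ j * s) ≢ 0ℤ) (cong (lookup E) (sym eq)) (Any.lookup-index (hit j)))
      where e = lookup E (Any.index (hit i))

  -- E and O list the even and odd vertices of the cuboid built so far; c is chosen
  -- so that none of the new odd vertices e + c s lies in the support of g.
  nonvanishing-cuboid : ∀ d (p s : Fin d → ℕ) t → (∀ j → SparseLines (p j) (s j)) → (∀ j → 2 ^ (toℕ j + t ∸ 1) < p j) →
    -- `t` counts the directions already used. Half of the 2^t vertices are even; at `t = 0`
    -- truncated subtraction gives the bound 1, which fits the single starting vertex.
    ∀ E O → length E ≤ 2 ^ (t ∸ 1) → length E + length O ≤ 2 ^ t →
    All (λ o → g o ≡ 0ℤ) O → 0ℤ ℤ.< sumOver E g →
    ∃ λ (c : Fin d → ℕ) → 0ℤ ℤ.< alternating E O (cuboid d (λ j → c j * s j) ⋆ g)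
  nonvanishing-cuboid zero p s t _ _ E O _ _ zeros pos = (λ ()) , subst (0ℤ ℤ.<_) (sym value) pos
    where
    one : ∀ k → (const 1ℤ ⋆ g) k ≡ g k
    one k = trans (⋆-const 1ℤ g k) (ℤP.*-identityˡ (g k))
    value : alternating E O (const 1ℤ ⋆ g) ≡ sumOver E g
    value = trans (cong₂ ℤ._-_ (sumOver-cong E one) (trans (sumOver-cong O one) (sumOver-≡0 O zeros))) (ℤP.+-identityʳ _)
  nonvanishing-cuboid (suc d) p s t sparse growth E O |E| |E|+|O| zeros pos
    with avoiding (p Fin.zero) (s Fin.zero) E (sparse Fin.zero) (ℕP.≤-<-trans |E| (growth Fin.zero))
  ... | c , new-zeros
    with nonvanishing-cuboid d (p ∘ Fin.suc) (s ∘ Fin.suc) (suc t) (sparse ∘ Fin.suc)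
           (λ j → subst (λ m → 2 ^ (m ∸ 1) < p (Fin.suc j)) (sym (ℕP.+-suc (toℕ j) t)) (growth (Fin.suc j)))
           (E ++ map (_+ c * s Fin.zero) O) (O ++ map (_+ c * s Fin.zero) E)
           -- Each old vertex yields one new even vertex, itself if it is even and its translate if
           -- it is odd, so the old total bounds the new `E`.
           (subst (_≤ 2 ^ t) (sym (len E O)) |E|+|O|)
           (subst (_≤ 2 ^ suc t) (sym (cong₂ _+_ (len E O) (len O E)))
             (ℕP.≤-trans (ℕP.+-mono-≤ |E|+|O| (subst (_≤ 2 ^ t) (ℕP.+-comm (length E) (length O)) |E|+|O|))
                         (ℕP.≤-reflexive (cong (2 ^ t +_) (sym (ℕP.+-identityʳ _))))))
           (All.++⁺ zeros (All.map⁺ new-zeros))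
           (subst (0ℤ ℤ.<_) (sym (sumOver-++ E _ g)) (ℤP.+-mono-<-≤ pos (sumOver-≥0 (map (_+ c * s Fin.zero) O) g≥0)))
    where
    len : ∀ xs ys → length (xs ++ map (_+ c * s Fin.zero) ys) ≡ length xs + length ys
    len xs ys = trans (LP.length-++ xs) (cong (length xs +_) (LP.length-map _ ys))
  ... | cs , positive = (λ { Fin.zero → c ; (Fin.suc j) → cs j }) ,
    subst (0ℤ ℤ.<_) (trans (sym (alternating-step (c * s Fin.zero) E O rest))
      (cong₂ ℤ._-_ (sumOver-cong E unfold) (sumOver-cong O unfold))) positive
    where
    rest : ℕ → ℤ
    rest = cuboid d (λ j → cs j * s (Fin.suc j)) ⋆ g
    unfold : ∀ k → (1-x (c * s Fin.zero) ⋆ rest) k ≡ (1-x (c * s Fin.zero) *P cuboid d (λ j → cs j * s (Fin.suc j)) ⋆ g) k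
    unfold k = sym (⋆-* (1-x (c * s Fin.zero)) (cuboid d (λ j → cs j * s (Fin.suc j))) g k)

  prodXs-∣-cuboid : ∀ d (c s : Fin d → ℕ) → prodXs (tabulate s) ∣ᴾ cuboid d (λ j → c j * s j)
  prodXs-∣-cuboid zero c s = ∣ᴾ-refl
  prodXs-∣-cuboid (suc d) c s = ∣ᴾ-* (∣ᴾ-trans (x-1-∣ (n∣m*n (c Fin.zero) {s Fin.zero})) (const -1ℤ , flip (mono (c Fin.zero * s Fin.zero))))
    (prodXs-∣-cuboid d (c ∘ Fin.suc) (s ∘ Fin.suc))
    where
    flip : ∀ x → const 1ℤ +P negP x ≋ (x +P const -1ℤ) *P const -1ℤ
    flip = solve-∀ Poly-acr

  -- The cuboid has steps c_j s_j, so its polynomial is a multiple of ∏ (X^(s_j) - 1). If the latter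
  -- annihilated `g`, the alternating sum that the greedy choice makes positive would be 0.
  not-annihilated : ∀ d (p s : Fin d → ℕ) → (∀ j → SparseLines (p j) (s j)) → (∀ j → 2 ^ (toℕ j ∸ 1) < p j) →
    ∀ k₀ → 0ℤ ℤ.< g k₀ → ¬ (∀ k → (prodXs (tabulate s) ⋆ g) k ≡ 0ℤ)
  not-annihilated d p s sparse growth k₀ pos killed
    with nonvanishing-cuboid d p s 0 sparse
           (λ j → subst (λ m → 2 ^ (m ∸ 1) < p j) (sym (ℕP.+-identityʳ (toℕ j))) (growth j))
           (k₀ ∷ []) [] ℕP.≤-refl ℕP.≤-refl All.[] (subst (0ℤ ℤ.<_) (sym (ℤP.+-identityʳ (g k₀))) pos)
  ... | c , positive with prodXs-∣-cuboid d c s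
  ... | q , e = ℤP.<-irrefl (sym value) positive
    where
    vanishes : ∀ k → (cuboid d (λ j → c j * s j) ⋆ g) k ≡ 0ℤ
    vanishes k = begin
      (cuboid d (λ j → c j * s j) ⋆ g) k         ≡⟨ at (≋-trans e (*P-comm W q)) g k ⟩
      (q *P W ⋆ g) k                             ≡⟨ ⋆-* q W g k ⟩
      (q ⋆ (W ⋆ g)) k                            ≡⟨ ⋆-cong q killed k ⟩
      (q ⋆ λ _ → 0ℤ) k                           ≡⟨ ⋆-0 q k ⟩
      0ℤ                                         ∎
      where
      open ≡-Reasoning
      W = prodXs (tabulate s)
    value : alternating (k₀ ∷ []) [] (cuboid d (λ j → c j * s j) ⋆ g) ≡ 0ℤ
    value rewrite vanishes k₀ = refl

-- Prime factors of M and subsets of ℤ_M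

prime-divisor : ∀ q → 1 < q → ∃ λ r → Prime r × r ∣ q
prime-divisor q@(suc _) 1<q with factorise q
... | record { factors = [] ; isFactorisation = refl } = ⊥-elim (ℕP.n≮n 1 1<q)
... | record { factors = r ∷ rs ; isFactorisation = eq ; factorsPrime = pr All.∷ _ } =
  r , pr , subst (r ∣_) (sym eq) (m∣m*n (product rs))

prime-∣-prime : ∀ {r p} → Prime r → Prime p → r ∣ p → r ≡ p
prime-∣-prime pr pp r∣p with prime⇒irreducible pp r∣p
... | inj₁ refl = ⊥-elim (¬prime[1] pr)
... | inj₂ r≡p = r≡p

prime-∣-^ : ∀ {r p} n → Prime r → Prime p → r ∣ p ^ n → r ≡ p
prime-∣-^ zero pr pp r∣1 with ∣1⇒≡1 r∣1
... | refl = ⊥-elim (¬prime[1] pr)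
prime-∣-^ {p = p} (suc n) pr pp r∣ with euclidsLemma p (p ^ n) pr r∣
... | inj₁ r∣p = prime-∣-prime pr pp r∣p
... | inj₂ r∣pⁿ = prime-∣-^ n pr pp r∣pⁿ

prime-∣-prodFin : ∀ d (p n : Fin d → ℕ) {r} → (∀ i → Prime (p i)) → Prime r →
  r ∣ prodFin d (λ i → p i ^ n i) → ∃ λ i → r ≡ p i
prime-∣-prodFin zero p n pp pr r∣1 with ∣1⇒≡1 r∣1
... | refl = ⊥-elim (¬prime[1] pr)
prime-∣-prodFin (suc d) p n pp pr r∣ with euclidsLemma (p Fin.zero ^ n Fin.zero) _ pr r∣
... | inj₁ r∣p = Fin.zero , prime-∣-^ (n Fin.zero) pr (pp Fin.zero) r∣p
... | inj₂ r∣rest with prime-∣-prodFin d (p ∘ Fin.suc) (n ∘ Fin.suc) (pp ∘ Fin.suc) pr r∣rest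
... | i , eq = Fin.suc i , eq

prodFin≢0 : ∀ d (f : Fin d → ℕ) → (∀ i → NonZero (f i)) → NonZero (prodFin d f)
prodFin≢0 zero f nz = _
prodFin≢0 (suc d) f nz = ℕP.m*n≢0 (f Fin.zero) _ {{nz Fin.zero}} {{prodFin≢0 d (f ∘ Fin.suc) (nz ∘ Fin.suc)}}

p∣pⁿ : ∀ p n → 1 ≤ n → p ∣ p ^ n
p∣pⁿ p (suc n) _ = m∣m*n (p ^ n)

∣-prodFin : ∀ d (f : Fin d → ℕ) i → f i ∣ prodFin d f
∣-prodFin (suc d) f Fin.zero = m∣m*n _
∣-prodFin (suc d) f (Fin.suc i) = ∣-trans (∣-prodFin d (f ∘ Fin.suc) i) (n∣m*n (f Fin.zero))

proper-divisor-∣ : ∀ {p s M d q} → .{{NonZero p}} → p * s ≡ M → M ≡ q * d → p ∣ q → d ∣ s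
proper-divisor-∣ {p} {s} {d = d} eq eq′ (divides q′ refl) = divides q′ (ℕP.*-cancelˡ-≡ s (q′ * d) p (begin
  p * s         ≡⟨ trans eq eq′ ⟩
  q′ * p * d    ≡⟨ cong (_* d) (ℕP.*-comm q′ p) ⟩
  p * q′ * d    ≡⟨ ℕP.*-assoc p q′ d ⟩
  p * (q′ * d)  ∎))
  where open ≡-Reasoning

-- Modulo M the number x is e s, and gcd(e s, p s) = s gcd(e, p) = s because 0 < e < p. The
-- multiples `U` and `V` of M state the congruence without subtraction.
gcd-on-line : ∀ {p s M x U V} e → .{{NonZero e}} → Prime p → p * s ≡ M → e < p →
  M ∣ U → M ∣ V → V + x ≡ U + e * s + M → gcd x M ≡ s
gcd-on-line {p} {s} {M} {x} {U} {V} e pp eq e<p M∣U M∣V sum≡ = ∣-antisym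
  (subst (gcd x M ∣_) gcd-es (gcd-greatest g∣es (gcd[m,n]∣n x M)))
  (gcd-greatest s∣x s∣M)
  where
  s∣M : s ∣ M
  s∣M = divides p (sym eq)
  s∣x : s ∣ x
  s∣x = ∣m+n∣m⇒∣n (subst (s ∣_) (sym sum≡) (∣m∣n⇒∣m+n (∣m∣n⇒∣m+n (∣-trans s∣M M∣U) (n∣m*n e)) s∣M)) (∣-trans s∣M M∣V)
  g = gcd x M
  g∣M = gcd[m,n]∣n x M
  g∣es : g ∣ e * s
  g∣es = ∣m+n∣n⇒∣m {n = M} (∣m+n∣m⇒∣n (subst (g ∣_) (trans sum≡ (ℕP.+-assoc U (e * s) M))
            (∣m∣n⇒∣m+n (∣-trans g∣M M∣V) (gcd[m,n]∣m x M))) (∣-trans g∣M M∣U)) g∣M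
    where
    ∣m+n∣n⇒∣m : ∀ {d m n} → d ∣ m + n → d ∣ n → d ∣ m
    ∣m+n∣n⇒∣m {d} {m} {n} h = ∣m+n∣m⇒∣n (subst (d ∣_) (ℕP.+-comm m n) h)
  gcd-es : gcd (e * s) M ≡ s
  gcd-es = begin
    gcd (e * s) M        ≡⟨ cong₂ gcd (ℕP.*-comm e s) (trans (sym eq) (ℕP.*-comm p s)) ⟩
    gcd (s * e) (s * p)  ≡⟨ c*gcd[m,n]≡gcd[cm,cn] s e p ⟨
    s * gcd e p          ≡⟨ cong (s *_) (trans (gcd-comm e p) (coprime⇒gcd≡1 (prime⇒coprime pp e<p))) ⟩
    s * 1                ≡⟨ ℕP.*-identityʳ s ⟩
    s                    ∎
    where open ≡-Reasoning

-- Sums over subsets of ℤ_M and their counting functions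

sumSet : ∀ {M} → Subset M → (ℕ → ℤ) → ℤ
sumSet [] f = 0ℤ
sumSet (b ∷ A) f = (if b then f 0 else 0ℤ) ℤ.+ sumSet A (f ∘ suc)

⋆-mask : ∀ {M} (A : Subset M) f k → (mask A ⋆ f) k ≡ sumSet A (λ a → f (k + a))
sumSet-cong : ∀ {M} (A : Subset M) {f f′} → (∀ a → f a ≡ f′ a) → sumSet A f ≡ sumSet A f′

⋆-mask [] f k = refl
⋆-mask (b ∷ A) f k = cong₂ ℤ._+_ (first b) (trans (⋆-mask A f (suc k)) (sumSet-cong A (λ a → cong f (sym (ℕP.+-suc k a)))))
  where
  first : ∀ b → (if b then 1ℤ else 0ℤ) ℤ.* f k ≡ (if b then f (k + 0) else 0ℤ)
  first true = trans (ℤP.*-identityˡ (f k)) (cong f (sym (ℕP.+-identityʳ k)))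
  first false = refl

sumSet-cong [] eq = refl
sumSet-cong (true ∷ A) eq = cong₂ ℤ._+_ (eq 0) (sumSet-cong A (eq ∘ suc))
sumSet-cong (false ∷ A) eq = cong (ℤ._+_ 0ℤ) (sumSet-cong A (eq ∘ suc))

sumSet-zero : ∀ {M} (A : Subset M) {f} → (∀ a → a ∈ A → f (toℕ a) ≡ 0ℤ) → sumSet A f ≡ 0ℤ
sumSet-zero [] z = refl
sumSet-zero (true ∷ A) z = cong₂ ℤ._+_ (z Fin.zero Vec.here) (sumSet-zero A (λ a → z (Fin.suc a) ∘ Vec.there))
sumSet-zero (false ∷ A) z = cong (ℤ._+_ 0ℤ) (sumSet-zero A (λ a → z (Fin.suc a) ∘ Vec.there))

sumSet-≥0 : ∀ {M} (A : Subset M) {f} → (∀ a → 0ℤ ℤ.≤ f a) → 0ℤ ℤ.≤ sumSet A f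
sumSet-≥0 [] pos = ℤP.≤-refl
sumSet-≥0 (true ∷ A) pos = ℤP.+-mono-≤ (pos 0) (sumSet-≥0 A (pos ∘ suc))
sumSet-≥0 (false ∷ A) pos = ℤP.+-mono-≤ (ℤP.≤-refl {0ℤ}) (sumSet-≥0 A (pos ∘ suc))

sumSet-only : ∀ {M} (A : Subset M) {f} i → i ∈ A → (∀ a → a ∈ A → a ≢ i → f (toℕ a) ≡ 0ℤ) → sumSet A f ≡ f (toℕ i)
sumSet-only (true ∷ A) {f} Fin.zero Vec.here others =
  trans (cong (ℤ._+_ (f 0)) (sumSet-zero A (λ a a∈ → others (Fin.suc a) (Vec.there a∈) λ ()))) (ℤP.+-identityʳ (f 0))
sumSet-only (b ∷ A) {f} (Fin.suc i) (Vec.there i∈) others = trans (cong₂ ℤ._+_ (first b others) (sumSet-only A i i∈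
    (λ a a∈ a≢ → others (Fin.suc a) (Vec.there a∈) (a≢ ∘ Fin.suc-injective)))) (ℤP.+-identityˡ _)
  where
  first : ∀ b → (∀ a → a ∈ (b ∷ A) → a ≢ Fin.suc i → f (toℕ a) ≡ 0ℤ) → (if b then f 0 else 0ℤ) ≡ 0ℤ
  first true others = others Fin.zero Vec.here λ ()
  first false _ = refl

sumSet-≢0 : ∀ {M} (A : Subset M) {f} → sumSet A f ≢ 0ℤ → ∃ λ a → a ∈ A × f (toℕ a) ≢ 0ℤ
sumSet-≢0 [] nz = contradiction refl nz
sumSet-≢0 (b ∷ A) {f} nz with sumSet A (f ∘ suc) ℤ.≟ 0ℤ
... | no tail≢0 with sumSet-≢0 A tail≢0
... | a , a∈ , fa≢0 = Fin.suc a , Vec.there a∈ , fa≢0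
sumSet-≢0 (true ∷ A) {f} nz | yes tail≡0 =
  Fin.zero , Vec.here , λ f0≡0 → nz (cong₂ ℤ._+_ f0≡0 tail≡0)
sumSet-≢0 (false ∷ A) nz | yes tail≡0 = contradiction (cong (ℤ._+_ 0ℤ) tail≡0) nz

sumSet->0 : ∀ {M} (A : Subset M) {f} → (∀ a → 0ℤ ℤ.≤ f a) → ∀ i → i ∈ A → 0ℤ ℤ.< f (toℕ i) → 0ℤ ℤ.< sumSet A f
sumSet->0 (true ∷ A) pos Fin.zero Vec.here fi>0 = ℤP.+-mono-<-≤ fi>0 (sumSet-≥0 A (pos ∘ suc))
sumSet->0 (true ∷ A) pos (Fin.suc i) (Vec.there i∈) fi>0 = ℤP.+-mono-≤-< (pos 0) (sumSet->0 A (pos ∘ suc) i i∈ fi>0)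
sumSet->0 (false ∷ A) pos (Fin.suc i) (Vec.there i∈) fi>0 =
  ℤP.+-mono-≤-< (ℤP.≤-refl {0ℤ}) (sumSet->0 A (pos ∘ suc) i i∈ fi>0)

-- The sequence called δ in the overview; the `δ` of the code consists of the unit sequences.
multiple : ℕ → ℕ → ℤ
multiple M k = if ⌊ M ∣? k ⌋ then 1ℤ else 0ℤ

multiple-yes : ∀ {M k} → M ∣ k → multiple M k ≡ 1ℤ
multiple-yes {M} {k} d with M ∣? k
... | yes _ = refl
... | no ¬d = contradiction d ¬d

multiple-no : ∀ {M k} → ¬ M ∣ k → multiple M k ≡ 0ℤ
multiple-no {M} {k} ¬d with M ∣? k
... | yes d = contradiction d ¬d
... | no _ = refl

multiple-≢0 : ∀ {M k} → multiple M k ≢ 0ℤ → M ∣ k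
multiple-≢0 {M} {k} nz with M ∣? k
... | yes d = d
... | no _ = contradiction refl nz

multiple-≥0 : ∀ M k → 0ℤ ℤ.≤ multiple M k
multiple-≥0 M k with M ∣? k
... | yes _ = ℤ.+≤+ z≤n
... | no _ = ℤP.≤-refl

multiple-≡ : ∀ {M k k′} → (M ∣ k → M ∣ k′) → (M ∣ k′ → M ∣ k) → multiple M k ≡ multiple M k′
multiple-≡ {M} {k} {k′} to from with M ∣? k
... | yes d = sym (multiple-yes (to d))
... | no ¬d = sym (multiple-no (¬d ∘ from))

multiple-periodic : ∀ M k → multiple M (k + M) ≡ multiple M k
multiple-periodic M k = multiple-≡ (λ d → ∣m+n∣m⇒∣n (subst (M ∣_) (ℕP.+-comm k M) d) ∣-refl) (λ d → ∣m∣n⇒∣m+n d ∣-refl)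

-- hits A k = #{ a ∈ A : k + a ≡ 0 mod M }
hits : ∀ {M} → Subset M → ℕ → ℤ
hits {M} A = mask A ⋆ multiple M

hits-≥0 : ∀ {M} (A : Subset M) k → 0ℤ ℤ.≤ hits A k
hits-≥0 {M} A k = subst (0ℤ ℤ.≤_) (sym (⋆-mask A (multiple M) k)) (sumSet-≥0 A (λ a → multiple-≥0 M (k + a)))

hits-≢0 : ∀ {M} (A : Subset M) {k} → hits A k ≢ 0ℤ → ∃ λ a → a ∈ A × M ∣ k + toℕ a
hits-≢0 {M} A {k} nz with sumSet-≢0 A (nz ∘ trans (⋆-mask A (multiple M) k))
... | a , a∈ , m≢0 = a , a∈ , multiple-≢0 m≢0

hits->0 : ∀ {M} (A : Subset M) a → a ∈ A → 0ℤ ℤ.< hits A (M ∸ toℕ a)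
hits->0 {M} A a a∈ = subst (0ℤ ℤ.<_) (sym (⋆-mask A (multiple M) (M ∸ toℕ a)))
  (sumSet->0 A (λ b → multiple-≥0 M (M ∸ toℕ a + b)) a a∈
    (subst (0ℤ ℤ.<_) (sym (multiple-yes M∣)) (ℤ.+<+ (s≤s z≤n))))
  where
  M∣ : M ∣ M ∸ toℕ a + toℕ a
  M∣ = subst (M ∣_) (sym (ℕP.m∸n+n≡m (ℕP.<⇒≤ (Fin.toℕ<n a)))) ∣-refl

⋆-x-1 : ∀ M h k → (x-1 M ⋆ h) k ≡ h (k + M) ℤ.- h k
⋆-x-1 M h k = trans (⋆-+ (mono M) (const -1ℤ) h k)
  (cong₂ ℤ._+_ (⋆-mono M h k) (trans (⋆-const -1ℤ h k) (ℤP.-1*i≡-i (h k))))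

x-1-kills-periodic : ∀ {M f h} → (∀ k → h (k + M) ≡ h k) → x-1 M ∣ᴾ f → ∀ k → (f ⋆ h) k ≡ 0ℤ
x-1-kills-periodic {M} {f} {h} per (q , e) k = begin
  (f ⋆ h) k              ≡⟨ at (≋-trans e (*P-comm (x-1 M) q)) h k ⟩
  (q *P x-1 M ⋆ h) k     ≡⟨ ⋆-* q (x-1 M) h k ⟩
  (q ⋆ (x-1 M ⋆ h)) k    ≡⟨ ⋆-cong q (λ k → trans (⋆-x-1 M h k) (trans (cong (ℤ._- h k) (per k)) (ℤP.+-inverseʳ (h k)))) k ⟩
  (q ⋆ λ _ → 0ℤ) k       ≡⟨ ⋆-0 q k ⟩
  0ℤ                     ∎
  where open ≡-Reasoning

-- Multiples of Φ_M, with the facts about W that both halves of the theorem share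

module PrimePowers (d : ℕ) (p : Fin d → ℕ) (pr : ∀ i → Prime (p i)) (n : Fin d → ℕ) (n≥1 : ∀ i → 1 ≤ n i)
  (growth : ∀ j → 2 ^ (toℕ j ∸ 1) < p j) (M : ℕ) (M≡ : M ≡ prodFin d (λ i → p i ^ n i)) where

  instance
    M≢0 : NonZero M
    M≢0 = subst NonZero (sym M≡) (prodFin≢0 d _ (λ i → ℕP.m^n≢0 (p i) (n i) {{prime⇒nonZero (pr i)}}))

  s : Fin d → ℕ
  s i = _/_ M (p i) {{prime⇒nonZero (pr i)}}

  p∣M : ∀ i → p i ∣ M
  p∣M i = subst (p i ∣_) (sym M≡) (∣-trans (p∣pⁿ (p i) (n i) (n≥1 i)) (∣-prodFin d (λ i → p i ^ n i) i))

  p*s≡M : ∀ i → p i * s i ≡ M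
  p*s≡M i = m*[n/m]≡n {{prime⇒nonZero (pr i)}} (p∣M i)

  s≢0 : ∀ i → NonZero (s i)
  s≢0 i = ℕP.m*n≢0⇒n≢0 (p i) {{subst NonZero (sym (p*s≡M i)) M≢0}}

  s≤M : ∀ i → s i ≤ M
  s≤M i = ∣⇒≤ (divides (p i) (sym (p*s≡M i)))

  -- The quotient M/e exceeds 1, so some p_i divides it, and e still divides M after that prime is
  -- removed.
  cover : ∀ {e} → e ∣ M → e < M → ∃ λ i → e ∣ s i
  cover {e} (divides zero M≡0) e<M = ⊥-elim (ℕ.≢-nonZero⁻¹ M M≡0)
  cover {e} (divides (suc zero) M≡e) e<M = ⊥-elim (ℕP.<⇒≢ e<M (sym (trans M≡e (ℕP.+-identityʳ e))))
  cover {e} (divides q@(suc (suc _)) M≡qe) e<M with prime-divisor q (s≤s (s≤s z≤n))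
  ... | r , pr-r , r∣q with prime-∣-prodFin d p n pr pr-r (subst (r ∣_) M≡ (subst (r ∣_) (sym M≡qe) (∣-trans r∣q (m∣m*n e))))
  ... | i , refl = i , proper-divisor-∣ {{prime⇒nonZero (pr i)}} (p*s≡M i) M≡qe r∣q

  W : Poly
  W = prodXs (tabulate s)

  -- Two hits at c < c′ come from a, a′ in A with a - a′ ≡ (c′ - c) s_i modulo M, and the gcd of
  -- this difference with M is s_i.
  hits-sparse : (A : Subset M) → ¬ (∃[ i ] InDiv M (s i) A) → ∀ i → Greedy.SparseLines (hits A) (hits-≥0 A) (p i) (s i)
  hits-sparse A none i k c c′ c<c′ c′<p hit hit′ with hits-≢0 A hit | hits-≢0 A hit′
  ... | a , a∈ , M∣U | a′ , a′∈ , M∣V = none (i , a , a′ , a∈ , a′∈ ,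
    gcd-on-line (c′ ∸ c) {{ℕ.>-nonZero (ℕP.m<n⇒0<n∸m c<c′)}} (pr i) (p*s≡M i) (ℕP.≤-<-trans (ℕP.m∸n≤m c′ c) c′<p) M∣U M∣V sum≡)
    where
    open ≡-Reasoning
    x = (toℕ a + M) ∸ toℕ a′
    sum≡ : k + c′ * s i + toℕ a′ + x ≡ k + c * s i + toℕ a + (c′ ∸ c) * s i + M
    sum≡ = begin
      k + c′ * s i + toℕ a′ + x                         ≡⟨ ℕP.+-assoc (k + c′ * s i) (toℕ a′) x ⟩
      k + c′ * s i + (toℕ a′ + x)                       ≡⟨ cong (k + c′ * s i +_) (ℕP.m+[n∸m]≡n (ℕP.≤-trans (ℕP.<⇒≤ (Fin.toℕ<n a′)) (ℕP.m≤n+m M (toℕ a)))) ⟩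
      k + c′ * s i + (toℕ a + M)                        ≡⟨ cong (λ c → k + c * s i + (toℕ a + M)) (sym (ℕP.m+[n∸m]≡n (ℕP.<⇒≤ c<c′))) ⟩
      k + (c + (c′ ∸ c)) * s i + (toℕ a + M)            ≡⟨ arrange k c (c′ ∸ c) (s i) (toℕ a) M ⟩
      k + c * s i + toℕ a + (c′ ∸ c) * s i + M          ∎
      where
      arrange : ∀ k c e s a m → k + (c + e) * s + (a + m) ≡ k + c * s + a + e * s + m
      arrange = ℕ-solve

  W-kills⇒InDiv : (A : Subset M) → Nonempty A → (∀ k → (W ⋆ hits A) k ≡ 0ℤ) → ¬ ¬ (∃[ i ] InDiv M (s i) A)
  W-kills⇒InDiv A (a , a∈) killed none =
    Greedy.not-annihilated (hits A) (hits-≥0 A) d p s (hits-sparse A none) growth (M ∸ toℕ a) (hits->0 A a a∈) killed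

  -- The greedy argument only refutes the absence of a witness; this finite search produces one.
  InDiv? : (A : Subset M) → Dec (∃[ i ] InDiv M (s i) A)
  InDiv? A = Fin.any? λ i → Fin.any? λ a → Fin.any? λ a′ → (a ∈? A) ×-dec (a′ ∈? A) ×-dec (gcdDiff M a a′ ≟ s i)

  cyclotomic-case : (A : Subset M) → Nonempty A → Φ M ∣P mask A → ∃[ i ] InDiv M (s i) A
  cyclotomic-case A nonempty (q , eq) = decidable-stable (InDiv? A) (W-kills⇒InDiv A nonempty killed)
    where
    eq′ : mask A ≈P (cyc M *P q)
    eq′ = subst (λ φ → mask A ≈P (φ *P q)) (sym (cyc≡Φ M)) eq
    divisible : x-1 M ∣ᴾ W *P mask A
    divisible = ∣ᴾ-trans (x-1-∣-cyc*prodXs M (tabulate s) (All.tabulate⁺ λ i → s≤M i , s≢0 i)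
                   λ e e∣M e<M → Any.tabulate⁺ (proj₁ (cover e∣M e<M)) (proj₂ (cover e∣M e<M)))
      (q , ≋-trans (*P-cong (≋-refl {W}) (≈P⇒≋ eq′)) (arrange W (cyc M) q))
      where
      arrange : ∀ w φ q → w *P (φ *P q) ≋ (φ *P w) *P q
      arrange = solve-∀ Poly-acr
    killed : ∀ k → (W ⋆ hits A) k ≡ 0ℤ
    killed k = trans (sym (⋆-* W (mask A) (multiple M) k)) (x-1-kills-periodic (multiple-periodic M) divisible k)

-- Dilations of tilings

sum< : ℕ → (ℕ → ℤ) → ℤ
sum< zero f = 0ℤ
sum< (suc n) f = f 0 ℤ.+ sum< n (f ∘ suc)

sum<-cong : ∀ n {f f′} → (∀ i → i < n → f i ≡ f′ i) → sum< n f ≡ sum< n f′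
sum<-cong zero eq = refl
sum<-cong (suc n) eq = cong₂ ℤ._+_ (eq 0 (s≤s z≤n)) (sum<-cong n (λ i lt → eq (suc i) (s≤s lt)))

sum<-+ : ∀ m n f → sum< (m + n) f ≡ sum< m f ℤ.+ sum< n (λ i → f (m + i))
sum<-+ zero n f = sym (ℤP.+-identityˡ _)
sum<-+ (suc m) n f rewrite sum<-+ m n (f ∘ suc) = sym (ℤP.+-assoc (f 0) _ _)

sum<-last : ∀ n f → sum< (suc n) f ≡ sum< n f ℤ.+ f n
sum<-last zero f = trans (ℤP.+-identityʳ (f 0)) (sym (ℤP.+-identityˡ (f 0)))
sum<-last (suc n) f = trans (cong (ℤ._+_ (f 0)) (sum<-last n (f ∘ suc))) (sym (ℤP.+-assoc (f 0) _ _))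

sum<-const : ∀ n c → sum< n (λ _ → c) ≡ ℤ.+ n ℤ.* c
sum<-const zero c = refl
sum<-const (suc n) c = trans (cong (ℤ._+_ c) (sum<-const n c)) (sym (ℤP.suc-* (ℤ.+ n) c))

sum<-linear : ∀ n a f f′ → sum< n (λ i → a ℤ.* f i ℤ.+ f′ i) ≡ a ℤ.* sum< n f ℤ.+ sum< n f′
sum<-linear zero a f f′ = sym (trans (ℤP.+-identityʳ _) (ℤP.*-zeroʳ a))
sum<-linear (suc n) a f f′ rewrite sum<-linear n a (f ∘ suc) (f′ ∘ suc) =
  arrange a (f 0) (f′ 0) (sum< n (f ∘ suc)) (sum< n (f′ ∘ suc))
  where
  arrange : ∀ a x y u v → a ℤ.* x ℤ.+ y ℤ.+ (a ℤ.* u ℤ.+ v) ≡ a ℤ.* (x ℤ.+ u) ℤ.+ (y ℤ.+ v)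
  arrange = ℤ-solve

sum<-+-distrib : ∀ n f f′ → sum< n (λ i → f i ℤ.+ f′ i) ≡ sum< n f ℤ.+ sum< n f′
sum<-+-distrib n f f′ = begin
  sum< n (λ i → f i ℤ.+ f′ i)             ≡⟨ sum<-cong n (λ i _ → cong (ℤ._+ f′ i) (sym (ℤP.*-identityˡ (f i)))) ⟩
  sum< n (λ i → 1ℤ ℤ.* f i ℤ.+ f′ i)      ≡⟨ sum<-linear n 1ℤ f f′ ⟩
  1ℤ ℤ.* sum< n f ℤ.+ sum< n f′           ≡⟨ cong (ℤ._+ sum< n f′) (ℤP.*-identityˡ (sum< n f)) ⟩
  sum< n f ℤ.+ sum< n f′                  ∎
  where open ≡-Reasoning

sum<-zero : ∀ n {f} → (∀ i → i < n → f i ≡ 0ℤ) → sum< n f ≡ 0ℤ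
sum<-zero n z = trans (sum<-cong n z) (trans (sum<-const n 0ℤ) (ℤP.*-zeroʳ (ℤ.+ n)))

sumOver-sum< : ∀ n es (f : ℕ → ℕ → ℤ) → sum< n (λ i → sumOver es (f i)) ≡ sumOver es (λ e → sum< n (λ i → f i e))
sumOver-sum< n [] f = sum<-zero n (λ _ _ → refl)
sumOver-sum< n (e ∷ es) f = trans (sum<-+-distrib n (λ i → f i e) (λ i → sumOver es (f i)))
  (cong (ℤ._+_ (sum< n (λ i → f i e))) (sumOver-sum< n es f))

sumOver-const : ∀ es c → sumOver es (λ _ → c) ≡ ℤ.+ length es ℤ.* c
sumOver-const [] c = refl
sumOver-const (e ∷ es) c = trans (cong (ℤ._+_ c) (sumOver-const es c)) (sym (ℤP.suc-* (ℤ.+ length es) c))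

Periodic : ℕ → (ℕ → ℤ) → Set
Periodic u h = ∀ k → h (k + u) ≡ h k

periodic-* : ∀ {u h} c → Periodic u h → Periodic (c * u) h
periodic-* {h = h} zero per k = cong h (ℕP.+-identityʳ k)
periodic-* {u} {h} (suc c) per k = trans (cong h (sym (ℕP.+-assoc k u (c * u)))) (trans (periodic-* c per (k + u)) (per k))

periodic-⋆ : ∀ {u h} f → Periodic u h → Periodic u (f ⋆ h)
periodic-⋆ {u} {h} f per k = trans (sym (⋆-shift f h u k)) (⋆-cong f per k)

sum<-rotate : ∀ n f → f n ≡ f 0 → sum< n (f ∘ suc) ≡ sum< n f
sum<-rotate n f eq = ℤ+-cancelˡ (f 0) (trans (sum<-last n f) (trans (ℤP.+-comm (sum< n f) (f n)) (cong (ℤ._+ sum< n f) eq)))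
  where
  ℤ+-cancelˡ : ∀ a {x y} → a ℤ.+ x ≡ a ℤ.+ y → x ≡ y
  ℤ+-cancelˡ a {x} {y} eq = trans (isolate a x) (trans (cong (ℤ._- a) eq) (sym (isolate a y)))
    where
    isolate : ∀ a x → x ≡ a ℤ.+ x ℤ.- a
    isolate = ℤ-solve

window : ∀ {M h} → Periodic M h → ∀ k → sum< M (λ i → h (k + i)) ≡ sum< M h
window per zero = refl
window {M} {h} per (suc k) = trans (sum<-cong M (λ i _ → cong h (sym (ℕP.+-suc k i))))
  (trans (sum<-rotate M (λ i → h (k + i)) (trans (per k) (cong h (sym (ℕP.+-identityʳ k))))) (window per k))

monos : List ℕ → Poly
monos [] = []
monos (e ∷ es) = mono e +P monos es

⋆-monos : ∀ es h k → (monos es ⋆ h) k ≡ sumOver es (λ e → h (k + e))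
⋆-monos [] h k = refl
⋆-monos (e ∷ es) h k = trans (⋆-+ (mono e) (monos es) h k) (cong₂ ℤ._+_ (⋆-mono e h k) (⋆-monos es h k))

open import Algebra.Properties.Semiring.Exp R.semiring using () renaming (_^_ to _^P_)
open import Algebra.Properties.Semiring.Mult R.semiring using () renaming (_×_ to _×P_)
open import Algebra.Properties.Semiring.Sum R.semiring using (sum; sum-init-last)
open import Algebra.Properties.CommutativeSemiring.Binomial R.commutativeSemiring using (binomialTerm) renaming (theorem to binomial)

×P≋const : ∀ n f → n ×P f ≋ const (ℤ.+ n) *P f
×P≋const zero f = ≋-sym (≋-trans (*P-cong {const 0ℤ} {[]} {f} (≈P⇒≋ λ { zero → refl ; (suc i) → refl }) ≋-refl) ≋-refl)
×P≋const (suc n) f = ≋-trans (+P-cong (≋-refl {f}) (×P≋const n f))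
  (≋-trans (factor (const (ℤ.+ n)) f) (*P-cong {const (ℤ.+ n) +P const 1ℤ} {const (ℤ.+ suc n)} {f}
    (≈P⇒≋ λ { zero → cong ℤ.+_ (ℕP.+-comm n 1) ; (suc i) → refl }) ≋-refl))
  where
  factor : ∀ c f → f +P c *P f ≋ (c +P const 1ℤ) *P f
  factor = solve-∀ Poly-acr

prime-∤-! : ∀ {q} → Prime q → ∀ k → k < q → ¬ q ∣ k !
prime-∤-! pq zero k<q q∣1 with ∣1⇒≡1 q∣1
... | refl = ¬prime[1] pq
prime-∤-! {q} pq (suc k) k<q q∣ with euclidsLemma (suc k) (k !) pq q∣
... | inj₁ q∣k = ℕP.<⇒≱ k<q (∣⇒≤ q∣k)
... | inj₂ q∣k! = prime-∤-! pq k (ℕP.<-trans (ℕP.n<1+n k) k<q) q∣k!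

prime-∣-choose : ∀ {q k} → Prime q → 0 < k → k < q → q ∣ q choose k
prime-∣-choose {q} {k} pq 0<k k<q with euclidsLemma (q choose k) (k ! * (q ∸ k) !) pq (subst (q ∣_) (sym factorial) (q∣q! q))
  where
  instance
    _ = ℕP._!*_!≢0 k (q ∸ k)
  factorial : (q choose k) * (k ! * (q ∸ k) !) ≡ q !
  factorial = trans (cong (_* (k ! * (q ∸ k) !)) (nCk≡n!/k![n-k]! (ℕP.<⇒≤ k<q))) (m/n*n≡m (k![n∸k]!∣n! (ℕP.<⇒≤ k<q)))
  q∣q! : ∀ q → .{{NonZero q}} → q ∣ q !
  q∣q! (suc q) = m∣m*n (q !)
  instance
    _ = prime⇒nonZero pq
... | inj₁ q∣C = q∣C
... | inj₂ q∣ with euclidsLemma (k !) ((q ∸ k) !) pq q∣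
... | inj₁ q∣k! = contradiction q∣k! (prime-∤-! pq k k<q)
... | inj₂ q∣! = contradiction q∣! (prime-∤-! pq (q ∸ k) (ℕP.∸-monoʳ-< {o = 0} 0<k (ℕP.<⇒≤ k<q)))

∣ᴾ-sum : ∀ {f} n (t : Fin n → Poly) → (∀ i → f ∣ᴾ t i) → f ∣ᴾ sum t
∣ᴾ-sum {f} zero t d = [] , ≋-sym (R.zeroʳ f)
∣ᴾ-sum {f} (suc n) t d =
  let r , e = d Fin.zero
      r′ , e′ = ∣ᴾ-sum n (t ∘ Fin.suc) (d ∘ Fin.suc)
  in r +P r′ , ≋-trans (+P-cong e e′) (≋-sym (R.distribˡ f r r′))

∣ᴾ-× : ∀ q {n} b → q ∣ n → const (ℤ.+ q) ∣ᴾ n ×P b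
∣ᴾ-× q {n} b (divides c eq) = const (ℤ.+ c) *P b , (begin
  n ×P b                                    ≡⟨ cong (_×P b) (trans eq (ℕP.*-comm c q)) ⟩
  (q * c) ×P b                              ≈⟨ ×P≋const (q * c) b ⟩
  const (ℤ.+ (q * c)) *P b                  ≡⟨ cong (λ z → const z *P b) (ℤP.pos-* q c) ⟩
  const (ℤ.+ q ℤ.* ℤ.+ c) *P b              ≈⟨ *P-cong (const-* (ℤ.+ q) (ℤ.+ c)) (≋-refl {b}) ⟩
  const (ℤ.+ q) *P const (ℤ.+ c) *P b       ≈⟨ *P-assoc (const (ℤ.+ q)) (const (ℤ.+ c)) b ⟩
  const (ℤ.+ q) *P (const (ℤ.+ c) *P b)     ∎)
  where open ≋-Reasoning

-- The binomial sum begins with g^q and ends with f^q, and q divides every coefficient in between.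
frobenius-+ : ∀ {q} → Prime q → ∀ f g → ∃ λ r → (f +P g) ^P q ≋ (f ^P q +P g ^P q) +P const (ℤ.+ q) *P r
frobenius-+ {suc q} pq f g = quotient middles , (begin
    (f +P g) ^P suc q                       ≈⟨ binomial (suc q) f g ⟩
    t Fin.zero +P sum (t ∘ Fin.suc)         ≈⟨ +P-cong (first (g ^P suc q))
                                                 (≋-trans (sum-init-last (t ∘ Fin.suc)) (+P-cong (equality middles) last)) ⟩
    g ^P suc q +P (const (ℤ.+ suc q) *P quotient middles +P f ^P suc q)
      ≈⟨ arrange (g ^P suc q) (const (ℤ.+ suc q) *P quotient middles) (f ^P suc q) ⟩
    (f ^P suc q +P g ^P suc q) +P const (ℤ.+ suc q) *P quotient middles ∎)
  where
  open ≋-Reasoning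
  t : Fin (suc (suc q)) → Poly
  t = binomialTerm f g (suc q)
  middle : ∀ i → const (ℤ.+ suc q) ∣ᴾ t (Fin.suc (Fin.inject₁ i))
  middle i = ∣ᴾ-× (suc q) (f ^P k *P g ^P (suc q ∸ k))
    (prime-∣-choose pq (s≤s z≤n) (s≤s (subst (_< q) (sym (Fin.toℕ-inject₁ i)) (Fin.toℕ<n i))))
    where k = suc (toℕ (Fin.inject₁ i))
  middles : const (ℤ.+ suc q) ∣ᴾ sum (λ i → t (Fin.suc (Fin.inject₁ i)))
  middles = ∣ᴾ-sum q (λ i → t (Fin.suc (Fin.inject₁ i))) middle
  arrange : ∀ a b c → a +P (b +P c) ≋ (c +P a) +P b
  arrange = solve-∀ Poly-acr
  first : ∀ x → const 1ℤ *P x +P [] ≋ x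
  first = solve-∀ Poly-acr
  last : t (Fin.suc (Fin.fromℕ q)) ≋ f ^P suc q
  last = last-term (Fin.toℕ-fromℕ q)
    where
    simplify : ∀ x → (x *P const 1ℤ) +P [] ≋ x
    simplify = solve-∀ Poly-acr
    last-term : ∀ {k} → k ≡ q → (suc q choose suc k) ×P (f ^P suc k *P g ^P (q ∸ k)) ≋ f ^P suc q
    last-term refl = subst₂ (λ c j → c ×P (f ^P suc q *P g ^P j) ≋ f ^P suc q)
      (sym (nCn≡1 (suc q))) (sym (ℕP.n∸n≡0 q)) (simplify (f ^P suc q))

mono-^ : ∀ n e → mono e ^P n ≋ mono (n * e)
mono-^ zero e = ≋-refl
mono-^ (suc n) e = ≋-trans (*P-cong (≋-refl {mono e}) (mono-^ n e)) (mono-+ e (n * e))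

frobenius : ∀ {q} → Prime q → ∀ es → ∃ λ r → monos es ^P q ≋ monos (map (q *_) es) +P const (ℤ.+ q) *P r
frobenius {suc q} pq [] = [] , ≋-sym (R.zeroʳ (const (ℤ.+ suc q)))
frobenius {q} pq (e ∷ es) =
  let r , eq = frobenius pq es
      r′ , eq′ = frobenius-+ pq (mono e) (monos es)
  in r +P r′ , ≋-trans eq′ (≋-trans
       (+P-cong (+P-cong (mono-^ q e) eq) (≋-refl {const (ℤ.+ q) *P r′}))
       (arrange (mono (q * e)) (monos (map (q *_) es)) (const (ℤ.+ q)) r r′))
  where
  arrange : ∀ a b c r s → (a +P (b +P c *P r)) +P c *P s ≋ (a +P b) +P c *P (r +P s)
  arrange = solve-∀ Poly-acr

prime-∣-power : ∀ {q} n j → Prime q → q ∣ n ^ j → q ∣ n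
prime-∣-power n zero pq q∣1 with ∣1⇒≡1 q∣1
... | refl = ⊥-elim (¬prime[1] pq)
prime-∣-power n (suc j) pq q∣ with euclidsLemma n (n ^ j) pq q∣
... | inj₁ q∣n = q∣n
... | inj₂ q∣nʲ = prime-∣-power n j pq q∣nʲ

sum<-≥ : ∀ n {u} → (∀ i → 1ℤ ℤ.≤ u i) → ℤ.+ n ℤ.≤ sum< n u
sum<-≥ zero _ = ℤP.≤-refl
sum<-≥ (suc n) le = ℤP.+-mono-≤ (le 0) (sum<-≥ n (le ∘ suc))

-- A tiling as a convolution identity. The translations form an arbitrary list in ℕ, so dilating
-- them requires neither reduction modulo M nor a check that they stay distinct.
Tiles : List ℕ → (ℕ → ℤ) → Set
Tiles es h = ∀ k → sumOver es (λ e → h (k + e)) ≡ 1ℤ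

-- By Frobenius, F(X^q) h is congruent to F^q h = |F|^(q-1) modulo q, so it has no zero;
-- its mean value is 1, so it is constant.
tiles-dilate : ∀ {M q h} es → .{{NonZero M}} → Periodic M h → (∀ k → 0ℤ ℤ.≤ h k) → Prime q → ¬ q ∣ M →
  Tiles es h → Tiles (map (q *_) es) h
tiles-dilate {M} {q} {h} es per h≥0 pq q∤M tiles k = ℤP.≤-antisym u≤1 (u≥1 k)
  where
  n = length es
  F = monos es
  u : ℕ → ℤ
  u k = sumOver (map (q *_) es) (λ e → h (k + e))
  powers : ∀ j k → (F ^P suc j ⋆ h) k ≡ ℤ.+ (n ^ j)
  powers zero k = trans (at (R.*-identityʳ F) h k) (trans (⋆-monos es h k) (tiles k))
  powers (suc j) k = begin
    (F *P F ^P suc j ⋆ h) k          ≡⟨ ⋆-* F (F ^P suc j) h k ⟩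
    (F ⋆ (F ^P suc j ⋆ h)) k         ≡⟨ ⋆-cong F (powers j) k ⟩
    (F ⋆ λ _ → ℤ.+ (n ^ j)) k        ≡⟨ ⋆-monos es (λ _ → ℤ.+ (n ^ j)) k ⟩
    sumOver es (λ _ → ℤ.+ (n ^ j))   ≡⟨ sumOver-const es (ℤ.+ (n ^ j)) ⟩
    ℤ.+ n ℤ.* ℤ.+ (n ^ j)            ≡⟨ ℤP.pos-* n (n ^ j) ⟨
    ℤ.+ (n * n ^ j)                  ∎
    where open ≡-Reasoning
  -- A full period has the same sum wherever it starts, so the value does not depend on the
  -- dilation: `c = 1` evaluates it by the given tiling, `c = q` carries it over to `u`.
  total : ∀ c k → sum< M (λ i → sumOver es (λ e → h (k + i + c * e))) ≡ ℤ.+ n ℤ.* sum< M h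
  total c k = begin
    sum< M (λ i → sumOver es (λ e → h (k + i + c * e)))   ≡⟨ sumOver-sum< M es (λ i e → h (k + i + c * e)) ⟩
    sumOver es (λ e → sum< M (λ i → h (k + i + c * e)))   ≡⟨ sumOver-cong es (λ e → trans
                                                                 (sum<-cong M (λ i _ → cong h (move k i (c * e)))) (window per (k + c * e))) ⟩
    sumOver es (λ _ → sum< M h)                           ≡⟨ sumOver-const es (sum< M h) ⟩
    ℤ.+ n ℤ.* sum< M h                                    ∎
    where
    open ≡-Reasoning
    move : ∀ k i x → k + i + x ≡ k + x + i
    move = ℕ-solve
  mass : ℤ.+ n ℤ.* sum< M h ≡ ℤ.+ M
  mass = begin
    ℤ.+ n ℤ.* sum< M h                                ≡⟨ total 1 0 ⟨
    sum< M (λ i → sumOver es (λ e → h (i + 1 * e)))   ≡⟨ sum<-cong M (λ i _ → trans (sumOver-cong es (λ e → cong (λ x → h (i + x)) (ℕP.*-identityˡ e))) (tiles i)) ⟩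
    sum< M (λ _ → 1ℤ)                                 ≡⟨ sum<-const M 1ℤ ⟩
    ℤ.+ M ℤ.* 1ℤ                                      ≡⟨ ℤP.*-identityʳ (ℤ.+ M) ⟩
    ℤ.+ M                                             ∎
    where open ≡-Reasoning
  n∣M : n ∣ M
  n∣M = divides ℤ.∣ sum< M h ∣ (trans (cong ℤ.∣_∣ (sym mass)) (trans (ℤP.abs-* (ℤ.+ n) (sum< M h)) (ℕP.*-comm n _)))
  u-total : ∀ k → sum< M (λ i → u (k + i)) ≡ ℤ.+ M
  u-total k = trans (sum<-cong M (λ i _ → sumOver-map (q *_) es (λ e → h (k + i + e)))) (trans (total q k) mass)
  u≢0 : ∀ k → u k ≢ 0ℤ
  -- At a zero of `u` the congruence gives q ∣ n^(q-1), hence q ∣ n; and n ∣ M by `mass`.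
  u≢0 k uk≡0 = q∤M (∣-trans (prime-∣-power n (ℕ.pred q) pq q∣) n∣M)
    where
    instance
      _ = prime⇒nonZero pq
    r = proj₁ (frobenius pq es)
    z = (r ⋆ h) k
    value : ℤ.+ (n ^ ℕ.pred q) ≡ ℤ.+ q ℤ.* z
    value = begin
      ℤ.+ (n ^ ℕ.pred q)                                      ≡⟨ powers (ℕ.pred q) k ⟨
      (F ^P suc (ℕ.pred q) ⋆ h) k                             ≡⟨ cong (λ j → (F ^P j ⋆ h) k) (ℕP.suc-pred q) ⟩
      (F ^P q ⋆ h) k                                          ≡⟨ at (proj₂ (frobenius pq es)) h k ⟩
      (monos (map (q *_) es) +P const (ℤ.+ q) *P r ⋆ h) k     ≡⟨ ⋆-+ (monos (map (q *_) es)) (const (ℤ.+ q) *P r) h k ⟩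
      (monos (map (q *_) es) ⋆ h) k ℤ.+ (const (ℤ.+ q) *P r ⋆ h) k
        ≡⟨ cong₂ ℤ._+_ (trans (⋆-monos (map (q *_) es) h k) uk≡0) (trans (⋆-* (const (ℤ.+ q)) r h k) (⋆-const (ℤ.+ q) (r ⋆ h) k)) ⟩
      0ℤ ℤ.+ ℤ.+ q ℤ.* z                                      ≡⟨ ℤP.+-identityˡ _ ⟩
      ℤ.+ q ℤ.* z                                             ∎
      where open ≡-Reasoning
    q∣ : q ∣ n ^ ℕ.pred q
    q∣ = divides ℤ.∣ z ∣ (trans (cong ℤ.∣_∣ value) (trans (ℤP.abs-* (ℤ.+ q) z) (ℕP.*-comm q _)))
  u≥1 : ∀ k → 1ℤ ℤ.≤ u k
  u≥1 k = ℤP.i<j⇒suc[i]≤j (ℤP.≤∧≢⇒< (sumOver-≥0 (map (q *_) es) (λ e → h≥0 (k + e))) (u≢0 k ∘ sym))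
  u≤1 : u k ℤ.≤ 1ℤ
  u≤1 = subst (ℤ._≤ 1ℤ) (cong u (ℕP.+-identityʳ k)) (bound M (λ i → u (k + i)) (λ i → u≥1 (k + i)) (u-total k))
    where
    bound : ∀ M → .{{NonZero M}} → ∀ v → (∀ i → 1ℤ ℤ.≤ v i) → sum< M v ≡ ℤ.+ M → v 0 ℤ.≤ 1ℤ
    bound (suc M) v v≥1 total = ℤP.≮⇒≥ λ 1<v₀ →
      ℤP.<-irrefl (sym total) (ℤP.+-mono-<-≤ 1<v₀ (sum<-≥ M (v≥1 ∘ suc)))

-- Ramanujan sums

-- The indicator of the t divisible by no member of `P`, in product form so that inclusion-exclusion
-- can remove one prime at a time.
χ : List ℕ → ℕ → ℤ
χ [] t = 1ℤ
χ (p ∷ P) t = (1ℤ ℤ.- multiple p t) ℤ.* χ P t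

-- With P the primes dividing M and product P * Q = M, ramanujan M P Q 1 m is the Ramanujan sum
-- ∑ ζ^(t m) over the t < M prime to M, expanded by inclusion-exclusion.
ramanujan : ℕ → List ℕ → ℕ → ℕ → ℕ → ℤ
ramanujan M [] Q e m = ℤ.+ Q ℤ.* multiple M (e * m)
ramanujan M (p ∷ P) Q e m = -1ℤ ℤ.* ramanujan M P Q (p * e) m ℤ.+ ramanujan M P (p * Q) e m

χ-≢0 : ∀ P {t} → χ P t ≢ 0ℤ → All (λ p → ¬ p ∣ t) P
χ-≢0 [] _ = All.[]
χ-≢0 (p ∷ P) {t} nz =
  (λ p∣t → nz (cong (λ b → (1ℤ ℤ.- b) ℤ.* χ P t) (multiple-yes p∣t))) All.∷
  χ-≢0 P (λ z → nz (trans (cong (ℤ._*_ (1ℤ ℤ.- multiple p t)) z) (ℤP.*-zeroʳ (1ℤ ℤ.- multiple p t))))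

χ-* : ∀ {p} P → Prime p → All Prime P → All (p ≢_) P → ∀ t → χ P (p * t) ≡ χ P t
χ-* [] pp _ _ t = refl
χ-* {p} (r ∷ P) pp (pr All.∷ prs) (p≢r All.∷ p≢P) t =
  cong₂ (λ a b → (1ℤ ℤ.- a) ℤ.* b) (multiple-≡ (cancel ∘ euclidsLemma p t pr) (∣n⇒∣m*n p)) (χ-* P pp prs p≢P t)
  where
  cancel : r ∣ p ⊎ r ∣ t → r ∣ t
  cancel (inj₁ r∣p) = contradiction (sym (prime-∣-prime pr pp r∣p)) p≢r
  cancel (inj₂ r∣t) = r∣t

sum<-multiples : ∀ p N (f : ℕ → ℤ) → .{{NonZero p}} → sum< (p * N) (λ t → multiple p t ℤ.* f t) ≡ sum< N (λ t → f (p * t))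
sum<-multiples p zero f = cong (λ n → sum< n (λ t → multiple p t ℤ.* f t)) (ℕP.*-zeroʳ p)
sum<-multiples p@(suc p′) (suc N) f = begin
  sum< (p * suc N) (λ t → multiple p t ℤ.* f t)         ≡⟨ cong (λ n → sum< n (λ t → multiple p t ℤ.* f t)) (ℕP.*-suc p N) ⟩
  sum< (p + p * N) (λ t → multiple p t ℤ.* f t)         ≡⟨ sum<-+ p (p * N) (λ t → multiple p t ℤ.* f t) ⟩
  sum< p (λ t → multiple p t ℤ.* f t) ℤ.+ sum< (p * N) (λ t → multiple p (p + t) ℤ.* f (p + t))
    ≡⟨ cong₂ ℤ._+_ (cong₂ ℤ._+_ first (sum<-zero p′ others)) (trans
         (sum<-cong (p * N) (λ t _ → cong (ℤ._* f (p + t)) (multiple-≡ {p} {p + t} {t} (λ d → ∣m+n∣m⇒∣n d ∣-refl) (∣m∣n⇒∣m+n ∣-refl))))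
         (sum<-multiples p N (λ t → f (p + t)))) ⟩
  f (p * 0) ℤ.+ 0ℤ ℤ.+ sum< N (λ t → f (p + p * t))
    ≡⟨ cong₂ ℤ._+_ (ℤP.+-identityʳ (f (p * 0))) (sum<-cong N (λ t _ → cong f (sym (ℕP.*-suc p t)))) ⟩
  f (p * 0) ℤ.+ sum< N (λ t → f (p * suc t))            ∎
  where
  open ≡-Reasoning
  first : multiple p 0 ℤ.* f 0 ≡ f (p * 0)
  first = trans (cong (ℤ._* f 0) (multiple-yes (p ∣0))) (trans (ℤP.*-identityˡ (f 0)) (cong f (sym (ℕP.*-zeroʳ p))))
  others : ∀ t → t < p′ → multiple p (suc t) ℤ.* f (suc t) ≡ 0ℤ
  others t t<p′ = cong (ℤ._* f (suc t)) (multiple-no (λ d → ℕP.<⇒≱ (s≤s t<p′) (∣⇒≤ d)))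

periodic-∣ : ∀ {u v h} → Periodic u h → u ∣ v → Periodic v h
periodic-∣ per (divides-refl c) = periodic-* c per

periodic-gcd : ∀ {a b h} → Periodic a h → Periodic b h → Periodic (gcd a b) h
periodic-gcd {a} {b} {h} perᵃ perᵇ k with Bézout.identity (gcd-GCD a b)
... | Bézout.+- x y eq = begin
  h (k + gcd a b)              ≡⟨ periodic-* y perᵇ (k + gcd a b) ⟨
  h (k + gcd a b + y * b)      ≡⟨ cong h (trans (ℕP.+-assoc k (gcd a b) (y * b)) (cong (k +_) eq)) ⟩
  h (k + x * a)                ≡⟨ periodic-* x perᵃ k ⟩
  h k                          ∎
  where open ≡-Reasoning
... | Bézout.-+ x y eq = begin
  h (k + gcd a b)              ≡⟨ periodic-* x perᵃ (k + gcd a b) ⟨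
  h (k + gcd a b + x * a)      ≡⟨ cong h (trans (ℕP.+-assoc k (gcd a b) (x * a)) (cong (k +_) eq)) ⟩
  h (k + y * b)                ≡⟨ periodic-* y perᵇ k ⟩
  h k                          ∎
  where open ≡-Reasoning

-- The second hypothesis says that `H` sums to 0 over every coset of a nontrivial subgroup, which
-- means that only primitive frequencies occur in it. For a prime p in `P` the sum over all t is
-- corrected by the multiples of p; these form the same kind of sum with `e` replaced by p e. Once
-- `P` is empty, the sum runs along a progression that closes up modulo M: it is Q H(k) if the step
-- is 0 modulo M and vanishes otherwise. The invariant is that the range of t times `e` is M.
ramanujan-average : ∀ {M H} → Periodic M H →
  (∀ Q n → M ∣ Q * n → ¬ M ∣ n → ∀ k → sum< Q (λ t → H (k + t * n)) ≡ 0ℤ) →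
  ∀ P Q e m → All Prime P → AllPairs _≢_ P → product P * Q * e ≡ M →
  ∀ k → sum< (product P * Q) (λ t → χ P t ℤ.* H (k + t * (e * m))) ≡ ramanujan M P Q e m ℤ.* H k
ramanujan-average {M} {H} per vanish [] Q e m _ _ eq k = begin
  sum< (Q + 0) (λ t → 1ℤ ℤ.* H (k + t * (e * m)))   ≡⟨ cong (λ n → sum< n (λ t → 1ℤ ℤ.* H (k + t * (e * m)))) (ℕP.+-identityʳ Q) ⟩
  sum< Q (λ t → 1ℤ ℤ.* H (k + t * (e * m)))         ≡⟨ sum<-cong Q (λ t _ → ℤP.*-identityˡ (H (k + t * (e * m)))) ⟩
  sum< Q (λ t → H (k + t * (e * m)))                ≡⟨ base (M ∣? (e * m)) ⟩
  ℤ.+ Q ℤ.* multiple M (e * m) ℤ.* H k              ∎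
  where
  open ≡-Reasoning
  Qe≡M : Q * e ≡ M
  Qe≡M = trans (cong (_* e) (sym (ℕP.+-identityʳ Q))) eq
  M∣Qem : M ∣ Q * (e * m)
  M∣Qem = divides m (trans (sym (ℕP.*-assoc Q e m)) (trans (cong (_* m) Qe≡M) (ℕP.*-comm M m)))
  base : Dec (M ∣ e * m) → sum< Q (λ t → H (k + t * (e * m))) ≡ ℤ.+ Q ℤ.* multiple M (e * m) ℤ.* H k
  base (yes d) = begin
    sum< Q (λ t → H (k + t * (e * m)))   ≡⟨ sum<-cong Q (λ t _ → periodic-∣ {h = H} per (∣n⇒∣m*n t d) k) ⟩
    sum< Q (λ _ → H k)                   ≡⟨ sum<-const Q (H k) ⟩
    ℤ.+ Q ℤ.* H k                        ≡⟨ cong (ℤ._* H k) (sym (trans (cong (ℤ._*_ (ℤ.+ Q)) (multiple-yes d)) (ℤP.*-identityʳ (ℤ.+ Q)))) ⟩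
    ℤ.+ Q ℤ.* multiple M (e * m) ℤ.* H k ∎
  base (no ¬d) = begin
    sum< Q (λ t → H (k + t * (e * m)))   ≡⟨ vanish Q (e * m) M∣Qem ¬d k ⟩
    0ℤ                                   ≡⟨ cong (ℤ._* H k) (sym (trans (cong (ℤ._*_ (ℤ.+ Q)) (multiple-no ¬d)) (ℤP.*-zeroʳ (ℤ.+ Q)))) ⟩
    ℤ.+ Q ℤ.* multiple M (e * m) ℤ.* H k ∎
ramanujan-average {M} {H} per vanish (p ∷ P) Q e m (pp All.∷ prs) (p≢P AP.∷ distinct) eq k = begin
  sum< (p * product P * Q) (λ t → (1ℤ ℤ.- multiple p t) ℤ.* χ P t ℤ.* H′ t)
    ≡⟨ sum<-cong (p * product P * Q) (λ t _ → expand (multiple p t) (χ P t) (H′ t)) ⟩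
  sum< (p * product P * Q) (λ t → -1ℤ ℤ.* (multiple p t ℤ.* (χ P t ℤ.* H′ t)) ℤ.+ χ P t ℤ.* H′ t)
    ≡⟨ sum<-linear (p * product P * Q) -1ℤ (λ t → multiple p t ℤ.* (χ P t ℤ.* H′ t)) (λ t → χ P t ℤ.* H′ t) ⟩
  -1ℤ ℤ.* sum< (p * product P * Q) (λ t → multiple p t ℤ.* (χ P t ℤ.* H′ t)) ℤ.+ sum< (p * product P * Q) (λ t → χ P t ℤ.* H′ t)
    ≡⟨ cong₂ (λ a b → -1ℤ ℤ.* a ℤ.+ b) multiples-of-p all-t ⟩
  -1ℤ ℤ.* (ramanujan M P Q (p * e) m ℤ.* H k) ℤ.+ ramanujan M P (p * Q) e m ℤ.* H k
    ≡⟨ collect (ramanujan M P Q (p * e) m) (ramanujan M P (p * Q) e m) (H k) ⟩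
  ramanujan M (p ∷ P) Q e m ℤ.* H k ∎
  where
  open ≡-Reasoning
  instance
    _ = prime⇒nonZero pp
  H′ : ℕ → ℤ
  H′ t = H (k + t * (e * m))
  expand : ∀ a c x → (1ℤ ℤ.- a) ℤ.* c ℤ.* x ≡ -1ℤ ℤ.* (a ℤ.* (c ℤ.* x)) ℤ.+ c ℤ.* x
  expand = ℤ-solve
  collect : ∀ a b x → -1ℤ ℤ.* (a ℤ.* x) ℤ.+ b ℤ.* x ≡ (-1ℤ ℤ.* a ℤ.+ b) ℤ.* x
  collect = ℤ-solve
  swap-p : ∀ p a q e → a * (p * q) * e ≡ p * a * q * e
  swap-p = ℕ-solve
  swap-p′ : ∀ p a q e → a * q * (p * e) ≡ p * a * q * e
  swap-p′ = ℕ-solve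
  swap-p″ : ∀ p a q → p * a * q ≡ a * (p * q)
  swap-p″ = ℕ-solve
  swap-t : ∀ p t e m → p * t * (e * m) ≡ t * (p * e * m)
  swap-t = ℕ-solve
  all-t : sum< (p * product P * Q) (λ t → χ P t ℤ.* H′ t) ≡ ramanujan M P (p * Q) e m ℤ.* H k
  all-t = trans (cong (λ n → sum< n (λ t → χ P t ℤ.* H′ t)) (swap-p″ p (product P) Q))
    (ramanujan-average per vanish P (p * Q) e m prs distinct (trans (swap-p p (product P) Q e) eq) k)
  multiples-of-p : sum< (p * product P * Q) (λ t → multiple p t ℤ.* (χ P t ℤ.* H′ t)) ≡ ramanujan M P Q (p * e) m ℤ.* H k
  multiples-of-p = begin
    sum< (p * product P * Q) (λ t → multiple p t ℤ.* (χ P t ℤ.* H′ t))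
      ≡⟨ cong (λ n → sum< n (λ t → multiple p t ℤ.* (χ P t ℤ.* H′ t))) (ℕP.*-assoc p (product P) Q) ⟩
    sum< (p * (product P * Q)) (λ t → multiple p t ℤ.* (χ P t ℤ.* H′ t))
      ≡⟨ sum<-multiples p (product P * Q) (λ t → χ P t ℤ.* H′ t) ⟩
    sum< (product P * Q) (λ t → χ P (p * t) ℤ.* H′ (p * t))
      ≡⟨ sum<-cong (product P * Q) (λ t _ → cong₂ ℤ._*_ (χ-* P pp prs p≢P t) (cong (λ x → H (k + x)) (swap-t p t e m))) ⟩
    sum< (product P * Q) (λ t → χ P t ℤ.* H (k + t * (p * e * m)))
      ≡⟨ ramanujan-average per vanish P Q (p * e) m prs distinct (trans (swap-p′ p (product P) Q e) eq) k ⟩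
    ramanujan M P Q (p * e) m ℤ.* H k ∎

ramanujan-periodic : ∀ {M} P Q e {u} → M ∣ e * u → Periodic u (ramanujan M P Q e)
ramanujan-periodic {M} [] Q e {u} M∣eu k = cong (ℤ._*_ (ℤ.+ Q)) (multiple-≡ {M} {e * (k + u)} {e * k}
  (λ d → ∣m+n∣m⇒∣n (subst (M ∣_) (trans (ℕP.*-distribˡ-+ e k u) (ℕP.+-comm (e * k) (e * u))) d) M∣eu)
  (λ d → subst (M ∣_) (sym (ℕP.*-distribˡ-+ e k u)) (∣m∣n⇒∣m+n d M∣eu)))
ramanujan-periodic {M} (p ∷ P) Q e {u} M∣eu k = cong₂ (λ a b → -1ℤ ℤ.* a ℤ.+ b)
  (ramanujan-periodic P Q (p * e) (subst (M ∣_) (sym (ℕP.*-assoc p e u)) (∣n⇒∣m*n p M∣eu)) k)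
  (ramanujan-periodic P (p * Q) e M∣eu k)

-- In the inclusion-exclusion expansion every term in which some p has entered `e` has a period u
-- with M ∣ p u, so X^u - 1 and with it `f` annihilates it. Only the term with e = 1 survives.
⋆-ramanujan : ∀ {M f} P Q → All (λ p → ∃ λ u → M ∣ p * u × x-1 u ∣ᴾ f) P →
  ∀ k → (f ⋆ ramanujan M P Q 1) k ≡ ℤ.+ (product P * Q) ℤ.* (f ⋆ multiple M) k
⋆-ramanujan {M} {f} [] Q _ k = begin
  (f ⋆ λ m → ℤ.+ Q ℤ.* multiple M (1 * m)) k               ≡⟨ ⋆-cong f (λ m → trans (cong (λ x → ℤ.+ Q ℤ.* multiple M x) (ℕP.*-identityˡ m))
                                                                (sym (ℤP.+-identityʳ _))) k ⟩
  (f ⋆ λ m → ℤ.+ Q ℤ.* multiple M m ℤ.+ 0ℤ) k              ≡⟨ ⋆-linear f (ℤ.+ Q) (multiple M) (λ _ → 0ℤ) k ⟩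
  ℤ.+ Q ℤ.* (f ⋆ multiple M) k ℤ.+ (f ⋆ λ _ → 0ℤ) k        ≡⟨ trans (cong (ℤ._+_ (ℤ.+ Q ℤ.* (f ⋆ multiple M) k)) (⋆-0 f k)) (ℤP.+-identityʳ _) ⟩
  ℤ.+ Q ℤ.* (f ⋆ multiple M) k                             ≡⟨ cong (λ q → ℤ.+ q ℤ.* (f ⋆ multiple M) k) (sym (ℕP.*-identityˡ Q)) ⟩
  ℤ.+ (1 * Q) ℤ.* (f ⋆ multiple M) k                       ∎
  where open ≡-Reasoning
⋆-ramanujan {M} {f} (p ∷ P) Q ((u , M∣pu , killed) All.∷ rest) k = begin
  (f ⋆ ramanujan M (p ∷ P) Q 1) k
    ≡⟨ ⋆-linear f -1ℤ (ramanujan M P Q (p * 1)) (ramanujan M P (p * Q) 1) k ⟩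
  -1ℤ ℤ.* (f ⋆ ramanujan M P Q (p * 1)) k ℤ.+ (f ⋆ ramanujan M P (p * Q) 1) k
    ≡⟨ cong₂ (λ a b → -1ℤ ℤ.* a ℤ.+ b)
         (x-1-kills-periodic {h = ramanujan M P Q (p * 1)} (ramanujan-periodic P Q (p * 1) (subst (λ e → M ∣ e * u) (sym (ℕP.*-identityʳ p)) M∣pu)) killed k)
         (⋆-ramanujan P (p * Q) rest k) ⟩
  -1ℤ ℤ.* 0ℤ ℤ.+ ℤ.+ (product P * (p * Q)) ℤ.* (f ⋆ multiple M) k
    ≡⟨ trans (ℤP.+-identityˡ _) (cong (λ n → ℤ.+ n ℤ.* (f ⋆ multiple M) k) (rearrange (product P) p Q)) ⟩
  ℤ.+ (p * product P * Q) ℤ.* (f ⋆ multiple M) k ∎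
  where
  open ≡-Reasoning
  rearrange : ∀ a p q → a * (p * q) ≡ p * a * q
  rearrange = ℕ-solve

⋆-sum< : ∀ f Q (g : ℕ → ℕ → ℤ) k → (f ⋆ (λ i → sum< Q (λ t → g t i))) k ≡ sum< Q (λ t → (f ⋆ g t) k)
⋆-sum< f zero g k = ⋆-0 f k
⋆-sum< f (suc Q) g k = begin
  (f ⋆ λ i → g 0 i ℤ.+ sum< Q (λ t → g (suc t) i)) k            ≡⟨ ⋆-cong f (λ i → cong (ℤ._+ sum< Q (λ t → g (suc t) i)) (sym (ℤP.*-identityˡ (g 0 i)))) k ⟩
  (f ⋆ λ i → 1ℤ ℤ.* g 0 i ℤ.+ sum< Q (λ t → g (suc t) i)) k     ≡⟨ ⋆-linear f 1ℤ (g 0) (λ i → sum< Q (λ t → g (suc t) i)) k ⟩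
  1ℤ ℤ.* (f ⋆ g 0) k ℤ.+ (f ⋆ λ i → sum< Q (λ t → g (suc t) i)) k ≡⟨ cong₂ ℤ._+_ (ℤP.*-identityˡ ((f ⋆ g 0) k)) (⋆-sum< f Q (g ∘ suc) k) ⟩
  (f ⋆ g 0) k ℤ.+ sum< Q (λ t → (f ⋆ g (suc t)) k)              ∎
  where open ≡-Reasoning

-- Tilings as identities between counting functions

elems : ∀ {M} → Subset M → List ℕ
elems [] = []
elems (true ∷ A) = 0 ∷ map suc (elems A)
elems (false ∷ A) = map suc (elems A)

sumSet-elems : ∀ {M} (A : Subset M) f → sumSet A f ≡ sumOver (elems A) f
sumSet-elems [] f = refl
sumSet-elems (true ∷ A) f = cong (ℤ._+_ (f 0)) (trans (sumSet-elems A (f ∘ suc)) (sym (sumOver-map suc (elems A) f)))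
sumSet-elems (false ∷ A) f = trans (ℤP.+-identityˡ _) (trans (sumSet-elems A (f ∘ suc)) (sym (sumOver-map suc (elems A) f)))

mod-∣ : ∀ {M u x y} → M ∣ u + x → x ≡ y [modℕ M ] → M ∣ u + y
mod-∣ {M} {u} {x} {y} d (c , inj₁ refl) = ∣m+n∣m⇒∣n (subst (M ∣_) (trans (sym (ℕP.+-assoc u y (c * M))) (ℕP.+-comm (u + y) (c * M))) d) (n∣m*n c)
mod-∣ {M} {u} {x} {y} d (c , inj₂ refl) = subst (M ∣_) (ℕP.+-assoc u x (c * M)) (∣m∣n⇒∣m+n d (n∣m*n c))

mod-sym : ∀ {M x y} → x ≡ y [modℕ M ] → y ≡ x [modℕ M ]
mod-sym (c , inj₁ eq) = c , inj₂ eq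
mod-sym (c , inj₂ eq) = c , inj₁ eq

∣-mod-≤ : ∀ {M u x y} → x ≤ y → M ∣ u + x → M ∣ u + y → x ≡ y [modℕ M ]
∣-mod-≤ {M} {u} {x} {y} x≤y dx dy
  with ∣m+n∣m⇒∣n (subst (M ∣_) (trans (cong (u +_) (sym (ℕP.m+[n∸m]≡n x≤y))) (sym (ℕP.+-assoc u x (y ∸ x)))) dy) dx
... | divides c eq = c , inj₂ (trans (sym (ℕP.m+[n∸m]≡n x≤y)) (cong (x +_) eq))

∣-mod : ∀ {M} u x y → M ∣ u + x → M ∣ u + y → x ≡ y [modℕ M ]
∣-mod u x y dx dy with ℕP.≤-total x y
... | inj₁ x≤y = ∣-mod-≤ {u = u} x≤y dx dy
... | inj₂ y≤x = mod-sym (∣-mod-≤ {u = u} y≤x dy dx)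

-- The residue of -k is that of k (M - 1), since k + k (M - 1) = k M.
complement : ∀ M → .{{_ : NonZero M}} → ∀ k → ∃ λ (x : Fin M) → M ∣ k + toℕ x
complement M@(suc M′) k = Fin.fromℕ< (m%n<n (k * M′) M) ,
  ∣m+n∣m⇒∣n (subst (M ∣_) total (n∣m*n k)) (n∣m*n (k * M′ / M))
  where
  total : k * M ≡ k * M′ / M * M + (k + toℕ (Fin.fromℕ< (m%n<n (k * M′) M)))
  total = begin
    k * M                                   ≡⟨ ℕP.*-suc k M′ ⟩
    k + k * M′                              ≡⟨ cong (k +_) (m≡m%n+[m/n]*n (k * M′) M) ⟩
    k + (k * M′ % M + k * M′ / M * M)       ≡⟨ move k (k * M′ % M) (k * M′ / M * M) ⟩
    k * M′ / M * M + (k + k * M′ % M)       ≡⟨ cong (λ x → k * M′ / M * M + (k + x)) (sym (Fin.toℕ-fromℕ< (m%n<n (k * M′) M))) ⟩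
    k * M′ / M * M + (k + toℕ (Fin.fromℕ< (m%n<n (k * M′) M))) ∎
    where
    open ≡-Reasoning
    move : ∀ k r q → k + (r + q) ≡ q + (k + r)
    move = ℕ-solve

-- The sum at k counts the pairs with a + b ≡ -k modulo M; covering supplies one, uniqueness removes
-- the other terms.
tiling⇒tiles : ∀ {M} → .{{NonZero M}} → (A B : Subset M) → IsTiling M A B → Tiles (elems A) (hits B)
tiling⇒tiles {M} A B (covers , unique) k = solve (complement M k)
  where
  open ≡-Reasoning
  pairs : ℕ → ℕ → ℤ
  pairs a b = multiple M (k + a + b)
  solve : (∃ λ (x : Fin M) → M ∣ k + toℕ x) → sumOver (elems A) (λ a → hits B (k + a)) ≡ 1ℤ
  solve (x , M∣k+x) with covers x
  ... | a , b , a∈ , b∈ , a+b≡x = begin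
    sumOver (elems A) (λ a → hits B (k + a))    ≡⟨ sumSet-elems A (λ a → hits B (k + a)) ⟨
    sumSet A (λ a → hits B (k + a))             ≡⟨ sumSet-cong A (λ a → ⋆-mask B (multiple M) (k + a)) ⟩
    sumSet A (λ a → sumSet B (pairs a))         ≡⟨ sumSet-only A a a∈ (λ a′ a′∈ a′≢a → sumSet-zero B (λ b′ b′∈ →
                                                     multiple-no (λ d → a′≢a (proj₁ (determined a′∈ b′∈ d))))) ⟩
    sumSet B (pairs (toℕ a))                    ≡⟨ sumSet-only B b b∈ (λ b′ b′∈ b′≢b →
                                                     multiple-no (λ d → b′≢b (proj₂ (determined a∈ b′∈ d)))) ⟩
    multiple M (k + toℕ a + toℕ b)              ≡⟨ multiple-yes M∣k+a+b ⟩
    1ℤ                                          ∎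
    where
    M∣k+[a+b] : M ∣ k + (toℕ a + toℕ b)
    M∣k+[a+b] = mod-∣ {u = k} M∣k+x (mod-sym a+b≡x)
    M∣k+a+b : M ∣ k + toℕ a + toℕ b
    M∣k+a+b = subst (M ∣_) (sym (ℕP.+-assoc k (toℕ a) (toℕ b))) M∣k+[a+b]
    determined : ∀ {a′ b′} → a′ ∈ A → b′ ∈ B → M ∣ k + toℕ a′ + toℕ b′ → a′ ≡ a × b′ ≡ b
    determined {a′} {b′} a′∈ b′∈ d = unique a′ a b′ b a′∈ a∈ b′∈ b∈
      (∣-mod k (toℕ a′ + toℕ b′) (toℕ a + toℕ b) (subst (M ∣_) (ℕP.+-assoc k (toℕ a′) (toℕ b′)) d) M∣k+[a+b])

tiles-coprime : ∀ {M h} es → .{{NonZero M}} → Periodic M h → (∀ k → 0ℤ ℤ.≤ h k) → Tiles es h →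
  ∀ qs → All (λ q → Prime q × ¬ q ∣ M) qs → Tiles (map (product qs *_) es) h
tiles-coprime {h = h} es per h≥0 tiles [] _ k = trans (sumOver-map (1 *_) es (λ e → h (k + e)))
  (trans (sumOver-cong es (λ e → cong (λ x → h (k + x)) (ℕP.*-identityˡ e))) (tiles k))
tiles-coprime {h = h} es per h≥0 tiles (q ∷ qs) ((pq , q∤M) All.∷ rest) k = begin
  sumOver (map (q * t *_) es) (λ e → h (k + e))         ≡⟨ sumOver-map (q * t *_) es (λ e → h (k + e)) ⟩
  sumOver es (λ e → h (k + q * t * e))                  ≡⟨ sumOver-cong es (λ e → cong (λ x → h (k + x)) (ℕP.*-assoc q t e)) ⟩
  sumOver es (λ e → h (k + q * (t * e)))                ≡⟨ sumOver-map (t *_) es (λ e → h (k + q * e)) ⟨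
  sumOver (map (t *_) es) (λ e → h (k + q * e))         ≡⟨ sumOver-map (q *_) (map (t *_) es) (λ e → h (k + e)) ⟨
  sumOver (map (q *_) (map (t *_) es)) (λ e → h (k + e)) ≡⟨ tiles-dilate (map (t *_) es) per h≥0 pq q∤M (tiles-coprime es per h≥0 tiles qs rest) k ⟩
  1ℤ                                                    ∎
  where
  open ≡-Reasoning
  t = product qs

-- Proof of the theorem

prodFin-∣ : ∀ d (f g : Fin d → ℕ) → (∀ i → f i ∣ g i) → prodFin d f ∣ prodFin d g
prodFin-∣ zero f g f∣g = ∣-refl
prodFin-∣ (suc d) f g f∣g = *-pres-∣ (f∣g Fin.zero) (prodFin-∣ d (f ∘ Fin.suc) (g ∘ Fin.suc) (f∣g ∘ Fin.suc))

product-tabulate : ∀ d (f : Fin d → ℕ) → product (tabulate f) ≡ prodFin d f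
product-tabulate zero f = refl
product-tabulate (suc d) f = cong (f Fin.zero *_) (product-tabulate d (f ∘ Fin.suc))

x-1-∣-prodXs : ∀ d (s : Fin d → ℕ) i → x-1 (s i) ∣ᴾ prodXs (tabulate s)
x-1-∣-prodXs (suc d) s Fin.zero = prodXs (tabulate (s ∘ Fin.suc)) , ≋-refl
x-1-∣-prodXs (suc d) s (Fin.suc i) = ∣ᴾ-trans (x-1-∣-prodXs d (s ∘ Fin.suc) i) (x-1 (s Fin.zero) , *P-comm (x-1 (s Fin.zero)) _)

sumOver-*ˡ : ∀ c es h → c ℤ.* sumOver es h ≡ sumOver es (λ e → c ℤ.* h e)
sumOver-*ˡ c [] h = ℤP.*-zeroʳ c
sumOver-*ˡ c (e ∷ es) h = trans (ℤP.*-distribˡ-+ c (h e) (sumOver es h)) (cong (ℤ._+_ (c ℤ.* h e)) (sumOver-*ˡ c es h))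

sumOver-*ʳ : ∀ c es h → sumOver es h ℤ.* c ≡ sumOver es (λ e → h e ℤ.* c)
sumOver-*ʳ c es h = trans (ℤP.*-comm (sumOver es h) c) (trans (sumOver-*ˡ c es h) (sumOver-cong es (λ e → ℤP.*-comm c (h e))))

module TilingCase (d : ℕ) (i₀ : Fin d) (p : Fin d → ℕ) (pr : ∀ i → Prime (p i))
  (increasing : ∀ i j → toℕ i < toℕ j → p i < p j)
  (n : Fin d → ℕ) (n≥1 : ∀ i → 1 ≤ n i) (growth : ∀ j → 2 ^ (toℕ j ∸ 1) < p j)
  (M : ℕ) (M≡ : M ≡ prodFin d (λ i → p i ^ n i))
  (A B : Subset M) (tiling : IsTiling M A B) where

  open PrimePowers d p pr n n≥1 growth M M≡

  P : List ℕ
  P = tabulate p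

  P∣M : product P ∣ M
  P∣M = subst₂ _∣_ (sym (product-tabulate d p)) (sym M≡) (prodFin-∣ d p (λ i → p i ^ n i) (λ i → p∣pⁿ (p i) (n i) (n≥1 i)))

  Q : ℕ
  Q = _∣_.quotient P∣M

  PQ≡M : product P * Q ≡ M
  PQ≡M = trans (ℕP.*-comm (product P) Q) (sym (_∣_.equality P∣M))

  H : ℕ → ℤ
  H = W ⋆ hits B

  hits-periodic : Periodic M (hits B)
  hits-periodic = periodic-⋆ {h = multiple M} (mask B) (multiple-periodic M)

  H-periodic : Periodic M H
  H-periodic = periodic-⋆ {h = hits B} W hits-periodic

  W-kills : ∀ i {h} → Periodic (s i) h → ∀ k → (W ⋆ h) k ≡ 0ℤ
  W-kills i {h} per = x-1-kills-periodic {h = h} per (x-1-∣-prodXs d s i)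

  -- Sum g_B along the progression before applying W. The result `G` has period n, because Q n ≡ 0
  -- modulo M closes the progression, and period M, hence period gcd(n, M). This is a proper divisor
  -- of M and divides some M/p_i, so W annihilates `G`.
  H-vanishes : ∀ Q n → M ∣ Q * n → ¬ M ∣ n → ∀ k → sum< Q (λ t → H (k + t * n)) ≡ 0ℤ
  H-vanishes Q n M∣Qn M∤n k = begin
    sum< Q (λ t → H (k + t * n))     ≡⟨ sum<-cong Q (λ t _ → ⋆-shift W (hits B) (t * n) k) ⟨
    sum< Q (λ t → (W ⋆ λ i → hits B (i + t * n)) k)
                                     ≡⟨ ⋆-sum< W Q (λ t i → hits B (i + t * n)) k ⟨
    (W ⋆ G) k                        ≡⟨ W-kills (proj₁ covering) {G} (periodic-∣ {h = G} (periodic-gcd {h = G} G-periodic G-periodic′) (proj₂ covering)) k ⟩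
    0ℤ                               ∎
    where
    open ≡-Reasoning
    G : ℕ → ℤ
    G i = sum< Q (λ t → hits B (i + t * n))
    G-periodic : Periodic n G
    G-periodic i = trans (sum<-cong Q (λ t _ → cong (hits B) (ℕP.+-assoc i n (t * n))))
      (sum<-rotate Q (λ t → hits B (i + t * n)) (trans (periodic-∣ {h = hits B} hits-periodic M∣Qn i) (cong (hits B) (sym (ℕP.+-identityʳ i)))))
    G-periodic′ : Periodic M G
    G-periodic′ i = sum<-cong Q (λ t _ → trans (cong (hits B) (exchange i M (t * n))) (hits-periodic (i + t * n)))
      where
      exchange : ∀ i m x → i + m + x ≡ i + x + m
      exchange = ℕ-solve
    covering : ∃ λ i → gcd n M ∣ s i
    covering = cover (gcd[m,n]∣n n M) (ℕP.≤∧≢⇒< (∣⇒≤ (gcd[m,n]∣n n M)) (λ g≡M → M∤n (subst (_∣ n) g≡M (gcd[m,n]∣m n M))))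

  es : List ℕ
  es = elems A

  tiles : Tiles es (hits B)
  tiles = tiling⇒tiles A B tiling

  H-sum : ∀ t → Tiles (map (t *_) es) (hits B) → ∀ k → sumOver es (λ a → H (k + t * a)) ≡ 0ℤ
  H-sum t tiles′ k = begin
    sumOver es (λ a → H (k + t * a))          ≡⟨ sumOver-map (t *_) es (λ e → H (k + e)) ⟨
    sumOver (map (t *_) es) (λ e → H (k + e)) ≡⟨ ⋆-monos (map (t *_) es) H k ⟨
    (F ⋆ (W ⋆ hits B)) k                      ≡⟨ ⋆-comm F W (hits B) k ⟩
    (W ⋆ (F ⋆ hits B)) k                      ≡⟨ ⋆-cong W (λ i → trans (⋆-monos (map (t *_) es) (hits B) i) (tiles′ i)) k ⟩
    -- Here a prime factor of M is required: with none, W would be 1 and fix the constants.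
    (W ⋆ λ _ → 1ℤ) k                          ≡⟨ W-kills i₀ {λ _ → 1ℤ} (λ _ → refl) k ⟩
    0ℤ                                        ∎
    where
    open ≡-Reasoning
    F = monos (map (t *_) es)

  -- A nonzero χ means that no p_i divides t, so all prime factors of t are prime to M and the
  -- dilations by them compose. The value t = 0 is excluded because every p_i divides it.
  units-tile : ∀ t → χ P t ≢ 0ℤ → Tiles (map (t *_) es) (hits B)
  units-tile zero nz = contradiction (p i₀ ∣0) (All.tabulate⁻ (χ-≢0 P nz) i₀)
  units-tile t@(suc _) nz = subst (λ t → Tiles (map (t *_) es) (hits B)) (sym t≡)
    (tiles-coprime es hits-periodic (hits-≥0 B) tiles qs (All.tabulate λ q∈ → All.lookup qs-prime q∈ , λ q∣M → absurd q∈ q∣M))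
    where
    open PrimeFactorisation (factorise t) renaming (factors to qs; isFactorisation to t≡; factorsPrime to qs-prime)
    absurd : ∀ {q} → q ∈ₗ qs → ¬ q ∣ M
    absurd {q} q∈ q∣M = let i , q≡pᵢ = prime-∣-prodFin d p n pr (All.lookup qs-prime q∈) (subst (q ∣_) M≡ q∣M)
      in All.tabulate⁻ (χ-≢0 P nz) i (subst₂ _∣_ q≡pᵢ (sym t≡) (∈⇒∣product q∈))

  N : ℕ
  N = product P * Q

  c : ℕ → ℤ
  c = ramanujan M P Q 1

  weighted : ∀ l k → sumOver es (λ a → c (l + a)) ℤ.* H k ≡ 0ℤ
  weighted l k = begin
    sumOver es (λ a → c (l + a)) ℤ.* H k
      ≡⟨ sumOver-*ʳ (H k) es (λ a → c (l + a)) ⟩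
    sumOver es (λ a → c (l + a) ℤ.* H k)
      ≡⟨ sumOver-cong es (λ a → ramanujan-average H-periodic H-vanishes P Q 1 (l + a) (All.tabulate⁺ pr)
           (AP.tabulate⁺-< (λ {i} {j} i<j → ℕP.<⇒≢ (increasing i j i<j))) (trans (ℕP.*-identityʳ N) PQ≡M) k) ⟨
    sumOver es (λ a → sum< N (λ t → χ P t ℤ.* H (k + t * (1 * (l + a)))))
      ≡⟨ sumOver-sum< N es (λ t a → χ P t ℤ.* H (k + t * (1 * (l + a)))) ⟨
    sum< N (λ t → sumOver es (λ a → χ P t ℤ.* H (k + t * (1 * (l + a)))))
      ≡⟨ sum<-zero N (λ t _ → term t) ⟩
    0ℤ ∎
    where
    open ≡-Reasoning
    move : ∀ k t l a → k + t * (1 * (l + a)) ≡ k + t * l + t * a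
    move = ℕ-solve
    term : ∀ t → sumOver es (λ a → χ P t ℤ.* H (k + t * (1 * (l + a)))) ≡ 0ℤ
    term t = trans (sym (sumOver-*ˡ (χ P t) es (λ a → H (k + t * (1 * (l + a)))))) (vanish (χ P t ℤ.≟ 0ℤ))
      where
      vanish : Dec (χ P t ≡ 0ℤ) → χ P t ℤ.* sumOver es (λ a → H (k + t * (1 * (l + a)))) ≡ 0ℤ
      vanish (yes z) = cong (ℤ._* sumOver es (λ a → H (k + t * (1 * (l + a))))) z
      -- H(k + t (l + a)) is the summand of `H-sum` at the point k + t l.
      vanish (no nz) = trans (cong (ℤ._*_ (χ P t)) (trans (sumOver-cong es (λ a → cong H (move k t l a)))
        (H-sum t (units-tile t nz) (k + t * l)))) (ℤP.*-zeroʳ (χ P t))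

  -- `⋆-ramanujan` is applied to f = W A(X): it equates M (W g_A) with W applied to the sequence A
  -- c, and `weighted` makes A c zero wherever it is evaluated, because H(k) can be cancelled.
  W-kills-A : ∀ k → H k ≢ 0ℤ → ∀ l → (W ⋆ hits A) l ≡ 0ℤ
  W-kills-A k Hk≢0 l = [ (λ M≡0 → contradiction (trans (sym PQ≡M) (ℤP.+-injective M≡0)) (ℕ.≢-nonZero⁻¹ M)) , id ]′
    (ℤP.i*j≡0⇒i≡0∨j≡0 (ℤ.+ N) (begin
      ℤ.+ N ℤ.* (W ⋆ hits A) l                      ≡⟨ cong (ℤ._*_ (ℤ.+ N)) (⋆-* W (mask A) (multiple M) l) ⟨
      ℤ.+ N ℤ.* (W *P mask A ⋆ multiple M) l        ≡⟨ ⋆-ramanujan P Q (All.tabulate⁺ divides-product) l ⟨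
      (W *P mask A ⋆ c) l                           ≡⟨ ⋆-* W (mask A) c l ⟩
      (W ⋆ (mask A ⋆ c)) l                          ≡⟨ ⋆-cong W A-kills-c l ⟩
      (W ⋆ λ _ → 0ℤ) l                              ≡⟨ ⋆-0 W l ⟩
      0ℤ                                            ∎))
    where
    open ≡-Reasoning
    divides-product : ∀ i → ∃ λ u → M ∣ p i * u × x-1 u ∣ᴾ W *P mask A
    divides-product i = s i , ∣-reflexive (sym (p*s≡M i)) , ∣ᴾ-trans (x-1-∣-prodXs d s i) (mask A , ≋-refl)
    A-kills-c : ∀ l → (mask A ⋆ c) l ≡ 0ℤ
    A-kills-c l = [ id , (λ Hk≡0 → contradiction Hk≡0 Hk≢0) ]′ (ℤP.i*j≡0⇒i≡0∨j≡0 ((mask A ⋆ c) l)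
      (trans (cong (ℤ._* H k) (trans (⋆-mask A c l) (sumSet-elems A (λ a → c (l + a))))) (weighted l k)))

  tiling-case : ∃[ i ] (InDiv M (s i) A ⊎ InDiv M (s i) B)
  tiling-case with InDiv? A | InDiv? B
  ... | yes (i , inA) | _ = i , inj₁ inA
  ... | no _ | yes (i , inB) = i , inj₂ inB
  -- Covering a single residue shows that both tiles are nonempty, as the cuboid argument requires a
  -- starting point.
  ... | no noneA | no noneB with proj₁ tiling (proj₁ (complement M 0))
  ... | a , b , a∈ , b∈ , _ = ⊥-elim (W-kills⇒InDiv B (b , b∈) H≡0 noneB)
    where
    H≡0 : ∀ k → H k ≡ 0ℤ
    H≡0 k = decidable-stable (H k ℤ.≟ 0ℤ) λ Hk≢0 → W-kills⇒InDiv A (a , a∈) (W-kills-A k Hk≢0) noneA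

-- Growth of the primes

¬prime-even : ∀ h {q} → q ≡ 2 * h → 1 < h → ¬ Prime q
¬prime-even h {q} refl 1<h pr with prime⇒irreducible pr (m∣m*n {2} h)
... | inj₁ ()
... | inj₂ 2≡q = ℕP.<⇒≢ (ℕP.*-monoʳ-< 2 1<h) 2≡q

-- The prime r is at least 2h and cannot equal 2h, which is composite for h > 1.
next-odd : ∀ h {q r} → 1 < h → q < r → Prime r → 2 * h ≤ suc q → suc (2 * h) ≤ r
next-odd h {q} {r} 1<h q<r pr le = ℕP.≤∧≢⇒< (ℕP.≤-trans le q<r) (λ eq → ¬prime-even h (sym eq) 1<h pr)

-- Indices start at 0, so the bounds to beat are 1, 1, 2, 4, 8, and increasing primes are at least
-- 2, 3, 5, 7, 9 by parity alone. The next bound is 16, which the sixth prime 13 fails; hence the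
-- hypothesis from index 5 on.
prime-growth : ∀ d (p : Fin d → ℕ) → (∀ i → Prime (p i)) → (∀ i j → toℕ i < toℕ j → p i < p j) →
  (∀ j → 5 ≤ toℕ j → 2 ^ (toℕ j ∸ 1) < p j) → ∀ j → 2 ^ (toℕ j ∸ 1) < p j
prime-growth d p pr increasing large j with 5 ≤? toℕ j
... | yes 5≤j = large j 5≤j
... | no 5≰j = small (toℕ j) refl (ℕP.≰⇒> 5≰j)
  where
  previous : ∀ k (j : Fin d) → toℕ j ≡ suc k → ∃ λ i → toℕ i ≡ k × p i < p j
  previous k j eq = i , i≡k , increasing i j (subst₂ _<_ (sym i≡k) (sym eq) (ℕP.n<1+n k))
    where
    k<d : k < d
    k<d = ℕP.<-trans (ℕP.n<1+n k) (subst (_< d) eq (Fin.toℕ<n j))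
    i = Fin.fromℕ< k<d
    i≡k = Fin.toℕ-fromℕ< k<d
  p₀ : ∀ j → 2 ≤ p j
  p₀ j = ℕ.nonTrivial⇒n>1 (p j) {{prime⇒nonTrivial (pr j)}}
  p₁ : ∀ j → toℕ j ≡ 1 → 3 ≤ p j
  p₁ j eq = let i , _ , lt = previous 0 j eq in ℕP.≤-trans (s≤s (p₀ i)) lt
  p₂ : ∀ j → toℕ j ≡ 2 → 5 ≤ p j
  p₂ j eq = let i , e , lt = previous 1 j eq in next-odd 2 (s≤s (s≤s z≤n)) lt (pr j) (s≤s (p₁ i e))
  p₃ : ∀ j → toℕ j ≡ 3 → 7 ≤ p j
  p₃ j eq = let i , e , lt = previous 2 j eq in next-odd 3 (s≤s (s≤s z≤n)) lt (pr j) (s≤s (p₂ i e))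
  p₄ : ∀ j → toℕ j ≡ 4 → 9 ≤ p j
  p₄ j eq = let i , e , lt = previous 3 j eq in next-odd 4 (s≤s (s≤s z≤n)) lt (pr j) (s≤s (p₃ i e))
  small : ∀ k → toℕ j ≡ k → k < 5 → 2 ^ (k ∸ 1) < p j
  small 0 eq _ = p₀ j
  small 1 eq _ = p₀ j
  small 2 eq _ = ℕP.≤-trans (ℕP.m≤m+n 3 2) (p₂ j eq)
  small 3 eq _ = ℕP.≤-trans (ℕP.m≤m+n 5 2) (p₃ j eq)
  small 4 eq _ = p₄ j eq
  small (suc (suc (suc (suc (suc k))))) eq (s≤s (s≤s (s≤s (s≤s (s≤s ())))))

theorem1p3 : (d : ℕ) → 1 ≤ d →
    (p : Fin d → ℕ) → (pr : ∀ i → Prime (p i)) →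
    (∀ (i j : Fin d) → toℕ i < toℕ j → p i < p j) →
    (n : Fin d → ℕ) → (∀ i → 1 ≤ n i) →
    (∀ (j : Fin d) → 5 ≤ toℕ j → 2 ^ (toℕ j ∸ 1) < p j) →
    (M : ℕ) → M ≡ prodFin d (λ i → p i ^ n i) →
    ((A : Subset M) → Nonempty A → Φ M ∣P mask A →
    ∃[ i ] InDiv M (_/_ M (p i) {{prime⇒nonZero (pr i)}}) A)
    × ((A B : Subset M) → IsTiling M A B →
    ∃[ i ] (InDiv M (_/_ M (p i) {{prime⇒nonZero (pr i)}}) A
    ⊎ InDiv M (_/_ M (p i) {{prime⇒nonZero (pr i)}}) B))
theorem1p3 (suc d) _ p pr increasing n n≥1 large M M≡ =
  PrimePowers.cyclotomic-case (suc d) p pr n n≥1 growth M M≡ ,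
  TilingCase.tiling-case (suc d) Fin.zero p pr increasing n n≥1 growth M M≡
  where
  growth : ∀ j → 2 ^ (toℕ j ∸ 1) < p j
  growth = prime-growth (suc d) p pr increasing large
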